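{- Let $\ell$ be an odd prime. Assume that the number of primes $p\in S^1(\ell,T)$ that are essential for $\Phi_\ell(X)$ is $o(T)$ as $T\to\infty$. Then $|S^2(\ell,T)|=o(T)$ as $T\to\infty$.
   Context: $\Phi_\ell(X)$ denotes the $\ell$-th cyclotomic polynomial. For a natural number $n$, $R_\ell(n):=\min\{d\in\mathbb{N}: n\mid \Phi_\ell(d)\}$ if such $d$ exists, and $R_\ell(n)=\infty$ otherwise. $\mathbb{P}$ denotes the set of primes $p$ that divide $\Phi_\ell(d)$ for some $d\in\mathbb{N}$. For a positive integer $i$ and real $T$, $S^i(\ell,T):=\{p\in\mathbb{P}: R_\ell(p^i)\le T\}$. A prime $p$ is called essential for $\Phi_\ell(X)$ if for every integer $c$ with $|cp|<\Phi_\ell(p^{2/\ell})$ the polynomial $\Phi_\ell(X)-cp$ is irreducible over $\mathbb{Q}$. -}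

module Defs where

open import Level using (0ℓ)
open import Algebra.Bundles using (RawRing; RawSemiring)
import Algebra.Definitions.RawSemiring as RawSemiringDefinitions
open import Data.Empty using (⊥)
open import Data.Fin.Base using (Fin; toℕ)
open import Data.Fin.Properties using (toℕ<n)
open import Data.Integer.Base as ℤ using (ℤ; +_; -[1+_]; 1ℤ)
import Data.Integer.Divisibility as ℤ
open import Data.List.Base using (List; []; _∷_; _++_; length; map; foldr; filter; replicate; take; allFin)
open import Data.List.Relation.Unary.All using (All)
open import Data.List.Relation.Unary.Unique.Propositional using (Unique)
open import Data.Nat.Base as ℕ using (ℕ; zero; suc; NonZero)
open import Data.Nat.Divisibility using (_∣?_)
open import Data.Nat.Induction using (<-wellFounded)
open import Data.Nat.Primality using (Prime)
open import Data.Product using (Σ; ∃; ∃-syntax; _×_; _,_)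
open import Data.Rational.Base as ℚ using (ℚ; 0ℚ; 1ℚ; _<_; _≤_; _/_)
import Data.Rational.Properties as ℚ
open import Data.Sum.Base using (_⊎_; inj₁; inj₂)
open import Induction.WellFounded using (Acc; acc)
open import Relation.Binary.PropositionalEquality using (_≡_; refl; subst; sym)
open import Relation.Nullary using (¬_)
open import Relation.Nullary.Construct.Add.Supremum using (_⁺; ⊤⁺; [_])

open RawSemiringDefinitions ℚ.+-*-rawSemiring using (_^_)

-- Univariate polynomials as coefficient lists, constant term first.
-- Trailing zeros are allowed, so equality of polynomials is _≈ₚ_ rather
-- than _≡_ on lists.

module Polynomial (R : RawRing 0ℓ 0ℓ) where
  open RawRing R

  Poly : Set
  Poly = List Carrier

  coeff : Poly → ℕ → Carrier
  coeff []      _       = 0#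
  coeff (a ∷ f) zero    = a
  coeff (a ∷ f) (suc n) = coeff f n

  infix 4 _≈ₚ_
  _≈ₚ_ : Poly → Poly → Set
  f ≈ₚ g = ∀ n → coeff f n ≈ coeff g n

  const : Carrier → Poly
  const a = a ∷ []

  X^_ : ℕ → Poly
  X^ n = replicate n 0# ++ const 1#

  scale : Carrier → Poly → Poly
  scale a = map (a *_)

  infixl 6 _+ₚ_ _-ₚ_
  infixl 7 _*ₚ_

  _+ₚ_ : Poly → Poly → Poly
  []      +ₚ g       = g
  (a ∷ f) +ₚ []      = a ∷ f
  (a ∷ f) +ₚ (b ∷ g) = (a + b) ∷ (f +ₚ g)

  _-ₚ_ : Poly → Poly → Poly
  f -ₚ g = f +ₚ map -_ g

  _*ₚ_ : Poly → Poly → Poly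
  []      *ₚ g = []
  (a ∷ f) *ₚ g = scale a g +ₚ (0# ∷ (f *ₚ g))

  eval : Poly → Carrier → Carrier
  eval []      x = 0#
  eval (a ∷ f) x = a + x * eval f x

  -- Division with remainder by a monic g of degree m.  From f = q g + r it
  -- follows that a + X f = (c + X q) g + (a + X r - c g), where c is the
  -- coefficient of X^m in a + X r.

  divMod : (m : ℕ) (g f : Poly) → Poly × Poly
  divMod m g []      = [] , []
  divMod m g (a ∷ f) =
    let q , r = divMod m g f
        c     = coeff (a ∷ r) m
    in  c ∷ q , (a ∷ r) -ₚ scale c g

  -- Quotient of f by g, for g monic and written without trailing zeros.
  -- The last m coefficients computed by divMod vanish and are dropped, so
  -- that the quotient of two such lists is again of this form.

  infixl 7 _÷_
  _÷_ : Poly → Poly → Poly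
  f ÷ g = let m = length g ℕ.∸ 1
              q , _ = divMod m g f
          in  take (length f ℕ.∸ m) q

  polyRawSemiring : RawSemiring 0ℓ 0ℓ
  polyRawSemiring = record
    { Carrier = Poly
    ; _≈_     = _≈ₚ_
    ; _+_     = _+ₚ_
    ; _*_     = _*ₚ_
    ; 0#      = []
    ; 1#      = const 1#
    }

module ℤ[X] = Polynomial ℤ.+-*-rawRing
module ℚ[X] = Polynomial ℚ.+-*-rawRing

Irreducible : ℚ[X].Poly → Set
Irreducible = RawSemiringDefinitions.Irreducible ℚ[X].polyRawSemiring

fromℤ : ℤ → ℚ
fromℤ z = z / 1

fromℕ : ℕ → ℚ
fromℕ n = fromℤ (+ n)

toℚ[X] : ℤ[X].Poly → ℚ[X].Poly
toℚ[X] = map fromℤ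

-- Cyclotomic polynomials, from X^n - 1 = ∏_{d ∣ n} Φ_d by recursion over
-- the proper divisors of n.  Only n ≥ 1 is meaningful.

cyclotomic : (n : ℕ) → Acc ℕ._<_ n → ℤ[X].Poly
cyclotomic n (acc rec) =
  (X^ n -ₚ const 1ℤ) ÷
  foldr _*ₚ_ (const 1ℤ)
    (map (λ d → cyclotomic (toℕ d) (rec (toℕ<n d)))
         (filter (λ d → toℕ d ∣? n) (allFin n)))
  where open ℤ[X]

Φ : ℕ → ℤ[X].Poly
Φ n = cyclotomic n (<-wellFounded n)

_ : Φ 5 ≡ + 1 ∷ + 1 ∷ + 1 ∷ + 1 ∷ + 1 ∷ []
_ = refl

_ : Φ 12 ≡ + 1 ∷ + 0 ∷ -[1+ 0 ] ∷ + 0 ∷ + 1 ∷ []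
_ = refl

-- Two-sided Dedekind cuts: lower q means q < x, upper q means x < q.

record ℝ : Set₁ where
  field
    lower upper     : ℚ → Set
    lower-inhabited : ∃ lower
    upper-inhabited : ∃ upper
    lower-down      : ∀ {q r} → q < r → lower r → lower q
    lower-open      : ∀ {q} → lower q → ∃[ r ] q < r × lower r
    upper-up        : ∀ {q r} → q < r → upper q → upper r
    upper-open      : ∀ {q} → upper q → ∃[ r ] r < q × upper r
    disjoint        : ∀ {q} → lower q → ¬ upper q
    located         : ∀ {q r} → q < r → lower q ⊎ upper r

infix 4 _<ˡ_ _<ʳ_ _≤ˡ_ _≤_·_

_<ˡ_ : ℚ → ℝ → Set
q <ˡ x = ℝ.lower x q

_<ʳ_ : ℝ → ℚ → Set
x <ʳ q = ℝ.upper x q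

_≤ˡ_ : ℚ → ℝ → Set
a ≤ˡ x = ∀ q → x <ʳ q → a ≤ q

-- a ≤ ε · x for ε > 0.
_≤_·_ : ℚ → ℚ → ℝ → Set
a ≤ ε · x = ∀ q → x <ʳ q → a ≤ ε ℚ.* q

^-nonNeg : ∀ {q} → 0ℚ ≤ q → ∀ n → 0ℚ ≤ q ^ n
^-nonNeg {q} 0≤q zero    = ℚ.*≤* (ℤ.+≤+ ℕ.z≤n)
^-nonNeg {q} 0≤q (suc n) =
  ℚ.nonNegative⁻¹ (q ℚ.* q ^ n)
    {{ℚ.nonNeg*nonNeg⇒nonNeg q {{ℚ.nonNegative 0≤q}}
        (q ^ n) {{ℚ.nonNegative (^-nonNeg 0≤q n)}}}}

^-mono-≤ : ∀ {q r} → 0ℚ ≤ q → q ≤ r → ∀ n → q ^ n ≤ r ^ n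
^-mono-≤         0≤q q≤r zero    = ℚ.≤-refl
^-mono-≤ {q} {r} 0≤q q≤r (suc n) = ℚ.≤-trans
  (ℚ.*-monoˡ-≤-nonNeg q {{ℚ.nonNegative 0≤q}} (^-mono-≤ 0≤q q≤r n))
  (ℚ.*-monoʳ-≤-nonNeg (r ^ n) {{ℚ.nonNegative (^-nonNeg (ℚ.≤-trans 0≤q q≤r) n)}} q≤r)

^-pos : ∀ {r} → 0ℚ < r → ∀ n → 0ℚ < r ^ n
^-pos {r} 0<r zero    = ℚ.*<* (ℤ.+<+ (ℕ.s≤s ℕ.z≤n))
^-pos {r} 0<r (suc n) =
  ℚ.positive⁻¹ (r ℚ.* r ^ n)
    {{ℚ.pos*pos⇒pos r {{ℚ.positive 0<r}} (r ^ n) {{ℚ.positive (^-pos 0<r n)}}}}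

^-mono-< : ∀ {q r} → 0ℚ ≤ q → q < r → ∀ n .{{_ : NonZero n}} → q ^ n < r ^ n
^-mono-< {q} {r} 0≤q q<r (suc n) = ℚ.≤-<-trans
  (ℚ.*-monoˡ-≤-nonNeg q {{ℚ.nonNegative 0≤q}} (^-mono-≤ 0≤q (ℚ.<⇒≤ q<r) n))
  (ℚ.*-monoˡ-<-pos (r ^ n) {{ℚ.positive (^-pos (ℚ.≤-<-trans 0≤q q<r) n)}} q<r)

0≤fromℕ : ∀ n → 0ℚ ≤ fromℕ n
0≤fromℕ n = ℚ.nonNegative⁻¹ (fromℕ n) {{ℚ.normalize-nonNeg n 1}}

p<p+1 : ∀ p → p < p ℚ.+ 1ℚ
p<p+1 p = subst (_< p ℚ.+ 1ℚ) (ℚ.+-identityʳ p)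
  (ℚ.+-monoʳ-< p {0ℚ} {1ℚ} (ℚ.*<* (ℤ.+<+ (ℕ.s≤s ℕ.z≤n))))

n≤[n+1]^k : ∀ n k .{{_ : NonZero k}} → fromℕ n ≤ (fromℕ n ℚ.+ 1ℚ) ^ k
n≤[n+1]^k n (suc k) = ℚ.≤-trans (ℚ.<⇒≤ (p<p+1 (fromℕ n)))
  (subst (_≤ r ℚ.* r ^ k) (ℚ.*-identityʳ r)
    (ℚ.*-monoˡ-≤-nonNeg r {{ℚ.nonNegative 0≤r}} (1≤^ k)))
  where
  r = fromℕ n ℚ.+ 1ℚ

  1≤r : 1ℚ ≤ r
  1≤r = subst (_≤ r) (ℚ.+-identityˡ 1ℚ) (ℚ.+-monoˡ-≤ 1ℚ (0≤fromℕ n))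

  0≤r : 0ℚ ≤ r
  0≤r = ℚ.≤-trans (ℚ.*≤* (ℤ.+≤+ ℕ.z≤n)) 1≤r

  1≤^ : ∀ k → 1ℚ ≤ r ^ k
  1≤^ zero    = ℚ.≤-refl
  1≤^ (suc k) = subst (_≤ r ^ suc k) (ℚ.*-identityʳ 1ℚ) (ℚ.≤-trans
    (ℚ.*-monoˡ-≤-nonNeg 1ℚ (1≤^ k))
    (ℚ.*-monoʳ-≤-nonNeg (r ^ k) {{ℚ.nonNegative (^-nonNeg 0≤r k)}} 1≤r))

-- The nonnegative k-th root of N.  The extra r makes both cuts open by
-- density of ℚ.

root : (k : ℕ) .{{_ : NonZero k}} → ℕ → ℝ
root k N = record
  { lower           = Lower
  ; upper           = Upper
  ; lower-inhabited = ℚ.- 1ℚ , 0ℚ , ℚ.*<* ℤ.-<+ , ℚ.≤-refl , 0^k≤N k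
  ; upper-inhabited = n+1 ℚ.+ 1ℚ , n+1 , p<p+1 n+1
                    , ℚ.≤-trans (0≤fromℕ N) (ℚ.<⇒≤ (p<p+1 (fromℕ N)))
                    , n≤[n+1]^k N k
  ; lower-down      = λ { q<r (s , r<s , rest) → s , ℚ.<-trans q<r r<s , rest }
  ; lower-open      = λ { (s , q<s , rest) →
                        let m , q<m , m<s = ℚ.<-dense q<s in m , q<m , s , m<s , rest }
  ; upper-up        = λ { q<r (s , s<q , rest) → s , ℚ.<-trans s<q q<r , rest }
  ; upper-open      = λ { (s , s<q , rest) →
                        let m , s<m , m<q = ℚ.<-dense s<q in m , m<q , s , s<m , rest }
  ; disjoint        = λ { (s , q<s , 0≤s , s^k≤N) (t , t<q , 0≤t , N≤t^k) →
                        ℚ.<-irrefl refl (ℚ.≤-<-trans (ℚ.≤-trans s^k≤N N≤t^k)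
                          (^-mono-< 0≤t (ℚ.<-trans t<q q<s) k)) }
  ; located         = located
  }
  where
  Lower Upper : ℚ → Set
  Lower q = ∃[ r ] q < r × 0ℚ ≤ r × r ^ k ≤ fromℕ N
  Upper q = ∃[ r ] r < q × 0ℚ ≤ r × fromℕ N ≤ r ^ k

  n+1 = fromℕ N ℚ.+ 1ℚ

  0^k≤N : ∀ k .{{_ : NonZero k}} → 0ℚ ^ k ≤ fromℕ N
  0^k≤N (suc k) = subst (_≤ fromℕ N) (sym (ℚ.*-zeroˡ (0ℚ ^ k))) (0≤fromℕ N)

  located : ∀ {q r} → q < r → Lower q ⊎ Upper r
  located q<r with ℚ.<-dense q<r
  ... | m , q<m , m<r with ℚ.≤-total 0ℚ m
  ...   | inj₂ m≤0 = inj₁ (0ℚ , ℚ.<-≤-trans q<m m≤0 , ℚ.≤-refl , 0^k≤N k)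
  ...   | inj₁ 0≤m with ℚ.≤-total (m ^ k) (fromℕ N)
  ...     | inj₁ m^k≤N = inj₁ (m , q<m , 0≤m , m^k≤N)
  ...     | inj₂ N≤m^k = inj₂ (m , m<r , 0≤m , N≤m^k)

-- c <eval F at x  means c < F(x): as F is continuous, this holds exactly
-- when F exceeds some c′ > c at all rational points of some open interval
-- with rational endpoints around x.

infix 4 _<eval_at_
_<eval_at_ : ℚ → ℚ[X].Poly → ℝ → Set
c <eval F at x =
  ∃[ a ] ∃[ b ] a <ˡ x × x <ʳ b × ∃[ c′ ] c < c′ ×
    (∀ q → a < q → q < b → c′ ≤ ℚ[X].eval F q)

infix 4 _∣Φ[_]at_
_∣Φ[_]at_ : ℕ → ℕ → ℕ → Set
n ∣Φ[ ℓ ]at d = + n ℤ.∣ ℤ[X].eval (Φ ℓ) (+ d)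

-- IsR ℓ n r  means R_ℓ(n) = r, with ⊤⁺ in the role of ∞.

IsR : ℕ → ℕ → ℕ ⁺ → Set
IsR ℓ n [ r ] = n ∣Φ[ ℓ ]at r × (∀ d → n ∣Φ[ ℓ ]at d → r ℕ.≤ d)
IsR ℓ n ⊤⁺    = ∀ d → ¬ n ∣Φ[ ℓ ]at d

infix 4 _≤⁺_
_≤⁺_ : ℕ ⁺ → ℝ → Set
[ r ] ≤⁺ T = fromℕ r ≤ˡ T
⊤⁺    ≤⁺ T = ⊥

-- The set of primes dividing some value of Φ_ℓ.

ℙ : ℕ → ℕ → Set
ℙ ℓ p = Prime p × ∃[ d ] p ∣Φ[ ℓ ]at d

S : ℕ → ℕ → ℝ → ℕ → Set
S i ℓ T p = ℙ ℓ p × ∃[ r ] IsR ℓ (p ℕ.^ i) r × r ≤⁺ T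

-- p^{2/ℓ} is the ℓ-th root of p².

Essential : (ℓ : ℕ) .{{_ : NonZero ℓ}} → ℕ → Set
Essential ℓ p = Prime p ×
  (∀ c → fromℕ ℤ.∣ c ℤ.* + p ∣ <eval toℚ[X] (Φ ℓ) at root ℓ (p ℕ.^ 2) →
     Irreducible (toℚ[X] (Φ ℓ) -ₚ const (fromℤ (c ℤ.* + p))))
  where open ℚ[X]

-- |A| ≤ ε · x for a set A of natural numbers, phrased by finite lists of
-- distinct elements since membership in A need not be decidable.

∣_∣≤_·_ : (ℕ → Set) → ℚ → ℝ → Set
∣ A ∣≤ ε · x = ∀ xs → Unique xs → All A xs → fromℕ (length xs) ≤ ε · x

-- |A T| = o(T) as T → ∞.

∣_∣=o[T] : (ℝ → ℕ → Set) → Set₁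
∣ A ∣=o[T] = ∀ ε → 0ℚ < ε → Σ ℚ λ T₀ → ∀ T → T₀ ≤ˡ T → ∣ A T ∣≤ ε · T

-- Let p² ∣ Φ_ℓ(r) with r ≤ M, so that p² ≤ ℓ M^(ℓ-1).  Hence for every
-- constant X there is R ≤ M / X with p² ≤ R^ℓ once M is large.  If p is not
-- essential, some Φ_ℓ - N with p ∣ N and ∣ N ∣ < Φ_ℓ(R) has a monic integer
-- factor f of degree 0 < k < ℓ - 1.  The subleading coefficient a of f is
-- O(R), because the roots of Φ_ℓ - N are.  Modulo p the polynomial Φ_ℓ - N
-- splits with the roots d, d², …, d^(ℓ-1) for any root d of Φ_ℓ, so
-- a + Σ_{i ∈ I} d^i ≡ 0 for some set I of k exponents, and p divides a nonzero
-- integer, of size polynomial in R, in the ideal generated by Φ_ℓ and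
-- a + Σ_{i ∈ I} X^i; it exists because Φ_ℓ is irreducible.  There are O(R)
-- pairs (a , I), and each accounts for O(1) primes p ≥ R, so all but O(R)
-- primes of S²(ℓ, T) are essential.  As X is arbitrary, this is o(T).

module Submission where

open import Level using (0ℓ)
open import Algebra.Bundles using (CommutativeMonoid; CommutativeRing; RawSemiring)
import Algebra.Properties.CommutativeSemigroup as CommutativeSemigroup
open import Data.Bool.Base using (Bool; true; false; not)
open import Data.Empty using (⊥; ⊥-elim)
open import Data.Fin.Base as Fin using (Fin; toℕ)
import Data.Fin.Properties as Fin
open import Data.Integer.Base as ℤ using (ℤ; +_; -[1+_]; 0ℤ; 1ℤ; ∣_∣; _+_; _*_; _-_; -_)
open import Data.Integer.Divisibility.Signed as ℤ using (_∣_; divides)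
import Data.Integer.Properties as ℤ
open import Data.Integer.Tactic.RingSolver using (solve-∀)
open import Data.List.Base as List using (List; []; _∷_; _++_; replicate; length)
import Data.List.Properties as List
open import Data.List.Relation.Unary.All as All using (All; []; _∷_)
import Data.List.Relation.Unary.All.Properties as All
open import Data.List.Relation.Unary.AllPairs using (AllPairs; []; _∷_)
import Data.List.Relation.Unary.AllPairs.Properties as AllPairs
open import Data.List.Relation.Unary.Unique.Propositional using (Unique)
import Data.List.Relation.Unary.Unique.Propositional.Properties as Unique
open import Data.Nat.Base as ℕ using (ℕ; zero; suc; NonZero; _≤_; _<_; z≤n; s≤s; _^_)
open import Data.Nat.Combinatorics using (_C_; nC1≡n; k>n⇒nCk≡0; nCk+nC[k+1]≡[n+1]C[k+1])
import Data.Nat.Coprimality as Coprime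
open import Data.Nat.Divisibility using (_∤_)
import Data.Nat.Divisibility as ℕ
import Data.Nat.DivMod as ℕ
open import Data.Nat.GCD using (module Bézout)
open import Data.Nat.Induction using (<-wellFounded)
open import Data.Nat.ListAction using (product)
open import Data.Nat.Primality using (Prime; ¬prime[0]; ¬prime[1]; euclidsLemma; prime⇒nonTrivial; prime⇒irreducible)
open import Data.Nat.Primality.Factorisation using (factorise; PrimeFactorisation; factorisationHasAllPrimeFactors)
import Data.Nat.Properties as ℕ
open import Data.Nat.Tactic.RingSolver using () renaming (solve-∀ to ℕ-solve-∀)
open import Data.Product using (∃; ∃₂; _×_; _,_; proj₁; proj₂)
open import Data.Rational.Base as ℚ using (ℚ; 0ℚ; 1ℚ; mkℚ)
import Data.Rational.Properties as ℚ
import Data.Rational.Unnormalised.Base as ℚᵘ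
open import Data.Sum.Base as Sum using (_⊎_; inj₁; inj₂; [_,_]′)
open import Data.Vec.Base as Vec using (Vec; []; _∷_)
open import Function.Base using (_∘_; id; case_of_)
open import Induction.WellFounded using (Acc; acc)
open import Relation.Binary.Definitions using (tri<; tri≈; tri>)
open import Relation.Binary.PropositionalEquality
  using (_≡_; _≢_; refl; sym; trans; cong; cong₂; subst; subst₂; module ≡-Reasoning)
open import Relation.Nullary using (¬_; Dec; yes; no; ¬?; contradiction)
open import Relation.Nullary.Construct.Add.Supremum using ([_])
open import Defs
open import Algebra.Definitions.RawMagma (RawSemiring.*-rawMagma ℚ[X].polyRawSemiring)
  using () renaming (_,_ to _,∣_)
open import Algebra.Definitions.RawSemiring ℚ.+-*-rawSemiring using () renaming (_^_ to _^ℚ_)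
open import Algebra.Definitions.RawSemiring ℚ[X].polyRawSemiring using (mkIrred) renaming (_∣_ to _∣ℚ_)

-- Only the subleading coefficient is used because it is linear in R: a coefficient j places below
-- the top may be of order R^j, which allows too many values. Two obstacles shape the rest. The
-- roots of Φ_ℓ - N are algebraic numbers, so both their size and their residues modulo p are
-- replaced by divided differences at integer points; one interpolation argument, with two notions
-- of smallness, serves both. The integer in the ideal would classically be a resultant; here it
-- comes from repeated pseudo-division, along which a bound on the coefficients is carried. The
-- integers for all pairs (a , I) are finally multiplied together, so that one comparison of sizes
-- counts all the exceptional primes.

-- Values and coefficients of polynomials over a commutative ring

module Evaluation (R : CommutativeRing 0ℓ 0ℓ) where
  open CommutativeRing R renaming (Carrier to A; _+_ to _⊕_; _*_ to _⊗_; -_ to ⊖_)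
    hiding (refl; sym; trans; ring)
  open CommutativeRing R using () renaming (refl to ≈-refl; sym to ≈-sym; trans to ≈-trans)
  open Polynomial rawRing
  open import Relation.Binary.Reasoning.Setoid setoid

  open import Algebra.Properties.CommutativeSemigroup +-commutativeSemigroup using (interchange)
  open import Algebra.Properties.CommutativeSemigroup *-commutativeSemigroup using (x∙yz≈y∙xz)
  open import Algebra.Properties.Ring (CommutativeRing.ring R)
    using (-0#≈0#; -‿distribʳ-*; -‿+-comm)

  eval-+ₚ : ∀ f g x → eval (f +ₚ g) x ≈ eval f x ⊕ eval g x
  eval-+ₚ []      g       x = ≈-sym (+-identityˡ _)
  eval-+ₚ (a ∷ f) []      x = ≈-sym (+-identityʳ _)
  eval-+ₚ (a ∷ f) (b ∷ g) x = begin
    (a ⊕ b) ⊕ x ⊗ eval (f +ₚ g) x           ≈⟨ +-congˡ (*-congˡ (eval-+ₚ f g x)) ⟩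
    (a ⊕ b) ⊕ x ⊗ (eval f x ⊕ eval g x)     ≈⟨ +-congˡ (distribˡ _ _ _) ⟩
    (a ⊕ b) ⊕ (x ⊗ eval f x ⊕ x ⊗ eval g x) ≈⟨ interchange _ _ _ _ ⟩
    (a ⊕ x ⊗ eval f x) ⊕ (b ⊕ x ⊗ eval g x) ∎

  eval-scale : ∀ c f x → eval (scale c f) x ≈ c ⊗ eval f x
  eval-scale c []      x = ≈-sym (zeroʳ c)
  eval-scale c (a ∷ f) x = begin
    c ⊗ a ⊕ x ⊗ eval (scale c f) x ≈⟨ +-congˡ (*-congˡ (eval-scale c f x)) ⟩
    c ⊗ a ⊕ x ⊗ (c ⊗ eval f x)     ≈⟨ +-congˡ (x∙yz≈y∙xz _ _ _) ⟩
    c ⊗ a ⊕ c ⊗ (x ⊗ eval f x)     ≈⟨ distribˡ _ _ _ ⟨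
    c ⊗ (a ⊕ x ⊗ eval f x)         ∎

  eval-neg : ∀ f x → eval (List.map ⊖_ f) x ≈ ⊖ eval f x
  eval-neg []      x = ≈-sym -0#≈0#
  eval-neg (a ∷ f) x = begin
    ⊖ a ⊕ x ⊗ eval (List.map ⊖_ f) x ≈⟨ +-congˡ (*-congˡ (eval-neg f x)) ⟩
    ⊖ a ⊕ x ⊗ (⊖ eval f x)           ≈⟨ +-congˡ (-‿distribʳ-* _ _) ⟨
    ⊖ a ⊕ ⊖ (x ⊗ eval f x)           ≈⟨ -‿+-comm _ _ ⟩
    ⊖ (a ⊕ x ⊗ eval f x)             ∎

  eval-const : ∀ c x → eval (const c) x ≈ c
  eval-const c x = ≈-trans (+-congˡ (zeroʳ x)) (+-identityʳ c)

  eval-*ₚ : ∀ f g x → eval (f *ₚ g) x ≈ eval f x ⊗ eval g x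
  eval-*ₚ []      g x = ≈-sym (zeroˡ _)
  eval-*ₚ (a ∷ f) g x = begin
    eval (scale a g +ₚ (0# ∷ f *ₚ g)) x        ≈⟨ eval-+ₚ (scale a g) _ x ⟩
    eval (scale a g) x ⊕ (0# ⊕ x ⊗ eval (f *ₚ g) x)
      ≈⟨ +-cong (eval-scale a g x) (+-congˡ (*-congˡ (eval-*ₚ f g x))) ⟩
    a ⊗ eval g x ⊕ (0# ⊕ x ⊗ (eval f x ⊗ eval g x))
      ≈⟨ +-congˡ (+-identityˡ _) ⟩
    a ⊗ eval g x ⊕ x ⊗ (eval f x ⊗ eval g x)   ≈⟨ +-congˡ (*-assoc _ _ _) ⟨
    a ⊗ eval g x ⊕ (x ⊗ eval f x) ⊗ eval g x   ≈⟨ distribʳ _ _ _ ⟨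
    (a ⊕ x ⊗ eval f x) ⊗ eval g x              ∎

  eval-zero : ∀ f x → f ≈ₚ [] → eval f x ≈ 0#
  eval-zero []      x f≈0 = ≈-refl
  eval-zero (a ∷ f) x f≈0 = begin
    a ⊕ x ⊗ eval f x ≈⟨ +-cong (f≈0 0) (*-congˡ (eval-zero f x (f≈0 ∘ suc))) ⟩
    0# ⊕ x ⊗ 0#      ≈⟨ +-identityˡ _ ⟩
    x ⊗ 0#           ≈⟨ zeroʳ x ⟩
    0#               ∎

  eval-cong : ∀ f g x → f ≈ₚ g → eval f x ≈ eval g x
  eval-cong []      g       x f≈g = ≈-sym (eval-zero g x (≈-sym ∘ f≈g))
  eval-cong (a ∷ f) []      x f≈g = eval-zero (a ∷ f) x f≈g
  eval-cong (a ∷ f) (b ∷ g) x f≈g =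
    +-cong (f≈g 0) (*-congˡ (eval-cong f g x (f≈g ∘ suc)))

  coeff-+ₚ : ∀ f g n → coeff (f +ₚ g) n ≈ coeff f n ⊕ coeff g n
  coeff-+ₚ []      g       n       = ≈-sym (+-identityˡ _)
  coeff-+ₚ (a ∷ f) []      n       = ≈-sym (+-identityʳ _)
  coeff-+ₚ (a ∷ f) (b ∷ g) zero    = ≈-refl
  coeff-+ₚ (a ∷ f) (b ∷ g) (suc n) = coeff-+ₚ f g n

  coeff-scale : ∀ c f n → coeff (scale c f) n ≈ c ⊗ coeff f n
  coeff-scale c []      n       = ≈-sym (zeroʳ c)
  coeff-scale c (a ∷ f) zero    = ≈-refl
  coeff-scale c (a ∷ f) (suc n) = coeff-scale c f n

  coeff-neg : ∀ f n → coeff (List.map ⊖_ f) n ≈ ⊖ coeff f n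
  coeff-neg []      n       = ≈-sym -0#≈0#
  coeff-neg (a ∷ f) zero    = ≈-refl
  coeff-neg (a ∷ f) (suc n) = coeff-neg f n

open ℤ[X]
open Evaluation ℤ.+-*-commutativeRing
open ℚ[X] using ()
  renaming ( Poly to ℚPoly; eval to evalℚ; coeff to coeffℚ; _≈ₚ_ to _≈ℚ_; _*ₚ_ to _*ℚ_
           ; scale to scaleℚ; const to constℚ )

-- Integer polynomials, their values and their degrees

z*i≡0 : ∀ {z i} → z ≢ 0ℤ → z * i ≡ 0ℤ → i ≡ 0ℤ
z*i≡0 {z} z≢0 eq = [ (λ z≡0 → contradiction z≡0 z≢0) , id ]′ (ℤ.i*j≡0⇒i≡0∨j≡0 z eq)

-- The constant term is divisible by every z ≠ 0, in particular by some
-- z > ∣ a ∣.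
eval≗0⇒≈[] : ∀ f → (∀ z → z ≢ 0ℤ → eval f z ≡ 0ℤ) → f ≈ₚ []
eval≗0⇒≈[] []      f≗0 n = refl
eval≗0⇒≈[] (a ∷ f) f≗0 = λ
  { zero    → a≡0
  ; (suc n) → eval≗0⇒≈[] f (λ z z≢0 → z*i≡0 z≢0
      (trans (sym (ℤ.+-identityˡ _)) (subst (λ a → a + z * eval f z ≡ 0ℤ) a≡0 (f≗0 z z≢0)))) n
  }
  where
  a≡0 : a ≡ 0ℤ
  a≡0 with ∣ a ∣ in ∣a∣≡
  ... | zero  = ℤ.∣i∣≡0⇒i≡0 ∣a∣≡
  ... | suc k = contradiction (ℕ.∣⇒≤ N∣) (ℕ.<⇒≱ (ℕ.n<1+n (suc k)))
    where
    N∣ : suc (suc k) ℕ.∣ suc k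
    N∣ = subst (suc (suc k) ℕ.∣_) ∣a∣≡ (ℤ.∣⇒∣ᵤ (ℤ.∣m+n∣n⇒∣m {m = a}
      (subst (+ suc (suc k) ∣_) (sym (f≗0 (+ suc (suc k)) λ ())) (divides 0ℤ refl))
      (ℤ.∣m⇒∣m*n (eval f (+ suc (suc k))) ℤ.∣-refl)))

-- Identities such as the commutativity of `_*ₚ_` are ring identities between values; this carries
-- them back to coefficients.
eval-injective : ∀ f g → (∀ z → eval f z ≡ eval g z) → f ≈ₚ g
eval-injective f g f≗g n = ℤ.i-j≡0⇒i≡j (coeff f n) (coeff g n) (begin
  coeff f n - coeff g n                     ≡⟨ cong (_+_ (coeff f n)) (sym (coeff-neg g n)) ⟩
  coeff f n + coeff (List.map -_ g) n       ≡⟨ sym (coeff-+ₚ f _ n) ⟩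
  coeff (f -ₚ g) n                          ≡⟨ eval≗0⇒≈[] (f -ₚ g) (λ z _ → f-g≡0 z) n ⟩
  0ℤ                                        ∎)
  where
  open ≡-Reasoning
  f-g≡0 : ∀ z → eval (f -ₚ g) z ≡ 0ℤ
  f-g≡0 z = begin
    eval (f -ₚ g) z                   ≡⟨ eval-+ₚ f _ z ⟩
    eval f z + eval (List.map -_ g) z ≡⟨ cong₂ _+_ (f≗g z) (eval-neg g z) ⟩
    eval g z - eval g z               ≡⟨ ℤ.+-inverseʳ (eval g z) ⟩
    0ℤ                                ∎

coeff-zero* : ∀ f g n → f ≈ₚ [] → coeff (f *ₚ g) n ≡ 0ℤ
coeff-zero* []      g n       f≈0 = refl
coeff-zero* (a ∷ f) g n f≈0 = begin
  coeff ((a ∷ f) *ₚ g) n                              ≡⟨ coeff-+ₚ (scale a g) (0ℤ ∷ f *ₚ g) n ⟩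
  coeff (scale a g) n + coeff (0ℤ ∷ f *ₚ g) n         ≡⟨ cong₂ _+_ (coeff-scale a g n) (tail n) ⟩
  a * coeff g n + 0ℤ                                  ≡⟨ ℤ.+-identityʳ (a * coeff g n) ⟩
  a * coeff g n                                       ≡⟨ cong (_* coeff g n) (f≈0 0) ⟩
  0ℤ                                                  ∎
  where
  open ≡-Reasoning
  tail : ∀ n → coeff (0ℤ ∷ f *ₚ g) n ≡ 0ℤ
  tail zero    = refl
  tail (suc n) = coeff-zero* f g n (f≈0 ∘ suc)

coeff-∷*-suc : ∀ a f g n →
  coeff ((a ∷ f) *ₚ g) (suc n) ≡ a * coeff g (suc n) + coeff (f *ₚ g) n
coeff-∷*-suc a f g n = trans (coeff-+ₚ (scale a g) _ (suc n))
  (cong (_+ coeff (f *ₚ g) n) (coeff-scale a g (suc n)))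

coeff-∷*-zero : ∀ a f g → coeff ((a ∷ f) *ₚ g) 0 ≡ a * coeff g 0
coeff-∷*-zero a f g = trans (coeff-+ₚ (scale a g) _ 0)
  (trans (ℤ.+-identityʳ _) (coeff-scale a g 0))

DegreeBound : Poly → ℕ → Set
DegreeBound f k = ∀ n → k < n → coeff f n ≡ 0ℤ

coeff-*-top : ∀ f g k m → DegreeBound f k → DegreeBound g m →
  coeff (f *ₚ g) (k ℕ.+ m) ≡ coeff f k * coeff g m
coeff-*-top []      g k       m f≤k g≤m = refl
coeff-*-top (a ∷ f) g zero    zero    f≤k g≤m = coeff-∷*-zero a f g
coeff-*-top (a ∷ f) g zero    (suc m) f≤k g≤m = begin
  coeff ((a ∷ f) *ₚ g) (suc m)               ≡⟨ coeff-∷*-suc a f g m ⟩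
  a * coeff g (suc m) + coeff (f *ₚ g) m
    ≡⟨ cong (_+_ (a * coeff g (suc m))) (coeff-zero* f g m (λ n → f≤k (suc n) (s≤s z≤n))) ⟩
  a * coeff g (suc m) + 0ℤ                   ≡⟨ ℤ.+-identityʳ _ ⟩
  a * coeff g (suc m)                        ∎
  where open ≡-Reasoning
coeff-*-top (a ∷ f) g (suc k) m f≤k g≤m = begin
  coeff ((a ∷ f) *ₚ g) (suc k ℕ.+ m)         ≡⟨ coeff-∷*-suc a f g (k ℕ.+ m) ⟩
  a * coeff g (suc k ℕ.+ m) + coeff (f *ₚ g) (k ℕ.+ m)
    ≡⟨ cong₂ _+_ (trans (cong (a *_) (g≤m _ (s≤s (ℕ.m≤n+m m k)))) (ℤ.*-zeroʳ a))
                 (coeff-*-top f g k m (λ n → f≤k (suc n) ∘ s≤s) g≤m) ⟩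
  0ℤ + coeff f k * coeff g m                 ≡⟨ ℤ.+-identityˡ _ ⟩
  coeff f k * coeff g m                      ∎
  where open ≡-Reasoning

DegreeBound-* : ∀ f g k m → DegreeBound f k → DegreeBound g m → DegreeBound (f *ₚ g) (k ℕ.+ m)
DegreeBound-* []      g k       m f≤k g≤m n       k+m<n = refl
DegreeBound-* (a ∷ f) g zero    m f≤k g≤m (suc n) m<n   = begin
  coeff ((a ∷ f) *ₚ g) (suc n)             ≡⟨ coeff-∷*-suc a f g n ⟩
  a * coeff g (suc n) + coeff (f *ₚ g) n
    ≡⟨ cong₂ _+_ (trans (cong (a *_) (g≤m _ m<n)) (ℤ.*-zeroʳ a))
                 (coeff-zero* f g n (λ n → f≤k (suc n) (s≤s z≤n))) ⟩
  0ℤ                                       ∎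
  where open ≡-Reasoning
DegreeBound-* (a ∷ f) g (suc k) m f≤k g≤m (suc n) (s≤s k+m<n) = begin
  coeff ((a ∷ f) *ₚ g) (suc n)             ≡⟨ coeff-∷*-suc a f g n ⟩
  a * coeff g (suc n) + coeff (f *ₚ g) n
    ≡⟨ cong₂ _+_ (trans (cong (a *_) (g≤m _ (ℕ.≤-trans (s≤s (ℕ.m≤n+m m k)) (ℕ.m≤n⇒m≤1+n k+m<n)))) (ℤ.*-zeroʳ a))
                 (DegreeBound-* f g k m (λ n → f≤k (suc n) ∘ s≤s) g≤m n k+m<n) ⟩
  0ℤ                                       ∎
  where open ≡-Reasoning

-- Gauss's lemma

-- The leading coefficient is kept apart from the k lower ones, so that for c ≠ 0 the degree is part
-- of the type and a monic polynomial is `snoc as 1ℤ`.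
snoc : ∀ {k} → Vec ℤ k → ℤ → Poly
snoc []       c = c ∷ []
snoc (a ∷ as) c = a ∷ snoc as c

coeff-snoc-top : ∀ {k} (as : Vec ℤ k) c → coeff (snoc as c) k ≡ c
coeff-snoc-top []       c = refl
coeff-snoc-top (a ∷ as) c = coeff-snoc-top as c

DegreeBound-snoc : ∀ {k} (as : Vec ℤ k) c → DegreeBound (snoc as c) k
DegreeBound-snoc []       c (suc n) _         = refl
DegreeBound-snoc (a ∷ as) c (suc n) (s≤s k<n) = DegreeBound-snoc as c n k<n

scale-snoc : ∀ {k} b (as : Vec ℤ k) c → scale b (snoc as c) ≡ snoc (Vec.map (b *_) as) (b * c)
scale-snoc b []       c = refl
scale-snoc b (a ∷ as) c = cong (b * a ∷_) (scale-snoc b as c)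

record LeadForm (f : Poly) : Set where
  constructor leadForm
  field
    {degree} : ℕ
    lower    : Vec ℤ degree
    lead     : ℤ
    lead≢0   : lead ≢ 0ℤ
    f≈snoc   : f ≈ₚ snoc lower lead

  f≗snoc : ∀ z → eval f z ≡ eval (snoc lower lead) z
  f≗snoc z = eval-cong f (snoc lower lead) z f≈snoc

  coeff-lead : coeff f degree ≡ lead
  coeff-lead = trans (f≈snoc degree) (coeff-snoc-top lower lead)

  degree≤ : ∀ {n} → DegreeBound f n → degree ≤ n
  degree≤ f≤n = ℕ.≮⇒≥ λ n<d → lead≢0 (trans (sym coeff-lead) (f≤n degree n<d))

strip : ∀ f → f ≈ₚ [] ⊎ LeadForm f
strip [] = inj₁ λ _ → refl
strip (a ∷ f) with strip f
... | inj₂ (leadForm as c c≢0 f≈) = inj₂ (leadForm (a ∷ as) c c≢0 λ { zero → refl ; (suc n) → f≈ n })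
... | inj₁ f≈0 with a ℤ.≟ 0ℤ
...   | yes a≡0 = inj₁ λ { zero → a≡0 ; (suc n) → f≈0 n }
...   | no  a≢0 = inj₂ (leadForm [] a a≢0 λ { zero → refl ; (suc n) → f≈0 n })

lead-product : ∀ {k m n} (as : Vec ℤ k) c (bs : Vec ℤ m) d (hs : Vec ℤ n) e →
  c ≢ 0ℤ → d ≢ 0ℤ → e ≢ 0ℤ →
  snoc as c *ₚ snoc bs d ≈ₚ snoc hs e → k ℕ.+ m ≡ n × c * d ≡ e
lead-product {k} {m} {n} as c bs d hs e c≢0 d≢0 e≢0 fg≈h with ℕ.<-cmp (k ℕ.+ m) n
... | tri< k+m<n _ _ = contradiction
  (trans (sym (coeff-snoc-top hs e)) (trans (sym (fg≈h n))
    (DegreeBound-* (snoc as c) (snoc bs d) k m (DegreeBound-snoc as c) (DegreeBound-snoc bs d) n k+m<n))) e≢0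
... | tri> _ _ n<k+m = contradiction
  (z*i≡0 c≢0 (trans (sym (cong₂ _*_ (coeff-snoc-top as c) (coeff-snoc-top bs d)))
    (trans (sym (coeff-*-top (snoc as c) (snoc bs d) k m (DegreeBound-snoc as c) (DegreeBound-snoc bs d)))
      (trans (fg≈h (k ℕ.+ m)) (DegreeBound-snoc hs e _ n<k+m))))) d≢0
... | tri≈ _ refl _ = refl , (begin
  c * d                                                   ≡⟨ sym (cong₂ _*_ (coeff-snoc-top as c) (coeff-snoc-top bs d)) ⟩
  coeff (snoc as c) k * coeff (snoc bs d) m
    ≡⟨ sym (coeff-*-top (snoc as c) (snoc bs d) k m (DegreeBound-snoc as c) (DegreeBound-snoc bs d)) ⟩
  coeff (snoc as c *ₚ snoc bs d) (k ℕ.+ m)                ≡⟨ fg≈h (k ℕ.+ m) ⟩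
  coeff (snoc hs e) (k ℕ.+ m)                             ≡⟨ coeff-snoc-top hs e ⟩
  e                                                       ∎)
  where open ≡-Reasoning

prime∣* : ∀ {q} → Prime q → ∀ a b → + q ∣ a * b → (+ q ∣ a) ⊎ (+ q ∣ b)
prime∣* pr a b q∣ab with euclidsLemma ∣ a ∣ ∣ b ∣ pr (subst (_ ℕ.∣_) (ℤ.abs-* a b) (ℤ.∣⇒∣ᵤ q∣ab))
... | inj₁ q∣a = inj₁ (ℤ.∣ᵤ⇒∣ q∣a)
... | inj₂ q∣b = inj₂ (ℤ.∣ᵤ⇒∣ q∣b)

infix 4 _∣ₚ_
_∣ₚ_ : ℤ → Poly → Set
q ∣ₚ f = ∀ n → q ∣ coeff f n

coeff-*∷-zero : ∀ f b g → coeff (f *ₚ (b ∷ g)) 0 ≡ b * coeff f 0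
coeff-*∷-zero []      b g = sym (ℤ.*-zeroʳ b)
coeff-*∷-zero (a ∷ f) b g = trans (coeff-∷*-zero a f (b ∷ g)) (ℤ.*-comm a b)

coeff-*∷-suc : ∀ f b g n →
  coeff (f *ₚ (b ∷ g)) (suc n) ≡ b * coeff f (suc n) + coeff (f *ₚ g) n
coeff-*∷-suc f b g n = begin
  coeff (f *ₚ (b ∷ g)) (suc n)                  ≡⟨ eval-injective (f *ₚ (b ∷ g)) (scale b f +ₚ (0ℤ ∷ f *ₚ g)) evals (suc n) ⟩
  coeff (scale b f +ₚ (0ℤ ∷ f *ₚ g)) (suc n)    ≡⟨ coeff-+ₚ (scale b f) _ (suc n) ⟩
  coeff (scale b f) (suc n) + coeff (f *ₚ g) n  ≡⟨ cong (_+ coeff (f *ₚ g) n) (coeff-scale b f (suc n)) ⟩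
  b * coeff f (suc n) + coeff (f *ₚ g) n        ∎
  where
  open ≡-Reasoning
  rearrange : ∀ b z u v → u * (b + z * v) ≡ b * u + (0ℤ + z * (u * v))
  rearrange = solve-∀
  evals : ∀ z → eval (f *ₚ (b ∷ g)) z ≡ eval (scale b f +ₚ (0ℤ ∷ f *ₚ g)) z
  evals z = begin
    eval (f *ₚ (b ∷ g)) z                         ≡⟨ eval-*ₚ f (b ∷ g) z ⟩
    eval f z * (b + z * eval g z)                 ≡⟨ rearrange b z (eval f z) (eval g z) ⟩
    b * eval f z + (0ℤ + z * (eval f z * eval g z))
      ≡⟨ cong₂ (λ u v → u + (0ℤ + z * v)) (sym (eval-scale b f z)) (sym (eval-*ₚ f g z)) ⟩
    eval (scale b f) z + (0ℤ + z * eval (f *ₚ g) z) ≡⟨ sym (eval-+ₚ (scale b f) _ z) ⟩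
    eval (scale b f +ₚ (0ℤ ∷ f *ₚ g)) z           ∎

∣ₚ-∷ : ∀ {q a f} → q ∣ a → q ∣ₚ f → q ∣ₚ a ∷ f
∣ₚ-∷ q∣a q∣f zero    = q∣a
∣ₚ-∷ q∣a q∣f (suc n) = q∣f n

∣ₚ-* : ∀ {q} → Prime q → ∀ f g → + q ∣ₚ f *ₚ g → (+ q ∣ₚ f) ⊎ (+ q ∣ₚ g)
∣ₚ-* pr []        g           q∣fg = inj₁ λ _ → divides 0ℤ refl
∣ₚ-* pr f@(_ ∷ _) []          q∣fg = inj₂ λ _ → divides 0ℤ refl
∣ₚ-* {q} pr f@(a ∷ f′) g@(b ∷ g′) q∣fg =
  [ (λ q∣a → Sum.map₁ (∣ₚ-∷ q∣a) (∣ₚ-* pr f′ g λ n → ℤ.∣m+n∣m⇒∣n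
      (subst (+ q ∣_) (coeff-∷*-suc a f′ g n) (q∣fg (suc n)))
      (ℤ.∣m⇒∣m*n (coeff g′ n) q∣a)))
  , (λ q∣b → Sum.map₂ (∣ₚ-∷ q∣b) (∣ₚ-* pr f g′ λ n → ℤ.∣m+n∣m⇒∣n
      (subst (+ q ∣_) (coeff-*∷-suc f b g′ n) (q∣fg (suc n)))
      (ℤ.∣m⇒∣m*n (coeff f′ n) q∣b)))
  ]′ (prime∣* pr a b (subst (+ q ∣_) (coeff-∷*-zero a f′ g) (q∣fg 0)))

∣ₚ-snoc : ∀ {k} q (as : Vec ℤ k) c → q ∣ₚ snoc as c →
  ∃₂ λ (as′ : Vec ℤ k) c′ → snoc as c ≡ scale q (snoc as′ c′) × c ≡ q * c′
∣ₚ-snoc q [] c q∣ with q∣ 0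
... | divides c′ c≡ = [] , c′ , cong (_∷ []) (trans c≡ (ℤ.*-comm c′ q)) , trans c≡ (ℤ.*-comm c′ q)
∣ₚ-snoc q (a ∷ as) c q∣ with q∣ 0 | ∣ₚ-snoc q as c (q∣ ∘ suc)
... | divides a′ a≡ | as′ , c′ , as≡ , c≡ = a′ ∷ as′ , c′ , cong₂ _∷_ (trans a≡ (ℤ.*-comm a′ q)) as≡ , c≡

prime-divisor : ∀ n .{{_ : NonZero n}} → n ≢ 1 → ∃ λ q → Prime q × q ℕ.∣ n
prime-divisor n n≢1 = first-factor factors isFactorisation factorsPrime
  where
  open PrimeFactorisation (factorise n)
  first-factor : ∀ qs → n ≡ product qs → All Prime qs → ∃ λ q → Prime q × q ℕ.∣ n
  first-factor []       n≡1 _        = contradiction n≡1 n≢1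
  first-factor (q ∷ qs) n≡  (pr ∷ _) = q , pr , ℕ.divides (product qs) (trans n≡ (ℕ.*-comm q _))

∣i∣≡1⇒i*i≡1 : ∀ i → ∣ i ∣ ≡ 1 → i * i ≡ 1ℤ
∣i∣≡1⇒i*i≡1 (+ 1)       refl = refl
∣i∣≡1⇒i*i≡1 (-[1+ 0 ])  refl = refl

*-cancel : ∀ q i j → q ≢ 0ℤ → q * i ≡ q * j → i ≡ j
*-cancel q i j q≢0 = ℤ.*-cancelˡ-≡ q i j {{ℤ.≢-nonZero q≢0}}

-- Recursion on a bound N for ∣ D ∣, removing one prime factor of D at a time.
gauss : ∀ N {k m} (as : Vec ℤ k) c (bs : Vec ℤ m) d h D → ∣ D ∣ ≤ N → D ≢ 0ℤ → c * d ≡ D →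
  (∀ z → eval (snoc as c) z * eval (snoc bs d) z ≡ D * eval h z) →
  ∃₂ λ (f : Vec ℤ k) (g : Vec ℤ m) → ∀ z → eval (snoc f 1ℤ) z * eval (snoc g 1ℤ) z ≡ eval h z
gauss zero as c bs d h D D≤N D≢0 cd≡D fg≗ =
  contradiction (ℤ.∣i∣≡0⇒i≡0 (ℕ.n≤0⇒n≡0 D≤N)) D≢0
gauss (suc N) as c bs d h D D≤N D≢0 cd≡D fg≗ with ∣ D ∣ ℕ.≟ 1
-- Here c and d are ±1. Multiplying each factor by its own leading coefficient makes it monic and
-- multiplies the product by c * d = D, where D * D = 1.
... | yes ∣D∣≡1 = Vec.map (c *_) as , Vec.map (d *_) bs , λ z → begin
  eval (snoc (Vec.map (c *_) as) 1ℤ) z * eval (snoc (Vec.map (d *_) bs) 1ℤ) z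
    ≡⟨ cong₂ _*_ (normalise c as z (ℕ.m*n≡1⇒m≡1 ∣ c ∣ ∣ d ∣ ∣cd∣≡1)) (normalise d bs z (ℕ.m*n≡1⇒n≡1 ∣ c ∣ ∣ d ∣ ∣cd∣≡1)) ⟩
  (c * eval (snoc as c) z) * (d * eval (snoc bs d) z)
    ≡⟨ rearrange c d (eval (snoc as c) z) (eval (snoc bs d) z) ⟩
  (c * d) * (eval (snoc as c) z * eval (snoc bs d) z)
    ≡⟨ cong₂ _*_ cd≡D (fg≗ z) ⟩
  D * (D * eval h z)         ≡⟨ sym (ℤ.*-assoc D D _) ⟩
  (D * D) * eval h z         ≡⟨ cong (_* eval h z) (∣i∣≡1⇒i*i≡1 D ∣D∣≡1) ⟩
  1ℤ * eval h z              ≡⟨ ℤ.*-identityˡ _ ⟩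
  eval h z                   ∎
  where
  open ≡-Reasoning
  ∣cd∣≡1 : ∣ c ∣ ℕ.* ∣ d ∣ ≡ 1
  ∣cd∣≡1 = trans (sym (ℤ.abs-* c d)) (trans (cong ∣_∣ cd≡D) ∣D∣≡1)
  rearrange : ∀ c d u v → (c * u) * (d * v) ≡ (c * d) * (u * v)
  rearrange = solve-∀
  normalise : ∀ {k} e (es : Vec ℤ k) z → ∣ e ∣ ≡ 1 →
    eval (snoc (Vec.map (e *_) es) 1ℤ) z ≡ e * eval (snoc es e) z
  normalise e es z ∣e∣≡1 = trans
    (cong (λ f → eval f z) (trans (cong (snoc (Vec.map (e *_) es)) (sym (∣i∣≡1⇒i*i≡1 e ∣e∣≡1)))
                                  (sym (scale-snoc e es e))))
    (eval-scale e (snoc es e) z)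
... | no ∣D∣≢1 with prime-divisor ∣ D ∣ {{ℕ.≢-nonZero (D≢0 ∘ ℤ.∣i∣≡0⇒i≡0)}} ∣D∣≢1
...   | q , pr , q∣D with ℤ.∣ᵤ⇒∣ {+ q} {D} q∣D
...     | divides D′ D≡ = split (∣ₚ-* pr (snoc as c) (snoc bs d) q∣ₚfg)
  where
  open ≡-Reasoning
  D≡qD′ : D ≡ + q * D′
  D≡qD′ = trans D≡ (ℤ.*-comm D′ (+ q))

  D′≢0 : D′ ≢ 0ℤ
  D′≢0 D′≡0 = D≢0 (trans D≡ (cong (_* + q) D′≡0))

  instance
    D′-nonZero : NonZero ∣ D′ ∣
    D′-nonZero = ℕ.≢-nonZero (D′≢0 ∘ ℤ.∣i∣≡0⇒i≡0)

  q≢0 : + q ≢ 0ℤ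
  q≢0 q≡0 = D≢0 (trans D≡qD′ (cong (_* D′) q≡0))

  D′≤N : ∣ D′ ∣ ≤ N
  D′≤N = ℕ.≤-pred (ℕ.<-≤-trans (subst (∣ D′ ∣ <_) (sym (trans (cong ∣_∣ D≡) (ℤ.abs-* D′ (+ q))))
    (ℕ.m<m*n ∣ D′ ∣ q (ℕ.nonTrivial⇒n>1 q {{prime⇒nonTrivial pr}}))) D≤N)

  q∣ₚfg : + q ∣ₚ snoc as c *ₚ snoc bs d
  q∣ₚfg n = subst (+ q ∣_) (sym (trans (eval-injective (snoc as c *ₚ snoc bs d) (scale D h)
      (λ z → trans (eval-*ₚ (snoc as c) (snoc bs d) z) (trans (fg≗ z) (sym (eval-scale D h z)))) n)
      (coeff-scale D h n)))
    (ℤ.∣m⇒∣m*n (coeff h n) (divides D′ D≡))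

  rearrangeˡ : ∀ q u v → (q * u) * v ≡ q * (u * v)
  rearrangeˡ = solve-∀
  rearrangeʳ : ∀ q u v → u * (q * v) ≡ q * (u * v)
  rearrangeʳ = solve-∀

  split : (+ q ∣ₚ snoc as c) ⊎ (+ q ∣ₚ snoc bs d) → _
  split (inj₁ q∣f) with ∣ₚ-snoc (+ q) as c q∣f
  ... | as′ , c′ , as≡ , c≡ = gauss N as′ c′ bs d h D′ D′≤N D′≢0
    (*-cancel (+ q) (c′ * d) D′ q≢0 (begin
      + q * (c′ * d) ≡⟨ sym (rearrangeˡ (+ q) c′ d) ⟩
      (+ q * c′) * d ≡⟨ cong (_* d) (sym c≡) ⟩
      c * d          ≡⟨ trans cd≡D D≡qD′ ⟩
      + q * D′       ∎))
    λ z → *-cancel (+ q) (eval (snoc as′ c′) z * eval (snoc bs d) z) (D′ * eval h z) q≢0 (begin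
      + q * (eval (snoc as′ c′) z * eval (snoc bs d) z) ≡⟨ sym (rearrangeˡ (+ q) (eval (snoc as′ c′) z) (eval (snoc bs d) z)) ⟩
      (+ q * eval (snoc as′ c′) z) * eval (snoc bs d) z
        ≡⟨ cong (_* eval (snoc bs d) z) (sym (trans (cong (λ f → eval f z) as≡) (eval-scale (+ q) (snoc as′ c′) z))) ⟩
      eval (snoc as c) z * eval (snoc bs d) z           ≡⟨ fg≗ z ⟩
      D * eval h z                                      ≡⟨ cong (_* eval h z) D≡qD′ ⟩
      (+ q * D′) * eval h z                             ≡⟨ ℤ.*-assoc (+ q) D′ _ ⟩
      + q * (D′ * eval h z)                             ∎)
  split (inj₂ q∣g) with ∣ₚ-snoc (+ q) bs d q∣g
  ... | bs′ , d′ , bs≡ , d≡ = gauss N as c bs′ d′ h D′ D′≤N D′≢0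
    (*-cancel (+ q) (c * d′) D′ q≢0 (begin
      + q * (c * d′) ≡⟨ sym (rearrangeʳ (+ q) c d′) ⟩
      c * (+ q * d′) ≡⟨ cong (c *_) (sym d≡) ⟩
      c * d          ≡⟨ trans cd≡D D≡qD′ ⟩
      + q * D′       ∎))
    λ z → *-cancel (+ q) (eval (snoc as c) z * eval (snoc bs′ d′) z) (D′ * eval h z) q≢0 (begin
      + q * (eval (snoc as c) z * eval (snoc bs′ d′) z) ≡⟨ sym (rearrangeʳ (+ q) (eval (snoc as c) z) (eval (snoc bs′ d′) z)) ⟩
      eval (snoc as c) z * (+ q * eval (snoc bs′ d′) z)
        ≡⟨ cong (eval (snoc as c) z *_) (sym (trans (cong (λ f → eval f z) bs≡) (eval-scale (+ q) (snoc bs′ d′) z))) ⟩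
      eval (snoc as c) z * eval (snoc bs d) z           ≡⟨ fg≗ z ⟩
      D * eval h z                                      ≡⟨ cong (_* eval h z) D≡qD′ ⟩
      (+ q * D′) * eval h z                             ≡⟨ ℤ.*-assoc (+ q) D′ _ ⟩
      + q * (D′ * eval h z)                             ∎)

MonicFactors : ℕ → ℕ → Poly → Set
MonicFactors k m h =
  ∃₂ λ (f : Vec ℤ k) (g : Vec ℤ m) → ∀ z → eval (snoc f 1ℤ) z * eval (snoc g 1ℤ) z ≡ eval h z

-- D stands for a common denominator of rational factors, or for the power of a leading coefficient
-- left by pseudo-division. Comparing leading coefficients gives c * d ≡ D, from which the primes of
-- D are then removed.
monic-factorisation : ∀ {k m n} (as : Vec ℤ k) c (bs : Vec ℤ m) d (hs : Vec ℤ n) D →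
  c ≢ 0ℤ → d ≢ 0ℤ → D ≢ 0ℤ →
  (∀ z → eval (snoc as c) z * eval (snoc bs d) z ≡ D * eval (snoc hs 1ℤ) z) →
  k ℕ.+ m ≡ n × MonicFactors k m (snoc hs 1ℤ)
monic-factorisation as c bs d hs D c≢0 d≢0 D≢0 fg≗ =
  let k+m≡n , cd≡D*1 = lead-product as c bs d (Vec.map (D *_) hs) (D * 1ℤ) c≢0 d≢0
        (D≢0 ∘ trans (sym (ℤ.*-identityʳ D)))
        (eval-injective (snoc as c *ₚ snoc bs d) (snoc (Vec.map (D *_) hs) (D * 1ℤ)) λ z → trans (eval-*ₚ (snoc as c) (snoc bs d) z) (trans (fg≗ z)
          (trans (sym (eval-scale D (snoc hs 1ℤ) z)) (cong (λ f → eval f z) (scale-snoc D hs 1ℤ)))))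
  in  k+m≡n , gauss ∣ D ∣ as c bs d (snoc hs 1ℤ) D ℕ.≤-refl D≢0 (trans cd≡D*1 (ℤ.*-identityʳ D)) fg≗

-- Irreducibility of Φ_ℓ for prime ℓ

ones : ℕ → Poly
ones n = replicate n 1ℤ

X-1 : Poly
X-1 = -[1+ 0 ] ∷ 1ℤ ∷ []

cyclotomic-1 : ∀ a → cyclotomic 1 a ≡ X-1
cyclotomic-1 (acc _) = refl

+ₚ-identityʳ : ∀ f → f +ₚ [] ≡ f
+ₚ-identityʳ []      = refl
+ₚ-identityʳ (a ∷ f) = refl

-- Each step after the first reads its quotient coefficient off the remainder 1 of the previous one;
-- the zeros are those that `divMod` leaves at the end of both lists.
divMod-X-1 : ∀ n → divMod 1 X-1 (X^ n) ≡ (ones n ++ 0ℤ ∷ [] , 1ℤ ∷ replicate (suc n) 0ℤ)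
divMod-X-1 zero = refl
divMod-X-1 (suc n) rewrite divMod-X-1 n = refl

take-++ : ∀ n (f : Poly) → List.take n (ones n ++ f) ≡ ones n
take-++ zero    f = refl
take-++ (suc n) f = cong (1ℤ ∷_) (take-++ n f)

length-X^ : ∀ n → length (X^ n) ≡ suc n
length-X^ zero    = refl
length-X^ (suc n) = cong suc (length-X^ n)

[X^n-1]÷[X-1] : ∀ n → (X^ suc n -ₚ const 1ℤ) ÷ X-1 ≡ ones (suc n)
[X^n-1]÷[X-1] n rewrite +ₚ-identityʳ (X^ n) | divMod-X-1 n | length-X^ n = cong (1ℤ ∷_) (take-++ n (0ℤ ∷ []))

module _ (n : ℕ) (ℓ-prime : Prime (suc (suc n))) where
  private
    ℓ = suc (suc n)

  proper-divisors : List.filter (λ d → toℕ d ℕ.∣? ℓ) (List.allFin ℓ) ≡ Fin.suc Fin.zero ∷ []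
  proper-divisors = begin
    List.filter d∣ℓ? (Fin.zero ∷ Fin.suc Fin.zero ∷ rest)
      ≡⟨ List.filter-reject d∣ℓ? {Fin.zero} {Fin.suc Fin.zero ∷ rest} (λ 0∣ℓ → case ℕ.0∣⇒≡0 0∣ℓ of λ ()) ⟩
    List.filter d∣ℓ? (Fin.suc Fin.zero ∷ rest)
      ≡⟨ List.filter-accept d∣ℓ? {Fin.suc Fin.zero} {rest} (ℕ.1∣ ℓ) ⟩
    Fin.suc Fin.zero ∷ List.filter d∣ℓ? rest
      ≡⟨ cong (Fin.suc Fin.zero ∷_) (List.filter-none d∣ℓ? (All.tabulate⁺ {f = λ i → Fin.suc (Fin.suc i)} ∤ℓ)) ⟩
    Fin.suc Fin.zero ∷ [] ∎
    where
    open ≡-Reasoning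
    d∣ℓ? = λ (d : Fin ℓ) → toℕ d ℕ.∣? ℓ
    rest = List.tabulate {n = n} (λ i → Fin.suc (Fin.suc i))
    ∤ℓ : ∀ (i : Fin n) → suc (suc (toℕ i)) ∤ ℓ
    ∤ℓ i i∣ℓ with prime⇒irreducible ℓ-prime i∣ℓ
    ... | inj₂ i≡ℓ = ℕ.<-irrefl i≡ℓ (s≤s (s≤s (Fin.toℕ<n i)))

  Φ-prime : Φ ℓ ≡ ones ℓ
  Φ-prime = unfold (<-wellFounded ℓ)
    where
    unfold : ∀ a → cyclotomic ℓ a ≡ ones ℓ
    unfold (acc rec) rewrite proper-divisors | cyclotomic-1 (rec (Fin.toℕ<n {ℓ} (Fin.suc Fin.zero))) =
      [X^n-1]÷[X-1] (suc n)

-- The substitution X ↦ 1 + X by Horner's scheme, which turns Φ_ℓ into an Eisenstein polynomial.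
shift : Poly → Poly
shift []      = []
shift (a ∷ f) = const a +ₚ (shift f +ₚ (0ℤ ∷ shift f))

eval-shift : ∀ f z → eval (shift f) z ≡ eval f (1ℤ + z)
eval-shift []      z = refl
eval-shift (a ∷ f) z = begin
  eval (const a +ₚ (shift f +ₚ (0ℤ ∷ shift f))) z
    ≡⟨ eval-+ₚ (const a) (shift f +ₚ (0ℤ ∷ shift f)) z ⟩
  eval (const a) z + eval (shift f +ₚ (0ℤ ∷ shift f)) z
    ≡⟨ cong₂ _+_ (eval-const a z) (eval-+ₚ (shift f) (0ℤ ∷ shift f) z) ⟩
  a + (eval (shift f) z + (0ℤ + z * eval (shift f) z))
    ≡⟨ cong (λ u → a + (u + (0ℤ + z * u))) (eval-shift f z) ⟩
  a + (eval f (1ℤ + z) + (0ℤ + z * eval f (1ℤ + z)))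
    ≡⟨ rearrange a z (eval f (1ℤ + z)) ⟩
  a + (1ℤ + z) * eval f (1ℤ + z) ∎
  where
  open ≡-Reasoning
  rearrange : ∀ a z u → a + (u + (0ℤ + z * u)) ≡ a + (1ℤ + z) * u
  rearrange = solve-∀

coeff-shift-zero : ∀ a f → coeff (shift (a ∷ f)) 0 ≡ a + coeff (shift f) 0
coeff-shift-zero a f = trans (coeff-+ₚ (const a) (shift f +ₚ (0ℤ ∷ shift f)) 0)
  (cong (_+_ a) (trans (coeff-+ₚ (shift f) (0ℤ ∷ shift f) 0) (ℤ.+-identityʳ (coeff (shift f) 0))))

coeff-shift-suc : ∀ a f n → coeff (shift (a ∷ f)) (suc n) ≡ coeff (shift f) (suc n) + coeff (shift f) n
coeff-shift-suc a f n = trans (coeff-+ₚ (const a) (shift f +ₚ (0ℤ ∷ shift f)) (suc n))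
  (trans (ℤ.+-identityˡ (coeff (shift f +ₚ (0ℤ ∷ shift f)) (suc n))) (coeff-+ₚ (shift f) (0ℤ ∷ shift f) (suc n)))

DegreeBound-shift : ∀ {k} (as : Vec ℤ k) c → DegreeBound (shift (snoc as c)) k
DegreeBound-shift []       c (suc n) _         = coeff-shift-suc c [] n
DegreeBound-shift (a ∷ as) c (suc n) (s≤s k<n) = trans (coeff-shift-suc a (snoc as c) n)
  (cong₂ _+_ (DegreeBound-shift as c (suc n) (ℕ.m≤n⇒m≤1+n k<n)) (DegreeBound-shift as c n k<n))

coeff-shift-top : ∀ {k} (as : Vec ℤ k) c → coeff (shift (snoc as c)) k ≡ c
coeff-shift-top []                c = trans (coeff-shift-zero c []) (ℤ.+-identityʳ c)
coeff-shift-top {suc k} (a ∷ as) c = trans (coeff-shift-suc a (snoc as c) k)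
  (trans (cong₂ _+_ (DegreeBound-shift as c (suc k) (ℕ.n<1+n k)) (coeff-shift-top as c)) (ℤ.+-identityˡ c))

-- The polynomial is ((1 + X)^n - 1) / X; one more coefficient 1 adds neighbouring entries, which is
-- Pascal's rule.
coeff-shift-ones : ∀ n i → coeff (shift (ones n)) i ≡ + (n C suc i)
coeff-shift-ones zero    i       = cong +_ (sym (k>n⇒nCk≡0 {0} {suc i} (s≤s z≤n)))
coeff-shift-ones (suc n) zero    = begin
  coeff (shift (ones (suc n))) 0    ≡⟨ coeff-shift-zero 1ℤ (ones n) ⟩
  1ℤ + coeff (shift (ones n)) 0     ≡⟨ cong (_+_ 1ℤ) (coeff-shift-ones n 0) ⟩
  + (1 ℕ.+ n C 1)                   ≡⟨ cong +_ (nCk+nC[k+1]≡[n+1]C[k+1] n 0) ⟩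
  + (suc n C 1)                     ∎
  where open ≡-Reasoning
coeff-shift-ones (suc n) (suc i) = begin
  coeff (shift (ones (suc n))) (suc i)                         ≡⟨ coeff-shift-suc 1ℤ (ones n) i ⟩
  coeff (shift (ones n)) (suc i) + coeff (shift (ones n)) i
    ≡⟨ cong₂ _+_ (coeff-shift-ones n (suc i)) (coeff-shift-ones n i) ⟩
  + (n C suc (suc i) ℕ.+ n C suc i)
    ≡⟨ cong +_ (trans (ℕ.+-comm (n C suc (suc i)) _) (nCk+nC[k+1]≡[n+1]C[k+1] n (suc i))) ⟩
  + (suc n C suc (suc i))                                      ∎
  where open ≡-Reasoning

-- For suc n = ℓ it exhibits ℓ as a divisor of (k + 1) C(ℓ , k + 1), so that Euclid's lemma applies
-- without factorials.
C-absorption : ∀ n k → suc k ℕ.* (suc n C suc k) ≡ suc n ℕ.* (n C k)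
C-absorption zero    zero    = refl
C-absorption zero    (suc k) = trans
  (trans (cong (suc (suc k) ℕ.*_) (k>n⇒nCk≡0 {1} {suc (suc k)} (s≤s (s≤s z≤n)))) (ℕ.*-zeroʳ (suc (suc k))))
  (sym (trans (ℕ.+-identityʳ _) (k>n⇒nCk≡0 {0} {suc k} (s≤s z≤n))))
C-absorption (suc n) zero    = trans (ℕ.*-identityˡ _) (trans (nC1≡n (suc (suc n))) (sym (ℕ.*-identityʳ _)))
C-absorption (suc n) (suc k) = begin
  suc (suc k) ℕ.* (suc (suc n) C suc (suc k))
    ≡⟨ cong (suc (suc k) ℕ.*_) (sym (nCk+nC[k+1]≡[n+1]C[k+1] (suc n) (suc k))) ⟩
  suc (suc k) ℕ.* (A ℕ.+ suc n C suc (suc k))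
    ≡⟨ ℕ.*-distribˡ-+ (suc (suc k)) A _ ⟩
  (A ℕ.+ suc k ℕ.* A) ℕ.+ suc (suc k) ℕ.* (suc n C suc (suc k))
    ≡⟨ cong₂ (λ u v → (A ℕ.+ u) ℕ.+ v) (C-absorption n k) (C-absorption n (suc k)) ⟩
  (A ℕ.+ suc n ℕ.* (n C k)) ℕ.+ suc n ℕ.* (n C suc k)
    ≡⟨ ℕ.+-assoc A _ _ ⟩
  A ℕ.+ (suc n ℕ.* (n C k) ℕ.+ suc n ℕ.* (n C suc k))
    ≡⟨ cong (A ℕ.+_) (sym (ℕ.*-distribˡ-+ (suc n) (n C k) _)) ⟩
  A ℕ.+ suc n ℕ.* (n C k ℕ.+ n C suc k)
    ≡⟨ cong (λ u → A ℕ.+ suc n ℕ.* u) (nCk+nC[k+1]≡[n+1]C[k+1] n k) ⟩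
  suc (suc n) ℕ.* A ∎
  where
  open ≡-Reasoning
  A = suc n C suc k

prime∣C : ∀ n → Prime (suc n) → ∀ k → suc k < suc n → suc n ℕ.∣ suc n C suc k
prime∣C n pr k k<n
  with euclidsLemma (suc k) (suc n C suc k) pr (ℕ.divides (n C k) (trans (C-absorption n k) (ℕ.*-comm (suc n) (n C k))))
... | inj₁ ∣1+k = contradiction (ℕ.∣⇒≤ ∣1+k) (ℕ.<⇒≱ k<n)
... | inj₂ ∣C   = ∣C

-- Modulo q, f is invertible as a power series, so g inherits the vanishing of the first n
-- coefficients. Concretely, q divides the constant term b of g; dropping b leaves the same claim
-- for the rest of g with n - 1 coefficients.
eisenstein : ∀ {q} → Prime q → ∀ f → ¬ (+ q ∣ coeff f 0) → ∀ n g →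
  (∀ i → i < n → + q ∣ coeff (f *ₚ g) i) → ∀ i → i < n → + q ∣ coeff g i
eisenstein pr f q∤f₀ n       []      q∣fg i       _         = divides 0ℤ refl
eisenstein {q} pr f q∤f₀ (suc n) (b ∷ g) q∣fg = λ
  { zero    _         → q∣b
  ; (suc i) (s≤s i<n) → eisenstein pr f q∤f₀ n g (λ j j<n → ℤ.∣m+n∣m⇒∣n
      (subst (+ q ∣_) (coeff-*∷-suc f b g j) (q∣fg (suc j) (s≤s j<n)))
      (ℤ.∣m⇒∣m*n (coeff f (suc j)) q∣b)) i i<n
  }
  where
  q∣b : + q ∣ b
  q∣b = [ id , (λ q∣f₀ → contradiction q∣f₀ q∤f₀) ]′
    (prime∣* pr b (coeff f 0) (subst (+ q ∣_) (coeff-*∷-zero f b g) (q∣fg 0 (s≤s z≤n))))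

∤1 : ∀ {q} → Prime q → ¬ (+ q ∣ 1ℤ)
∤1 {q} pr q∣1 = ℕ.<⇒≱ (ℕ.nonTrivial⇒n>1 q {{prime⇒nonTrivial pr}}) (ℕ.∣⇒≤ (ℤ.∣⇒∣ᵤ q∣1))

ones-irreducible : ∀ {n k m} → Prime (suc n) → 1 ≤ k → 1 ≤ m → k ℕ.+ m ≡ n →
  ¬ MonicFactors k m (ones (suc n))
ones-irreducible {n} {k} {m} pr 1≤k 1≤m k+m≡n (f , g , fg≗) =
  split (+ ℓ ℤ.∣? coeff u 0) (+ ℓ ℤ.∣? coeff v 0)
  where
  open ≡-Reasoning
  ℓ = suc n
  u = shift (snoc f 1ℤ)
  v = shift (snoc g 1ℤ)

  coeff-uv : ∀ i → coeff (u *ₚ v) i ≡ + (ℓ C suc i)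
  coeff-uv i = trans (eval-injective (u *ₚ v) (shift (ones ℓ)) (λ z → begin
    eval (u *ₚ v) z                                         ≡⟨ eval-*ₚ u v z ⟩
    eval u z * eval v z                                     ≡⟨ cong₂ _*_ (eval-shift (snoc f 1ℤ) z) (eval-shift (snoc g 1ℤ) z) ⟩
    eval (snoc f 1ℤ) (1ℤ + z) * eval (snoc g 1ℤ) (1ℤ + z)   ≡⟨ fg≗ (1ℤ + z) ⟩
    eval (ones ℓ) (1ℤ + z)                                  ≡⟨ sym (eval-shift (ones ℓ) z) ⟩
    eval (shift (ones ℓ)) z                                 ∎) i) (coeff-shift-ones ℓ i)

  ∣coeff-uv : ∀ i → i < n → + ℓ ∣ coeff (u *ₚ v) i
  ∣coeff-uv i i<n = subst (+ ℓ ∣_) (sym (coeff-uv i)) (ℤ.∣ᵤ⇒∣ (prime∣C n pr i (s≤s i<n)))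

  coeff-vu : ∀ i → coeff (v *ₚ u) i ≡ coeff (u *ₚ v) i
  coeff-vu = eval-injective (v *ₚ u) (u *ₚ v) λ z → trans (eval-*ₚ v u z)
    (trans (ℤ.*-comm (eval v z) (eval u z)) (sym (eval-*ₚ u v z)))

  coeff-0 : ∀ f g → coeff (f *ₚ g) 0 ≡ coeff f 0 * coeff g 0
  coeff-0 []      g = refl
  coeff-0 (a ∷ f) g = coeff-∷*-zero a f g

  split : _ → _ → ⊥
  -- The top coefficient 1 of v has index m < n and would be divisible by ℓ.
  split (no ℓ∤u₀) _ = ∤1 pr (subst (+ ℓ ∣_) (coeff-shift-top g 1ℤ)
    (eisenstein pr u ℓ∤u₀ n v ∣coeff-uv m (subst (m <_) k+m≡n (ℕ.+-monoˡ-≤ m 1≤k))))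
  split (yes _) (no ℓ∤v₀) = ∤1 pr (subst (+ ℓ ∣_) (coeff-shift-top f 1ℤ)
    (eisenstein pr v ℓ∤v₀ n u (λ i i<n → subst (+ ℓ ∣_) (sym (coeff-vu i)) (∣coeff-uv i i<n))
      k (subst (k <_) (trans (ℕ.+-comm m k) k+m≡n) (ℕ.+-monoˡ-≤ k 1≤m))))
  -- Now ℓ² divides the constant term of the product, which is Φ_ℓ(1) = ℓ.
  split (yes (divides a u₀≡)) (yes (divides b v₀≡)) = ∤1 pr (divides (a * b)
    (*-cancel (+ ℓ) 1ℤ (a * b * + ℓ) (λ ()) (begin
      + ℓ * 1ℤ                  ≡⟨ ℤ.*-identityʳ (+ ℓ) ⟩
      + ℓ                       ≡⟨ cong +_ (sym (nC1≡n ℓ)) ⟩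
      + (ℓ C 1)                 ≡⟨ sym (coeff-uv 0) ⟩
      coeff (u *ₚ v) 0          ≡⟨ coeff-0 u v ⟩
      coeff u 0 * coeff v 0     ≡⟨ cong₂ _*_ u₀≡ v₀≡ ⟩
      (a * + ℓ) * (b * + ℓ)     ≡⟨ rearrange a b (+ ℓ) ⟩
      + ℓ * (a * b * + ℓ)       ∎)))
    where
    rearrange : ∀ a b l → (a * l) * (b * l) ≡ l * (a * b * l)
    rearrange = solve-∀

-- Small integers in the ideal generated by Φ_ℓ and another polynomial

CoeffBound : Poly → ℕ → Set
CoeffBound f S = ∀ i → ∣ coeff f i ∣ ≤ S

unsnoc : ∀ {k} (w : Vec ℤ (suc k)) → ∃₂ λ (us : Vec ℤ k) t → Vec.toList w ≡ snoc us t
unsnoc (a ∷ [])        = [] , a , refl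
unsnoc (a ∷ w@(_ ∷ _)) = let us , t , w≡ = unsnoc w in a ∷ us , t , cong (a ∷_) w≡

-- In c · `snoc us t` - t · `snoc hs c` the leading terms cancel, so k coefficients suffice.
cross : ∀ {k} → ℤ → ℤ → Vec ℤ k → Vec ℤ k → Vec ℤ k
cross c t = Vec.zipWith (λ u h → c * u - t * h)

coeff-cross : ∀ {k} c t (us hs : Vec ℤ k) i →
  coeff (Vec.toList (cross c t us hs)) i ≡ c * coeff (snoc us t) i - t * coeff (snoc hs c) i
coeff-cross c t []       []       zero    = sym (trans (cong (_- t * c) (ℤ.*-comm c t)) (ℤ.+-inverseʳ (t * c)))
coeff-cross c t []       []       (suc i) = sym (cong₂ _-_ (ℤ.*-zeroʳ c) (ℤ.*-zeroʳ t))
coeff-cross c t (u ∷ us) (h ∷ hs) zero    = refl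
coeff-cross c t (u ∷ us) (h ∷ hs) (suc i) = coeff-cross c t us hs i

eval-cross : ∀ {k} c t (us hs : Vec ℤ k) z →
  eval (Vec.toList (cross c t us hs)) z ≡ c * eval (snoc us t) z - t * eval (snoc hs c) z
eval-cross c t []       []       z = base c t z
  where
  base : ∀ c t z → 0ℤ ≡ c * (t + z * 0ℤ) - t * (c + z * 0ℤ)
  base = solve-∀
eval-cross c t (u ∷ us) (h ∷ hs) z = trans
  (cong (λ v → c * u - t * h + z * v) (eval-cross c t us hs z))
  (rearrange c t u h z (eval (snoc us t) z) (eval (snoc hs c) z))
  where
  rearrange : ∀ c t u h z U H → c * u - t * h + z * (c * U - t * H) ≡ c * (u + z * U) - t * (h + z * H)
  rearrange = solve-∀

∣cu-th∣≤ : ∀ {S b} c u t h → ∣ c ∣ ≤ S → ∣ u ∣ ≤ b → ∣ t ∣ ≤ b → ∣ h ∣ ≤ S →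
  ∣ c * u - t * h ∣ ≤ 2 ℕ.* S ℕ.* b
∣cu-th∣≤ {S} {b} c u t h c≤ u≤ t≤ h≤ = begin
  ∣ c * u - t * h ∣                        ≤⟨ ℤ.∣i-j∣≤∣i∣+∣j∣ (c * u) (t * h) ⟩
  ∣ c * u ∣ ℕ.+ ∣ t * h ∣                  ≡⟨ cong₂ ℕ._+_ (ℤ.abs-* c u) (trans (ℤ.abs-* t h) (ℕ.*-comm ∣ t ∣ ∣ h ∣)) ⟩
  ∣ c ∣ ℕ.* ∣ u ∣ ℕ.+ ∣ h ∣ ℕ.* ∣ t ∣      ≤⟨ ℕ.+-mono-≤ (ℕ.*-mono-≤ c≤ u≤) (ℕ.*-mono-≤ h≤ t≤) ⟩
  S ℕ.* b ℕ.+ S ℕ.* b                      ≡⟨ cong (S ℕ.* b ℕ.+_) (sym (ℕ.+-identityʳ (S ℕ.* b))) ⟩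
  2 ℕ.* (S ℕ.* b)                          ≡⟨ sym (ℕ.*-assoc 2 S b) ⟩
  2 ℕ.* S ℕ.* b                            ∎
  where open ℕ.≤-Reasoning

∣i^n∣≤ : ∀ {S} i n → ∣ i ∣ ≤ S → ∣ i ℤ.^ n ∣ ≤ S ^ n
∣i^n∣≤ i zero    i≤ = ℕ.≤-refl
∣i^n∣≤ i (suc n) i≤ = subst (_≤ _) (sym (ℤ.abs-* i (i ℤ.^ n))) (ℕ.*-mono-≤ i≤ (∣i^n∣≤ i n i≤))

i^n≢0 : ∀ i n → i ≢ 0ℤ → i ℤ.^ n ≢ 0ℤ
i^n≢0 i (suc n) i≢0 i^≡0 = i^n≢0 i n i≢0 (z*i≡0 i≢0 i^≡0)

-- The power of the leading coefficient c keeps the division inside ℤ, with one factor for each of n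
-- steps. Each step also costs a factor 2 S in the size of the remainder, since it forms a
-- difference of two products.
record PseudoDivision {e} (hs : Vec ℤ (suc e)) (c : ℤ) (n : ℕ) : Set where
  field
    quotient  : Poly
    remainder : Vec ℤ (suc e)
    equality  : ∀ z → c ℤ.^ n * eval (ones n) z ≡ eval quotient z * eval (snoc hs c) z + eval (Vec.toList remainder) z
    bounded   : ∀ {S} → CoeffBound (snoc hs c) S → ∣ c ∣ ≤ S → CoeffBound (Vec.toList remainder) ((2 ℕ.* S) ^ n)

coeff-zeros : ∀ k i → coeff (Vec.toList (Vec.replicate k 0ℤ)) i ≡ 0ℤ
coeff-zeros zero    i       = refl
coeff-zeros (suc k) zero    = refl
coeff-zeros (suc k) (suc i) = coeff-zeros k i

pseudo-divide : ∀ {e} (hs : Vec ℤ (suc e)) c n → PseudoDivision hs c n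
pseudo-divide {e} hs c zero = record
  { quotient  = []
  ; remainder = Vec.replicate (suc e) 0ℤ
  ; equality  = λ z → sym (trans (ℤ.+-identityˡ (eval (Vec.toList (Vec.replicate (suc e) 0ℤ)) z))
      (eval-zero (Vec.toList (Vec.replicate (suc e) 0ℤ)) z (coeff-zeros (suc e))))
  ; bounded   = λ _ _ i → subst (_≤ 1) (sym (cong ∣_∣ (coeff-zeros (suc e) i))) z≤n
  }
pseudo-divide {e} hs c (suc n) = record
  { quotient  = t ∷ scale c quotient
  ; remainder = cross c t us hs
  ; equality  = eq
  ; bounded   = λ {S} hs≤ c≤ → let w≤ = w-bounded {S} hs≤ c≤ in λ i →
      subst (_≤ (2 ℕ.* S) ^ suc n) (sym (cong ∣_∣ (coeff-cross c t us hs i)))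
        (∣cu-th∣≤ c (coeff (snoc us t) i) t (coeff (snoc hs c) i) c≤ (w≤ i)
          (subst (λ x → ∣ x ∣ ≤ (2 ℕ.* S) ^ n) (coeff-snoc-top us t) (w≤ (suc e))) (hs≤ i))
  }
  where
  open PseudoDivision (pseudo-divide hs c n)
  -- As `ones (suc n)` is 1 + X · `ones n`, what is left to divide is c^n + X · `remainder`. Its
  -- degree is at most that of the divisor, so a single cancellation suffices.
  w = c ℤ.^ n ∷ remainder
  us = proj₁ (unsnoc w)
  t  = proj₁ (proj₂ (unsnoc w))
  w≡ : Vec.toList w ≡ snoc us t
  w≡ = proj₂ (proj₂ (unsnoc w))

  w-bounded : ∀ {S} → CoeffBound (snoc hs c) S → ∣ c ∣ ≤ S → CoeffBound (snoc us t) ((2 ℕ.* S) ^ n)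
  w-bounded {S} hs≤ c≤ = subst (λ f → CoeffBound f ((2 ℕ.* S) ^ n)) w≡ λ
    { zero    → ∣i^n∣≤ c n (ℕ.≤-trans c≤ (ℕ.m≤m+n S (S ℕ.+ 0)))
    ; (suc i) → bounded hs≤ c≤ i
    }

  rearrange₁ : ∀ c K z F → c * K * (1ℤ + z * F) ≡ c * K + c * (z * (K * F))
  rearrange₁ = solve-∀
  rearrange₂ : ∀ c K z Q H R t → c * K + c * (z * (Q * H + R)) ≡ (t + z * (c * Q)) * H + (c * (K + z * R) - t * H)
  rearrange₂ = solve-∀

  eq : ∀ z → c ℤ.^ suc n * eval (ones (suc n)) z ≡
    eval (t ∷ scale c quotient) z * eval (snoc hs c) z + eval (Vec.toList (cross c t us hs)) z
  eq z = begin
    c * K * (1ℤ + z * F)                          ≡⟨ rearrange₁ c K z F ⟩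
    c * K + c * (z * (K * F))                     ≡⟨ cong (λ x → c * K + c * (z * x)) (equality z) ⟩
    c * K + c * (z * (Q * H + R))                 ≡⟨ rearrange₂ c K z Q H R t ⟩
    (t + z * (c * Q)) * H + (c * eval (Vec.toList w) z - t * H)
      ≡⟨ cong (λ f → (t + z * (c * Q)) * H + (c * eval f z - t * H)) w≡ ⟩
    (t + z * (c * Q)) * H + (c * eval (snoc us t) z - t * H)
      ≡⟨ cong₂ (λ x y → (t + z * x) * H + y) (sym (eval-scale c quotient z)) (sym (eval-cross c t us hs z)) ⟩
    (t + z * eval (scale c quotient) z) * H + eval (Vec.toList (cross c t us hs)) z ∎
    where
    open ≡-Reasoning
    K = c ℤ.^ n
    F = eval (ones n) z
    Q = eval quotient z
    H = eval (snoc hs c) z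
    R = eval (Vec.toList remainder) z

DegreeBound-toList : ∀ {k} (v : Vec ℤ (suc k)) → DegreeBound (Vec.toList v) k
DegreeBound-toList (a ∷ [])        (suc i) _         = refl
DegreeBound-toList (a ∷ v@(_ ∷ _)) (suc i) (s≤s k<i) = DegreeBound-toList v i k<i

ones≡snoc : ∀ n → ones (suc n) ≡ snoc (Vec.replicate n 1ℤ) 1ℤ
ones≡snoc zero    = refl
ones≡snoc (suc n) = cong (1ℤ ∷_) (ones≡snoc n)

∣i∣≥1 : ∀ {i} → i ≢ 0ℤ → 1 ≤ ∣ i ∣
∣i∣≥1 i≢0 = ℕ.n≢0⇒n>0 (i≢0 ∘ ℤ.∣i∣≡0⇒i≡0)

-- Membership of N in the ideal (h, Φ_ℓ) is only recorded through values
-- at integers modulo p.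
record IdealInteger (ℓ : ℕ) (h : Poly) (b : ℕ) : Set where
  field
    N       : ℕ
    N≥1     : 1 ≤ N
    N≤b     : N ≤ b
    common  : ∀ p d → + p ∣ eval (ones ℓ) d → + p ∣ eval h d → + p ∣ + N

module _ {n : ℕ} (ℓ-prime : Prime (suc n)) where
  private
    ℓ = suc n

  -- A division replaces the bound S by (2 S)^ℓ, and 2 (2 S)^ℓ ≤ (2 S)^(ℓ+1): the exponent gains a
  -- factor ℓ + 1 for each drop in degree.
  exponent-step : ∀ S d e → 1 ≤ S → d ≤ e →
    (2 ℕ.* (2 ℕ.* S) ^ ℓ) ^ (suc ℓ ^ d) ≤ (2 ℕ.* S) ^ (suc ℓ ^ suc e)
  exponent-step S d e 1≤S d≤e = begin
    (2 ℕ.* (2 ℕ.* S) ^ ℓ) ^ (suc ℓ ^ d)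
      ≤⟨ ℕ.^-monoˡ-≤ (suc ℓ ^ d) (ℕ.*-monoˡ-≤ ((2 ℕ.* S) ^ ℓ) (ℕ.*-monoʳ-≤ 2 1≤S)) ⟩
    ((2 ℕ.* S) ^ suc ℓ) ^ (suc ℓ ^ d)
      ≡⟨ ℕ.^-*-assoc (2 ℕ.* S) (suc ℓ) (suc ℓ ^ d) ⟩
    (2 ℕ.* S) ^ (suc ℓ ^ suc d)
      ≤⟨ ℕ.^-monoʳ-≤ (2 ℕ.* S) {{2S≢0}} (ℕ.^-monoʳ-≤ (suc ℓ) (s≤s d≤e)) ⟩
    (2 ℕ.* S) ^ (suc ℓ ^ suc e) ∎
    where
    open ℕ.≤-Reasoning
    2S≢0 = ℕ.>-nonZero (ℕ.≤-trans 1≤S (ℕ.m≤m+n S (S ℕ.+ 0)))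

  -- Gauss's lemma would turn the equation into a monic factorisation of Φ_ℓ; as e + 1 < n, the
  -- cofactor q would have positive degree too.
  no-exact-division : ∀ {e} (hs : Vec ℤ (suc e)) c → c ≢ 0ℤ → suc e < n →
    ∀ q → ¬ (∀ z → c ℤ.^ ℓ * eval (ones ℓ) z ≡ eval q z * eval (snoc hs c) z)
  no-exact-division {e} hs c c≢0 e<n q eq with strip q
  ... | inj₁ q≈0 = i^n≢0 c ℓ c≢0 (begin
    c ℤ.^ ℓ                             ≡⟨ sym (ℤ.*-identityʳ _) ⟩
    c ℤ.^ ℓ * eval (ones ℓ) 0ℤ          ≡⟨ eq 0ℤ ⟩
    eval q 0ℤ * eval (snoc hs c) 0ℤ     ≡⟨ cong (_* eval (snoc hs c) 0ℤ) (eval-zero q 0ℤ q≈0) ⟩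
    0ℤ                                  ∎)
    where open ≡-Reasoning
  ... | inj₂ Q = irreducible (monic-factorisation lower lead hs c (Vec.replicate n 1ℤ) (c ℤ.^ ℓ)
      lead≢0 c≢0 (i^n≢0 c ℓ c≢0)
      (λ z → trans (cong (_* eval (snoc hs c) z) (sym (f≗snoc z)))
        (trans (sym (eq z)) (cong (λ f → c ℤ.^ ℓ * eval f z) (ones≡snoc n)))))
    where
    open LeadForm Q
    irreducible : degree ℕ.+ suc e ≡ n × MonicFactors degree (suc e) (snoc (Vec.replicate n 1ℤ) 1ℤ) → ⊥
    irreducible (deg≡ , factors) = ones-irreducible ℓ-prime
      (ℕ.n≢0⇒n>0 (λ deg≡0 → ℕ.<-irrefl (trans (cong (ℕ._+ suc e) (sym deg≡0)) deg≡) e<n))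
      (s≤s z≤n) deg≡ (subst (MonicFactors degree (suc e)) (sym (ones≡snoc n)) factors)

  -- Each step divides Φ_ℓ afresh instead of the previous divisor, so only one polynomial varies.
  -- The remainder lies in the same ideal and has smaller degree than the divisor, and
  -- irreducibility of Φ_ℓ keeps it from being zero. At degree 0 its absolute value is the integer
  -- sought.
  euclid : ∀ {e} → Acc _<_ e → (hs : Vec ℤ e) → ∀ c → c ≢ 0ℤ → e < n → ∀ S → CoeffBound (snoc hs c) S →
    IdealInteger ℓ (snoc hs c) ((2 ℕ.* S) ^ (suc ℓ ^ e))
  euclid {zero} _ [] c c≢0 _ S hs≤ = record
    { N       = ∣ c ∣
    ; N≥1     = ∣i∣≥1 c≢0
    ; N≤b     = ℕ.≤-trans (hs≤ 0) (ℕ.≤-trans (ℕ.m≤m+n S (S ℕ.+ 0)) (ℕ.≤-reflexive (sym (ℕ.*-identityʳ (2 ℕ.* S)))))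
    ; common  = λ p d _ p∣c → ℤ.∣-trans (subst (+ p ∣_) (eval-const c d) p∣c) ℤ.m∣∣m∣
    }
  euclid {suc e} (acc rec) hs c c≢0 e<n S hs≤ = step (strip r)
    where
    open PseudoDivision (pseudo-divide hs c ℓ)
    r = Vec.toList remainder
    c≤S : ∣ c ∣ ≤ S
    c≤S = subst (λ x → ∣ x ∣ ≤ S) (coeff-snoc-top hs c) (hs≤ (suc e))

    step : r ≈ₚ [] ⊎ LeadForm r → IdealInteger ℓ (snoc hs c) ((2 ℕ.* S) ^ (suc ℓ ^ suc e))
    step (inj₁ r≈0) = ⊥-elim (no-exact-division hs c c≢0 e<n quotient λ z → trans (equality z)
      (trans (cong (_+_ (eval quotient z * eval (snoc hs c) z)) (eval-zero r z r≈0)) (ℤ.+-identityʳ _)))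
    step (inj₂ r-form) = record
      { N       = I.N
      ; N≥1     = I.N≥1
      ; N≤b     = ℕ.≤-trans I.N≤b (exponent-step S degree e (ℕ.≤-trans (∣i∣≥1 c≢0) c≤S) degree≤e)
      ; common  = λ p d p∣Φ p∣h → I.common p d p∣Φ (subst (+ p ∣_) (f≗snoc d)
          (ℤ.∣m+n∣m⇒∣n (subst (+ p ∣_) (equality d) (ℤ.∣n⇒∣m*n (c ℤ.^ ℓ) p∣Φ))
                       (ℤ.∣n⇒∣m*n (eval quotient d) p∣h)))
      }
      where
      open LeadForm r-form
      degree≤e : degree ≤ e
      degree≤e = degree≤ (DegreeBound-toList remainder)
      module I = IdealInteger (euclid (rec (s≤s degree≤e)) lower lead lead≢0
        (ℕ.≤-<-trans degree≤e (ℕ.<-trans (ℕ.n<1+n e) e<n)) ((2 ℕ.* S) ^ ℓ)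
        λ i → subst (λ x → ∣ x ∣ ≤ (2 ℕ.* S) ^ ℓ) (f≈snoc i) (bounded hs≤ c≤S i))

coeff-ones-< : ∀ {n i} → i < n → coeff (ones n) i ≡ 1ℤ
coeff-ones-< {suc n} {zero}  _         = refl
coeff-ones-< {suc n} {suc i} (s≤s i<n) = coeff-ones-< i<n

coeff-ones-≥ : ∀ {n i} → n ≤ i → coeff (ones n) i ≡ 0ℤ
coeff-ones-≥ {zero}  {i}     _         = refl
coeff-ones-≥ {suc n} {suc i} (s≤s n≤i) = coeff-ones-≥ n≤i

-- Subtracting t Φ_ℓ cancels the coefficient of X^n and makes `euclid` applicable; nothing is left
-- exactly if all coefficients agree, which is the first alternative. The subtraction may double the
-- coefficients, whence 2 · (2 · S).
ideal-integer : ∀ {n} (ℓ-prime : Prime (suc n)) h S → DegreeBound h n → CoeffBound h S →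
  (∀ i → i < n → coeff h i ≡ coeff h n) ⊎ IdealInteger (suc n) h ((2 ℕ.* (2 ℕ.* S)) ^ (suc (suc n) ^ n))
ideal-integer {zero}      ℓ-prime h S h≤n h≤S = inj₁ λ i ()
ideal-integer {n@(suc m)} ℓ-prime h S h≤n h≤S = split (strip g)
  where
  ℓ = suc n
  t = coeff h n
  g = h -ₚ scale t (ones ℓ)

  coeff-g : ∀ i → coeff g i ≡ coeff h i - t * coeff (ones ℓ) i
  coeff-g i = trans (coeff-+ₚ h (List.map -_ (scale t (ones ℓ))) i)
    (cong (_+_ (coeff h i)) (trans (coeff-neg (scale t (ones ℓ)) i) (cong -_ (coeff-scale t (ones ℓ) i))))

  coeff-g-< : ∀ i → i < ℓ → coeff g i ≡ coeff h i - t
  coeff-g-< i i<ℓ = trans (coeff-g i) (cong (λ u → coeff h i - u)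
    (trans (cong (t *_) (coeff-ones-< i<ℓ)) (ℤ.*-identityʳ t)))

  coeff-g-≥ : ∀ i → ℓ ≤ i → coeff g i ≡ 0ℤ
  coeff-g-≥ i ℓ≤i = trans (coeff-g i) (cong₂ _-_ (h≤n i ℓ≤i)
    (trans (cong (t *_) (coeff-ones-≥ ℓ≤i)) (ℤ.*-zeroʳ t)))

  g≤2S : CoeffBound g (2 ℕ.* S)
  g≤2S i with i ℕ.<? ℓ
  ... | no  i≮ℓ = subst (λ x → ∣ x ∣ ≤ 2 ℕ.* S) (sym (coeff-g-≥ i (ℕ.≮⇒≥ i≮ℓ))) z≤n
  ... | yes i<ℓ = subst (λ x → ∣ x ∣ ≤ 2 ℕ.* S) (sym (coeff-g-< i i<ℓ))
    (ℕ.≤-trans (ℤ.∣i-j∣≤∣i∣+∣j∣ (coeff h i) t)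
      (ℕ.+-mono-≤ (h≤S i) (ℕ.≤-trans (h≤S n) (ℕ.≤-reflexive (sym (ℕ.+-identityʳ S))))))

  g≤m : DegreeBound g m
  g≤m i m<i with i ℕ.<? ℓ
  ... | no  i≮ℓ = coeff-g-≥ i (ℕ.≮⇒≥ i≮ℓ)
  ... | yes i<ℓ rewrite ℕ.≤-antisym (ℕ.≤-pred i<ℓ) m<i =
    trans (coeff-g-< n (ℕ.n<1+n n)) (ℤ.+-inverseʳ t)

  eval-g : ∀ d → eval g d ≡ eval h d - t * eval (ones ℓ) d
  eval-g d = trans (eval-+ₚ h (List.map -_ (scale t (ones ℓ))) d)
    (cong (_+_ (eval h d)) (trans (eval-neg (scale t (ones ℓ)) d) (cong -_ (eval-scale t (ones ℓ) d))))

  split : g ≈ₚ [] ⊎ LeadForm g →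
    (∀ i → i < n → coeff h i ≡ coeff h n) ⊎ IdealInteger ℓ h ((2 ℕ.* (2 ℕ.* S)) ^ (suc ℓ ^ n))
  split (inj₁ g≈0) = inj₁ λ i i<n → ℤ.i-j≡0⇒i≡j (coeff h i) t
    (trans (sym (coeff-g-< i (ℕ.m≤n⇒m≤1+n i<n))) (g≈0 i))
  split (inj₂ g-form) = inj₂ record
    { N      = I.N
    ; N≥1    = I.N≥1
    ; N≤b    = ℕ.≤-trans I.N≤b (ℕ.^-monoʳ-≤ (2 ℕ.* (2 ℕ.* S)) {{4S≢0}}
        (ℕ.^-monoʳ-≤ (suc ℓ) (ℕ.≤-trans (degree≤ g≤m) (ℕ.n≤1+n m))))
    ; common = λ p d p∣Φ p∣h → I.common p d p∣Φ (subst (+ p ∣_) (trans (sym (eval-g d)) (f≗snoc d))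
        (ℤ.∣m∣n⇒∣m-n p∣h (ℤ.∣n⇒∣m*n t p∣Φ)))
    }
    where
    open LeadForm g-form
    snoc≤2S : CoeffBound (snoc lower lead) (2 ℕ.* S)
    snoc≤2S i = subst (λ x → ∣ x ∣ ≤ 2 ℕ.* S) (f≈snoc i) (g≤2S i)
    1≤2S : 1 ≤ 2 ℕ.* S
    1≤2S = ℕ.≤-trans (∣i∣≥1 lead≢0) (subst (λ x → ∣ x ∣ ≤ 2 ℕ.* S) (coeff-snoc-top lower lead) (snoc≤2S degree))
    4S≢0 = ℕ.>-nonZero (ℕ.≤-trans 1≤2S (ℕ.m≤m+n (2 ℕ.* S) _))
    module I = IdealInteger (euclid ℓ-prime (<-wellFounded degree) lower lead lead≢0
      (s≤s (degree≤ g≤m)) (2 ℕ.* S) snoc≤2S)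

-- Products over all pairs (a , I) and their large prime divisors

bit : Bool → ℤ
bit true  = 1ℤ
bit false = 0ℤ

bits→poly : ∀ {n} → Vec Bool n → Poly
bits→poly bs = Vec.toList (Vec.map bit bs)

bits→poly-≤1 : ∀ {n} (bs : Vec Bool n) → CoeffBound (bits→poly bs) 1
bits→poly-≤1 []           i       = z≤n
bits→poly-≤1 (true  ∷ bs) zero    = ℕ.≤-refl
bits→poly-≤1 (false ∷ bs) zero    = z≤n
bits→poly-≤1 (b     ∷ bs) (suc i) = bits→poly-≤1 bs i

bits→poly-degree : ∀ {n} (bs : Vec Bool n) i → n ≤ i → coeff (bits→poly bs) i ≡ 0ℤ
bits→poly-degree []       i       _         = refl
bits→poly-degree (b ∷ bs) (suc i) (s≤s n≤i) = bits→poly-degree bs i n≤i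

product-bits : ∀ n → (Vec Bool n → ℕ) → ℕ
product-bits zero    F = F []
product-bits (suc n) F = product-bits n (F ∘ (true ∷_)) ℕ.* product-bits n (F ∘ (false ∷_))

∣-product-bits : ∀ n F bs → F bs ℕ.∣ product-bits n F
∣-product-bits zero    F []           = ℕ.∣-refl
∣-product-bits (suc n) F (true  ∷ bs) = ℕ.∣m⇒∣m*n _ (∣-product-bits n (F ∘ (true ∷_)) bs)
∣-product-bits (suc n) F (false ∷ bs) = ℕ.∣n⇒∣m*n (product-bits n (F ∘ (true ∷_))) (∣-product-bits n (F ∘ (false ∷_)) bs)

product-bits-≥1 : ∀ n F → (∀ bs → 1 ≤ F bs) → 1 ≤ product-bits n F
product-bits-≥1 zero    F F≥1 = F≥1 []
product-bits-≥1 (suc n) F F≥1 = ℕ.*-mono-≤ (product-bits-≥1 n _ (λ bs → F≥1 (true ∷ bs))) (product-bits-≥1 n _ (λ bs → F≥1 (false ∷ bs)))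

^-double : ∀ b m → b ^ m ℕ.* b ^ m ≡ b ^ (2 ℕ.* m)
^-double b m = trans (sym (ℕ.^-distribˡ-+-* b m m)) (cong (λ u → b ^ (m ℕ.+ u)) (sym (ℕ.+-identityʳ m)))

product-bits-≤ : ∀ n F {b} → (∀ bs → F bs ≤ b) → product-bits n F ≤ b ^ (2 ^ n)
product-bits-≤ zero    F {b} F≤b = ℕ.≤-trans (F≤b []) (ℕ.≤-reflexive (sym (ℕ.*-identityʳ b)))
product-bits-≤ (suc n) F {b} F≤b = ℕ.≤-trans
  (ℕ.*-mono-≤ (product-bits-≤ n _ (λ bs → F≤b (true ∷ bs))) (product-bits-≤ n _ (λ bs → F≤b (false ∷ bs))))
  (ℕ.≤-reflexive (^-double b (2 ^ n)))

product-below : (ℕ → ℕ) → ℕ → ℕ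
product-below F zero    = 1
product-below F (suc n) = F n ℕ.* product-below F n

∣-product-below : ∀ F {i n} → i < n → F i ℕ.∣ product-below F n
∣-product-below F {i} {suc n} i<1+n with i ℕ.≟ n
... | yes refl = ℕ.∣m⇒∣m*n _ ℕ.∣-refl
... | no  i≢n  = ℕ.∣n⇒∣m*n (F n) (∣-product-below F (ℕ.≤∧≢⇒< (ℕ.≤-pred i<1+n) i≢n))

product-below-≥1 : ∀ F n → (∀ i → 1 ≤ F i) → 1 ≤ product-below F n
product-below-≥1 F zero    F≥1 = ℕ.≤-refl
product-below-≥1 F (suc n) F≥1 = ℕ.*-mono-≤ (F≥1 n) (product-below-≥1 F n F≥1)

product-below-≤ : ∀ F n {b} → (∀ i → i < n → F i ≤ b) → product-below F n ≤ b ^ n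
product-below-≤ F zero    F≤b = ℕ.≤-refl
product-below-≤ F (suc n) F≤b = ℕ.*-mono-≤ (F≤b n (ℕ.n<1+n n)) (product-below-≤ F n (λ i i<n → F≤b i (ℕ.m≤n⇒m≤1+n i<n)))

-- The new prime divides N = k · `product ps`, but not `product ps`, all of whose primes differ from
-- it; so it divides k.
product-of-primes-∣ : ∀ ps {N} → Unique ps → All Prime ps → All (ℕ._∣ N) ps → product ps ℕ.∣ N
product-of-primes-∣ []       _              _          _            = ℕ.1∣ _
product-of-primes-∣ (p ∷ ps) (p∉ps ∷ uniq) (pr ∷ prs) (p∣N ∷ ps∣N)
  with product-of-primes-∣ ps uniq prs ps∣N
... | ℕ.divides k N≡ with euclidsLemma k (product ps) pr (subst (p ℕ.∣_) N≡ p∣N)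
...   | inj₁ p∣k  = subst (p ℕ.* product ps ℕ.∣_) (sym N≡) (ℕ.*-monoˡ-∣ (product ps) p∣k)
...   | inj₂ p∣ps = contradiction refl (All.lookup p∉ps (factorisationHasAllPrimeFactors pr p∣ps prs))

power≤product : ∀ ps {B} → All (B <_) ps → B ^ length ps ≤ product ps
power≤product []       []           = ℕ.≤-refl
power≤product (p ∷ ps) (B<p ∷ B<ps) = ℕ.*-mono-≤ (ℕ.<⇒≤ B<p) (power≤product ps B<ps)

-- More than e distinct primes above B would have a product larger than B^e that divides N.
count-prime-divisors : ∀ ps {N B e} → 2 ≤ B → 1 ≤ N → N ≤ B ^ e →
  Unique ps → All Prime ps → All (B <_) ps → All (ℕ._∣ N) ps → length ps ≤ e
count-prime-divisors ps {N} {B} {e} 2≤B 1≤N N≤ uniq prs B<ps ps∣N = ℕ.≮⇒≥ λ e<len →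
  ℕ.<-irrefl refl (begin-strict
    B ^ e          <⟨ ℕ.^-monoʳ-< B 2≤B e<len ⟩
    B ^ length ps  ≤⟨ power≤product ps B<ps ⟩
    product ps     ≤⟨ ℕ.∣⇒≤ {{ℕ.>-nonZero 1≤N}} (product-of-primes-∣ ps uniq prs ps∣N) ⟩
    N              ≤⟨ N≤ ⟩
    B ^ e          ∎)
  where open ℕ.≤-Reasoning

module _ {n : ℕ} (ℓ-prime : Prime (suc n)) where
  private
    ℓ = suc n
    E = suc ℓ ^ n

  -- a ∷ bits→poly bs is a + Σ_{i ∈ I} X^i for the subset I of {1, …, n} given
  -- by bs.
  subset-ideal : ∀ a (bs : Vec Bool n) →
    (∀ i → i < n → coeff (a ∷ bits→poly bs) i ≡ coeff (a ∷ bits→poly bs) n)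
    ⊎ IdealInteger ℓ (a ∷ bits→poly bs) ((2 ℕ.* (2 ℕ.* suc ∣ a ∣)) ^ E)
  subset-ideal a bs = ideal-integer ℓ-prime (a ∷ bits→poly bs) (suc ∣ a ∣)
    (λ { (suc i) (s≤s n≤i) → bits→poly-degree bs i n≤i })
    (λ { zero    → ℕ.n≤1+n ∣ a ∣
       ; (suc i) → ℕ.≤-trans (bits→poly-≤1 bs i) (s≤s z≤n) })

  -- The value 1, neutral in the products below, stands for the case in which a + Σ X^i is a
  -- multiple of Φ_ℓ; this happens only if I is empty or full.
  subset-integer : ℤ → Vec Bool n → ℕ
  subset-integer a bs = [ (λ _ → 1) , IdealInteger.N ]′ (subset-ideal a bs)

  subset-integer-≥1 : ∀ a bs → 1 ≤ subset-integer a bs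
  subset-integer-≥1 a bs with subset-ideal a bs
  ... | inj₁ _ = ℕ.≤-refl
  ... | inj₂ I = IdealInteger.N≥1 I

  subset-integer-≤ : ∀ {A} a bs → ∣ a ∣ ≤ A → subset-integer a bs ≤ (4 ℕ.* suc A) ^ E
  subset-integer-≤ {A} a bs a≤A with subset-ideal a bs
  ... | inj₁ _ = ℕ.>-nonZero⁻¹ ((4 ℕ.* suc A) ^ E) {{ℕ.m^n≢0 (4 ℕ.* suc A) E}}
  ... | inj₂ I = ℕ.≤-trans (IdealInteger.N≤b I) (ℕ.^-monoˡ-≤ E
    (ℕ.≤-trans (ℕ.≤-reflexive (sym (ℕ.*-assoc 2 2 (suc ∣ a ∣)))) (ℕ.*-monoʳ-≤ 4 (s≤s a≤A))))

  ∣-subset-integer : ∀ a bs p d → ¬ (∀ i → i < n → coeff (a ∷ bits→poly bs) i ≡ coeff (a ∷ bits→poly bs) n) →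
    + p ∣ eval (ones ℓ) d → + p ∣ eval (a ∷ bits→poly bs) d → p ℕ.∣ subset-integer a bs
  ∣-subset-integer a bs p d nonconstant p∣Φ p∣h with subset-ideal a bs
  ... | inj₁ constant = contradiction constant nonconstant
  ... | inj₂ I        = ℤ.∣⇒∣ᵤ (IdealInteger.common I p d p∣Φ p∣h)

  -- All pairs (a , I) with ∣ a ∣ ≤ A at once; the product runs over ∣ a ∣, hence two factors for
  -- the two signs.
  bad-product : ℕ → ℕ
  bad-product A = product-below
    (λ i → product-bits n (subset-integer (+ i)) ℕ.* product-bits n (subset-integer (- + i))) (suc A)

  ∣-bad-product : ∀ {A} a bs → ∣ a ∣ ≤ A → subset-integer a bs ℕ.∣ bad-product A
  ∣-bad-product {A} a bs a≤A = ℕ.∣-trans (factor a) (∣-product-below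
      (λ i → product-bits n (subset-integer (+ i)) ℕ.* product-bits n (subset-integer (- + i))) (s≤s a≤A))
    where
    factor : ∀ a → subset-integer a bs ℕ.∣
      product-bits n (subset-integer (+ ∣ a ∣)) ℕ.* product-bits n (subset-integer (- + ∣ a ∣))
    factor (+ i)      = ℕ.∣m⇒∣m*n _ (∣-product-bits n (subset-integer (+ i)) bs)
    factor -[1+ i ]   = ℕ.∣n⇒∣m*n (product-bits n (subset-integer (+ suc i))) (∣-product-bits n (subset-integer -[1+ i ]) bs)

  bad-product-≥1 : ∀ A → 1 ≤ bad-product A
  bad-product-≥1 A = product-below-≥1 _ (suc A) λ i → ℕ.*-mono-≤
    (product-bits-≥1 n (subset-integer (+ i)) (subset-integer-≥1 (+ i)))
    (product-bits-≥1 n (subset-integer (- + i)) (subset-integer-≥1 (- + i)))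

  -- E for a single integer, 2^n for the subsets and 2 for the signs.
  bad-exponent : ℕ
  bad-exponent = E ℕ.* (2 ℕ.* 2 ^ n)

  bad-product-≤ : ∀ A → bad-product A ≤ (4 ℕ.* suc A) ^ (bad-exponent ℕ.* suc A)
  bad-product-≤ A = ℕ.≤-trans (product-below-≤ _ (suc A) bound)
    (ℕ.≤-reflexive (trans (cong (_^ suc A) (trans (^-double (B ^ E) (2 ^ n)) (ℕ.^-*-assoc B E (2 ℕ.* 2 ^ n))))
      (ℕ.^-*-assoc B bad-exponent (suc A))))
    where
    B = 4 ℕ.* suc A
    bound : ∀ i → i < suc A → product-bits n (subset-integer (+ i)) ℕ.* product-bits n (subset-integer (- + i))
      ≤ (B ^ E) ^ (2 ^ n) ℕ.* (B ^ E) ^ (2 ^ n)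
    bound i (s≤s i≤A) = ℕ.*-mono-≤
      (product-bits-≤ n (subset-integer (+ i)) λ bs → subset-integer-≤ (+ i) bs i≤A)
      (product-bits-≤ n (subset-integer (- + i)) λ bs → subset-integer-≤ (- + i) bs
        (subst (_≤ A) (sym (ℤ.∣-i∣≡∣i∣ (+ i))) i≤A))

  -- The threshold 4 (A + 1) for the primes is also the base in the bound on `bad-product`, so its
  -- exponent bounds their number: linear in A, without a logarithm.
  count-bad-primes : ∀ A ps → Unique ps → All Prime ps → All (4 ℕ.* suc A <_) ps → All (ℕ._∣ bad-product A) ps →
    length ps ≤ bad-exponent ℕ.* suc A
  count-bad-primes A ps = count-prime-divisors ps {e = bad-exponent ℕ.* suc A}
    (ℕ.≤-trans (s≤s (s≤s z≤n)) (ℕ.*-monoʳ-≤ 4 (s≤s (z≤n {A})))) (bad-product-≥1 A) (bad-product-≤ A)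

-- The subleading coefficient of a factor of Φ_ℓ - N

monic : ∀ {k} → Vec ℤ k → ℤ → ℤ
monic as z = eval (snoc as 1ℤ) z

subleading : ∀ {k} → Vec ℤ (suc k) → ℤ
subleading = Vec.last

-- By Horner's scheme the coefficients of the quotient by X - r are the
-- values at r of the tails.
quotient-at : ∀ {k} → Vec ℤ (suc k) → ℤ → Vec ℤ k
quotient-at (a ∷ [])         r = []
quotient-at (a ∷ as@(_ ∷ _)) r = monic as r ∷ quotient-at as r

quotient-at-spec : ∀ {k} (as : Vec ℤ (suc k)) r z →
  monic as z - monic as r ≡ (z - r) * monic (quotient-at as r) z
quotient-at-spec (a ∷ []) r z = base a r z
  where
  base : ∀ a r z → a + z * (1ℤ + z * 0ℤ) - (a + r * (1ℤ + r * 0ℤ)) ≡ (z - r) * (1ℤ + z * 0ℤ)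
  base = solve-∀
quotient-at-spec (a ∷ as@(_ ∷ _)) r z = begin
  a + z * F - (a + r * G)          ≡⟨ rearrange₁ a z r F G ⟩
  (z - r) * G + z * (F - G)        ≡⟨ cong (λ u → (z - r) * G + z * u) (quotient-at-spec as r z) ⟩
  (z - r) * G + z * ((z - r) * Q)  ≡⟨ rearrange₂ z r G Q ⟩
  (z - r) * (G + z * Q)            ∎
  where
  open ≡-Reasoning
  F = monic as z
  G = monic as r
  Q = monic (quotient-at as r) z
  rearrange₁ : ∀ a z r F G → a + z * F - (a + r * G) ≡ (z - r) * G + z * (F - G)
  rearrange₁ = solve-∀
  rearrange₂ : ∀ z r G Q → (z - r) * G + z * ((z - r) * Q) ≡ (z - r) * (G + z * Q)
  rearrange₂ = solve-∀

-- The roots of the quotient are those of f - f(r) except r, so by Vieta r is added. The degree is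
-- at least 2, so subtracting f(r) does not touch the subleading coefficient.
subleading-quotient-at : ∀ {k} (as : Vec ℤ (suc (suc k))) r →
  subleading (quotient-at as r) ≡ subleading as + r
subleading-quotient-at (a ∷ b ∷ []) r = base b r
  where
  base : ∀ b r → b + r * (1ℤ + r * 0ℤ) ≡ b + r
  base = solve-∀
subleading-quotient-at (a ∷ as@(_ ∷ _ ∷ _)) r = subleading-quotient-at as r

sum : List ℤ → ℤ
sum = List.foldr _+_ 0ℤ

-- Divided differences of a monic polynomial, for a notion of smallness
-- that survives division by the differences of the nodes.  It is used with
-- divisibility by a prime and with bounds on absolute values.
module Interpolation
  (Small  : ℕ → ℤ → Set)
  (Spaced : ℤ → ℤ → Set)
  (divide : ∀ {n x y z w} v → Spaced z w → Small n x → Small n y → x - y ≡ (w - z) * v → Small (suc n) v)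
  where

  divide-all : ∀ {k n} (f : Vec ℤ (suc k)) z zs → All (Spaced z) zs →
    Small n (monic f z) → All (Small n ∘ monic f) zs → All (Small (suc n) ∘ monic (quotient-at f z)) zs
  divide-all f z []       []       sz []         = []
  divide-all f z (w ∷ zs) (s ∷ ss) sz (sw ∷ szs) =
    divide (monic (quotient-at f z) w) s sw sz (quotient-at-spec f z w) ∷ divide-all f z zs ss sz szs

  -- The divided difference of order k of a monic polynomial of degree k is its leading coefficient.
  -- The index of `Small` counts the divisions made.
  small-lead : ∀ {k n} (f : Vec ℤ k) zs → k < length zs → AllPairs Spaced zs →
    All (Small n ∘ monic f) zs → Small (k ℕ.+ n) 1ℤ
  small-lead         []        (z ∷ zs) _         _        (s ∷ _)  = subst (Small _) (eval-const 1ℤ z) s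
  small-lead {suc k} f@(_ ∷ _) (z ∷ zs) (s≤s k<l) (p ∷ ps) (s ∷ ss) = subst (λ n → Small n 1ℤ) (ℕ.+-suc k _)
    (small-lead (quotient-at f z) zs k<l ps (divide-all f z zs p s ss))

  -- One order lower, the last quotient is X plus a constant that has collected every node but the
  -- last; its value there is the given sum. If all nodes are roots modulo p, this is Vieta's
  -- formula.
  small-subleading : ∀ {k n} (f : Vec ℤ (suc k)) zs → length zs ≡ suc k → AllPairs Spaced zs →
    All (Small n ∘ monic f) zs → Small (k ℕ.+ n) (subleading f + sum zs)
  small-subleading (a ∷ []) (z ∷ []) _ _ (s ∷ _) = subst (Small _) (base a z) s
    where
    base : ∀ a z → a + z * (1ℤ + z * 0ℤ) ≡ a + (z + 0ℤ)
    base = solve-∀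
  small-subleading {suc k} f@(_ ∷ _ ∷ _) (z ∷ zs) l≡ (p ∷ ps) (s ∷ ss) = subst₂ Small (ℕ.+-suc k _)
    (trans (cong (_+ sum zs) (subleading-quotient-at f z)) (ℤ.+-assoc (subleading f) z (sum zs)))
    (small-subleading (quotient-at f z) zs (ℕ.suc-injective l≡) ps (divide-all f z zs p s ss))

-- Splitting a list of points by a bit vector

select : ∀ {n} → Vec Bool n → Vec ℤ n → List ℤ
select []           []       = []
select (true  ∷ bs) (x ∷ xs) = x ∷ select bs xs
select (false ∷ bs) (x ∷ xs) = select bs xs

unselect : ∀ {n} → Vec Bool n → Vec ℤ n → List ℤ
unselect = select ∘ Vec.map not

All-select : ∀ {n} {P : ℤ → Set} bs (xs : Vec ℤ n) → All P (Vec.toList xs) → All P (select bs xs)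
All-select []           []       []       = []
All-select (true  ∷ bs) (x ∷ xs) (p ∷ ps) = p ∷ All-select bs xs ps
All-select (false ∷ bs) (x ∷ xs) (p ∷ ps) = All-select bs xs ps

AllPairs-select : ∀ {n} {P : ℤ → ℤ → Set} bs (xs : Vec ℤ n) → AllPairs P (Vec.toList xs) → AllPairs P (select bs xs)
AllPairs-select []           []       []       = []
AllPairs-select (true  ∷ bs) (x ∷ xs) (p ∷ ps) = All-select bs xs p ∷ AllPairs-select bs xs ps
AllPairs-select (false ∷ bs) (x ∷ xs) (p ∷ ps) = AllPairs-select bs xs ps

length-select : ∀ {n} bs (xs : Vec ℤ n) → length (select bs xs) ℕ.+ length (unselect bs xs) ≡ n
length-select []           []       = refl
length-select (true  ∷ bs) (x ∷ xs) = cong suc (length-select bs xs)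
length-select (false ∷ bs) (x ∷ xs) = trans (ℕ.+-suc _ _) (cong suc (length-select bs xs))

-- An element with both properties is assigned once. As the two lists have n entries together, an
-- upper bound for the length of one is a lower bound for the other; both the roots modulo p and the
-- interpolation nodes are counted in this way.
choose : ∀ {n} {P Q : ℤ → Set} (xs : Vec ℤ n) → All (λ x → P x ⊎ Q x) (Vec.toList xs) →
  ∃ λ bs → All P (select bs xs) × All Q (unselect bs xs)
choose []       []            = [] , [] , []
choose (x ∷ xs) (inj₁ p ∷ ps) = let bs , ps , qs = choose xs ps in true  ∷ bs , p ∷ ps , qs
choose (x ∷ xs) (inj₂ q ∷ ps) = let bs , ps , qs = choose xs ps in false ∷ bs , ps , q ∷ qs

select-nonempty : ∀ {n} bs (xs : Vec ℤ n) → 1 ≤ length (select bs xs) →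
  ∃ λ i → i < n × coeff (bits→poly bs) i ≡ 1ℤ
select-nonempty []           []       ()
select-nonempty (true  ∷ bs) (x ∷ xs) _  = 0 , s≤s z≤n , refl
select-nonempty (false ∷ bs) (x ∷ xs) 1≤ = let i , i<n , eq = select-nonempty bs xs 1≤ in suc i , s≤s i<n , eq

unselect-nonempty : ∀ {n} bs (xs : Vec ℤ n) → 1 ≤ length (unselect bs xs) →
  ∃ λ i → i < n × coeff (bits→poly bs) i ≡ 0ℤ
unselect-nonempty []           []       ()
unselect-nonempty (false ∷ bs) (x ∷ xs) _  = 0 , s≤s z≤n , refl
unselect-nonempty (true  ∷ bs) (x ∷ xs) 1≤ = let i , i<n , eq = unselect-nonempty bs xs 1≤ in suc i , s≤s i<n , eq

-- The powers of d as roots of Φ_ℓ modulo p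

powers : ℤ → ℤ → ∀ n → Vec ℤ n
powers c d zero    = []
powers c d (suc n) = c ∷ powers (c * d) d n

sum-select-powers : ∀ {n} c d (bs : Vec Bool n) → sum (select bs (powers c d n)) ≡ c * eval (bits→poly bs) d
sum-select-powers c d []           = sym (ℤ.*-zeroʳ c)
sum-select-powers {suc n} c d (true  ∷ bs) = trans (cong (_+_ c) (sum-select-powers (c * d) d bs))
  (rearrange c d (eval (bits→poly bs) d))
  where
  rearrange : ∀ c d u → c + c * d * u ≡ c * (1ℤ + d * u)
  rearrange = solve-∀
sum-select-powers {suc n} c d (false ∷ bs) = trans (sum-select-powers (c * d) d bs)
  (rearrange c d (eval (bits→poly bs) d))
  where
  rearrange : ∀ c d u → c * d * u ≡ c * (0ℤ + d * u)
  rearrange = solve-∀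

geometric : ∀ n x → (x - 1ℤ) * eval (ones n) x ≡ x ℤ.^ n - 1ℤ
geometric zero    x = ℤ.*-zeroʳ (x - 1ℤ)
geometric (suc n) x = begin
  (x - 1ℤ) * (1ℤ + x * F)          ≡⟨ rearrange₁ x F ⟩
  x - 1ℤ + x * ((x - 1ℤ) * F)      ≡⟨ cong (λ u → x - 1ℤ + x * u) (geometric n x) ⟩
  x - 1ℤ + x * (x ℤ.^ n - 1ℤ)      ≡⟨ rearrange₂ x (x ℤ.^ n) ⟩
  x * x ℤ.^ n - 1ℤ                 ∎
  where
  open ≡-Reasoning
  F = eval (ones n) x
  rearrange₁ : ∀ x F → (x - 1ℤ) * (1ℤ + x * F) ≡ x - 1ℤ + x * ((x - 1ℤ) * F)
  rearrange₁ = solve-∀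
  rearrange₂ : ∀ x P → x - 1ℤ + x * (P - 1ℤ) ≡ x * P - 1ℤ
  rearrange₂ = solve-∀

-- Here n is the value at 1. For n = ℓ this excludes d ≡ 1 modulo a prime p > ℓ that divides Φ_ℓ(d).
x-1∣Φ-ℓ : ∀ n x → x - 1ℤ ∣ eval (ones n) x - + n
x-1∣Φ-ℓ zero    x = divides 0ℤ refl
x-1∣Φ-ℓ (suc n) x with x-1∣Φ-ℓ n x
... | divides k eq = divides (k + F) (begin
  1ℤ + x * F - + suc n                ≡⟨ rearrange₁ x F (+ n) ⟩
  (F - + n) + F * (x - 1ℤ)            ≡⟨ cong (_+ F * (x - 1ℤ)) eq ⟩
  k * (x - 1ℤ) + F * (x - 1ℤ)         ≡⟨ sym (ℤ.*-distribʳ-+ (x - 1ℤ) k F) ⟩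
  (k + F) * (x - 1ℤ)                  ∎)
  where
  open ≡-Reasoning
  F = eval (ones n) x
  rearrange₁ : ∀ x F m → 1ℤ + x * F - (1ℤ + m) ≡ (F - m) + F * (x - 1ℤ)
  rearrange₁ = solve-∀

module RootsModPrime {n p d} (ℓ-prime : Prime (suc n)) (p-prime : Prime p) (ℓ<p : suc n < p)
  (p∣Φ : + p ∣ eval (ones (suc n)) d) where
  private
    ℓ = suc n

  UnityExponent : ℕ → Set
  UnityExponent t = + p ∣ d ℤ.^ t - 1ℤ

  unity-ℓ : UnityExponent ℓ
  unity-ℓ = subst (+ p ∣_) (geometric ℓ d) (ℤ.∣n⇒∣m*n (d - 1ℤ) p∣Φ)

  ∣x^m-1 : ∀ x m → + p ∣ x - 1ℤ → + p ∣ x ℤ.^ m - 1ℤ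
  ∣x^m-1 x m p∣x-1 = subst (+ p ∣_) (geometric m x) (ℤ.∣m⇒∣m*n (eval (ones m) x) p∣x-1)

  unity-* : ∀ s t → UnityExponent t → UnityExponent (s ℕ.* t)
  unity-* s t u = subst (λ x → + p ∣ x - 1ℤ)
    (trans (ℤ.^-*-assoc d t s) (cong (d ℤ.^_) (ℕ.*-comm t s))) (∣x^m-1 (d ℤ.^ t) s u)

  p∤d : ¬ (+ p ∣ d)
  p∤d p∣d = ∤1 p-prime (subst (+ p ∣_) (rearrange (d * d ℤ.^ n))
    (ℤ.∣m∣n⇒∣m-n (ℤ.∣m⇒∣m*n (d ℤ.^ n) p∣d) unity-ℓ))
    where
    rearrange : ∀ x → x - (x - 1ℤ) ≡ 1ℤ
    rearrange = solve-∀

  p∤d-1 : ¬ (+ p ∣ d - 1ℤ)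
  p∤d-1 p∣d-1 = ℕ.<⇒≱ ℓ<p (ℕ.∣⇒≤ (ℤ.∣⇒∣ᵤ (subst (+ p ∣_) (rearrange (eval (ones ℓ) d) (+ ℓ))
    (ℤ.∣m∣n⇒∣m-n p∣Φ (ℤ.∣-trans p∣d-1 (x-1∣Φ-ℓ ℓ d))))))
    where
    rearrange : ∀ x y → x - (x - y) ≡ y
    rearrange = solve-∀

  unity-1 : ∀ a b → UnityExponent a → UnityExponent b → 1 ℕ.+ a ≡ b → + p ∣ d - 1ℤ
  unity-1 a b ua ub refl = subst (+ p ∣_) (rearrange d (d ℤ.^ a)) (ℤ.∣m∣n⇒∣m-n ub (ℤ.∣n⇒∣m*n d ua))
    where
    rearrange : ∀ d x → d * x - 1ℤ - d * (x - 1ℤ) ≡ d - 1ℤ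
    rearrange = solve-∀

  -- The exponents with d^t ≡ 1 are closed under multiples, and t is coprime to ℓ. Bézout yields two
  -- of them that differ by 1, hence d ≡ 1, which is excluded.
  ¬unity : ∀ {t} → 1 ≤ t → t < ℓ → ¬ UnityExponent t
  ¬unity {t} 1≤t t<ℓ u with Coprime.coprime-Bézout (Coprime.prime⇒coprime ℓ-prime {{ℕ.>-nonZero 1≤t}} t<ℓ)
  ... | Bézout.+- x y eq = p∤d-1 (unity-1 (y ℕ.* t) (x ℕ.* ℓ) (unity-* y t u) (unity-* x ℓ unity-ℓ) eq)
  ... | Bézout.-+ x y eq = p∤d-1 (unity-1 (x ℕ.* ℓ) (y ℕ.* t) (unity-* x ℓ unity-ℓ) (unity-* y t u) eq)

  -- p divides d^(t ℓ) - 1 = (d^t - 1) Φ_ℓ(d^t), but not the first factor.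
  root-power : ∀ {t} → 1 ≤ t → t < ℓ → + p ∣ eval (ones ℓ) (d ℤ.^ t)
  root-power {t} 1≤t t<ℓ = [ (λ p∣x-1 → contradiction p∣x-1 (¬unity 1≤t t<ℓ)) , id ]′
    (prime∣* p-prime (d ℤ.^ t - 1ℤ) (eval (ones ℓ) (d ℤ.^ t))
      (subst (+ p ∣_) (sym (geometric ℓ (d ℤ.^ t)))
        (subst (λ x → + p ∣ x - 1ℤ) (sym (ℤ.^-*-assoc d t ℓ)) (unity-* t ℓ unity-ℓ))))

  Distinct : ℤ → ℤ → Set
  Distinct z w = ¬ (+ p ∣ w - z)

  PowerIn : ℕ → ℕ → ℤ → Set
  PowerIn s m w = ∃ λ t → s ≤ t × t < s ℕ.+ m × w ≡ d ℤ.^ t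

  powers-are-powers : ∀ s m → All (PowerIn s m) (Vec.toList (powers (d ℤ.^ s) d m))
  powers-are-powers s zero    = []
  powers-are-powers s (suc m) =
    (s , ℕ.≤-refl , ℕ.m<m+n s (s≤s z≤n) , refl) ∷
    subst (λ c → All (PowerIn s (suc m)) (Vec.toList (powers c d m))) (ℤ.*-comm d (d ℤ.^ s))
      (All.map (λ { (t , s<t , t< , eq) → t , ℕ.<⇒≤ s<t , subst (t <_) (sym (ℕ.+-suc s m)) t< , eq })
        (powers-are-powers (suc s) m))

  powers-distinct : ∀ s m → s ℕ.+ m ≤ ℓ → AllPairs Distinct (Vec.toList (powers (d ℤ.^ s) d m))
  powers-distinct s zero    _ = []
  powers-distinct s (suc m) s+m<ℓ =
    subst (λ c → All (Distinct (d ℤ.^ s)) (Vec.toList (powers c d m))) (ℤ.*-comm d (d ℤ.^ s))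
      (All.map distinct (powers-are-powers (suc s) m)) ∷
    subst (λ c → AllPairs Distinct (Vec.toList (powers c d m))) (ℤ.*-comm d (d ℤ.^ s))
      (powers-distinct (suc s) m (subst (_≤ ℓ) (ℕ.+-suc s m) s+m<ℓ))
    where
    p∤d^ : ∀ t → ¬ (+ p ∣ d ℤ.^ t)
    p∤d^ zero    = ∤1 p-prime
    p∤d^ (suc t) = [ p∤d , p∤d^ t ]′ ∘ prime∣* p-prime d (d ℤ.^ t)
    distinct : ∀ {w} → PowerIn (suc s) m w → Distinct (d ℤ.^ s) w
    distinct (t , s<t , t<s+m , refl) p∣ = [ p∤d^ s , ¬unity (ℕ.m<n⇒0<n∸m s<t)
        (ℕ.≤-<-trans (ℕ.m∸n≤m t s) (ℕ.<-≤-trans t<s+m (subst (_≤ ℓ) (ℕ.+-suc s m) s+m<ℓ))) ]′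
      (prime∣* p-prime (d ℤ.^ s) (d ℤ.^ (t ℕ.∸ s) - 1ℤ) (subst (+ p ∣_) factor p∣))
      where
      open ≡-Reasoning
      rearrange : ∀ x y → x * y - x ≡ x * (y - 1ℤ)
      rearrange = solve-∀
      factor : d ℤ.^ t - d ℤ.^ s ≡ d ℤ.^ s * (d ℤ.^ (t ℕ.∸ s) - 1ℤ)
      factor = begin
        d ℤ.^ t - d ℤ.^ s                           ≡⟨ cong (λ e → d ℤ.^ e - d ℤ.^ s) (sym (ℕ.m+[n∸m]≡n (ℕ.<⇒≤ s<t))) ⟩
        d ℤ.^ (s ℕ.+ (t ℕ.∸ s)) - d ℤ.^ s           ≡⟨ cong (_- d ℤ.^ s) (ℤ.^-distribˡ-+-* d s (t ℕ.∸ s)) ⟩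
        d ℤ.^ s * d ℤ.^ (t ℕ.∸ s) - d ℤ.^ s         ≡⟨ rearrange (d ℤ.^ s) (d ℤ.^ (t ℕ.∸ s)) ⟩
        d ℤ.^ s * (d ℤ.^ (t ℕ.∸ s) - 1ℤ)            ∎

  roots : Vec ℤ n
  roots = powers (d ℤ.^ 1) d n

  roots-distinct : AllPairs Distinct (Vec.toList roots)
  roots-distinct = powers-distinct 1 n ℕ.≤-refl

  -- Differences of the nodes are units modulo p, so divisibility by p survives every division
  -- without loss.
  open Interpolation (λ _ x → + p ∣ x) Distinct
    (λ {_} {x} {y} {z} {w} v z≢w p∣x p∣y eq → [ (λ p∣ → contradiction p∣ z≢w) , id ]′
      (prime∣* p-prime (w - z) v (subst (+ p ∣_) eq (ℤ.∣m∣n⇒∣m-n p∣x p∣y))))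

  -- Modulo p the factor f is ∏_{i ∈ I} (X - d^i), with I given by the bits.
  factor-roots : ∀ {k m} (f : Vec ℤ (suc k)) (g : Vec ℤ m) c → 1 ≤ m → suc k ℕ.+ m ≡ n →
    (∀ z → monic f z * monic g z ≡ eval (ones ℓ) z - c * + p) →
    ∃ λ bs → + p ∣ eval (subleading f ∷ bits→poly bs) d ×
             ¬ (∀ i → i < n → coeff (subleading f ∷ bits→poly bs) i ≡ coeff (subleading f ∷ bits→poly bs) n)
  factor-roots {k} {m} f g c 1≤m k+m≡n fg≗
    with choose {P = λ x → + p ∣ monic f x} {Q = λ x → + p ∣ monic g x} roots (All.map
      (λ { {x} (t , 1≤t , t<ℓ , x≡) → prime∣* p-prime (monic f x) (monic g x) (subst (+ p ∣_) (sym (fg≗ x))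
           (ℤ.∣m∣n⇒∣m-n (subst (λ x → + p ∣ eval (ones ℓ) x) (sym x≡) (root-power 1≤t t<ℓ)) (ℤ.∣n⇒∣m*n c ℤ.∣-refl))) })
      (powers-are-powers 1 n))
  ... | bs , p∣f , p∣g = bs , subst (+ p ∣_) sum≡ p∣sum , nonconstant
    where
    f-roots = select bs roots
    g-roots = unselect bs roots

    -- More roots than the degree allows would make p divide the leading coefficient 1.
    #f≤ : length f-roots ≤ suc k
    #f≤ = ℕ.≮⇒≥ λ k<# → ∤1 p-prime (small-lead {n = 0} f f-roots k<# (AllPairs-select bs roots roots-distinct) p∣f)

    #g≤ : length g-roots ≤ m
    #g≤ = ℕ.≮⇒≥ λ m<# → ∤1 p-prime (small-lead {n = 0} g g-roots m<# (AllPairs-select (Vec.map not bs) roots roots-distinct) p∣g)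

    #f+#g≡ : length f-roots ℕ.+ length g-roots ≡ suc k ℕ.+ m
    #f+#g≡ = trans (length-select bs roots) (sym k+m≡n)

    -- The two upper bounds add up to n, the number of all roots, so both are attained.
    #f≡ : length f-roots ≡ suc k
    #f≡ = ℕ.≤-antisym #f≤ (ℕ.+-cancelʳ-≤ m (suc k) (length f-roots)
      (ℕ.≤-trans (ℕ.≤-reflexive (sym #f+#g≡)) (ℕ.+-monoʳ-≤ (length f-roots) #g≤)))

    #g≡ : length g-roots ≡ m
    #g≡ = ℕ.+-cancelˡ-≡ (suc k) (length g-roots) m (trans (cong (ℕ._+ length g-roots) (sym #f≡)) #f+#g≡)

    p∣sum : + p ∣ subleading f + sum f-roots
    p∣sum = small-subleading {n = 0} f f-roots #f≡ (AllPairs-select bs roots roots-distinct) p∣f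

    sum≡ : subleading f + sum f-roots ≡ eval (subleading f ∷ bits→poly bs) d
    sum≡ = cong (_+_ (subleading f)) (trans (sum-select-powers (d ℤ.^ 1) d bs)
      (cong (_* eval (bits→poly bs) d) (ℤ.^-identityʳ d)))

    -- Both factors have positive degree, so I is neither empty nor full, and both 1 and 0 occur
    -- among the coefficients of X, ..., X^n.
    nonconstant : ¬ (∀ i → i < n → coeff (subleading f ∷ bits→poly bs) i ≡ coeff (subleading f ∷ bits→poly bs) n)
    nonconstant constant
      with select-nonempty bs roots (subst (1 ≤_) (sym #f≡) (s≤s z≤n))
         | unselect-nonempty bs roots (subst (1 ≤_) (sym #g≡) 1≤m)
    ... | i , i<n , bᵢ≡1 | j , j<n , bⱼ≡0 = contradiction (trans (sym bᵢ≡1) (trans (equal i i<n) (trans (sym (equal j j<n)) bⱼ≡0))) λ ()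
      where
      equal : ∀ i → i < n → coeff (bits→poly bs) i ≡ coeff (subleading f ∷ bits→poly bs) n
      equal i i<n with suc i ℕ.≟ n
      ... | yes refl = refl
      ... | no  i+1≢n = constant (suc i) (ℕ.≤∧≢⇒< i<n i+1≢n)

-- The size of the subleading coefficient

eval-ones-≤ : ∀ n z {b} → 1 ≤ b → ∣ z ∣ ≤ b → ∣ eval (ones (suc n)) z ∣ ≤ suc n ℕ.* b ^ n
eval-ones-≤ zero    z {b} 1≤b z≤b = ℕ.≤-reflexive (cong ∣_∣ (eval-const 1ℤ z))
eval-ones-≤ (suc n) z {b} 1≤b z≤b = begin
  ∣ 1ℤ + z * F ∣                             ≤⟨ ℤ.∣i+j∣≤∣i∣+∣j∣ 1ℤ (z * F) ⟩
  1 ℕ.+ ∣ z * F ∣                            ≡⟨ cong (1 ℕ.+_) (ℤ.abs-* z F) ⟩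
  1 ℕ.+ ∣ z ∣ ℕ.* ∣ F ∣                      ≤⟨ ℕ.+-mono-≤ 1≤b^ (ℕ.*-mono-≤ z≤b (eval-ones-≤ n z 1≤b z≤b)) ⟩
  b ^ suc n ℕ.+ b ℕ.* (suc n ℕ.* b ^ n)      ≡⟨ rearrange b (suc n) (b ^ n) ⟩
  suc (suc n) ℕ.* b ^ suc n                  ∎
  where
  open ℕ.≤-Reasoning
  F = eval (ones (suc n)) z
  rearrange : ∀ b n P → b ℕ.* P ℕ.+ b ℕ.* (n ℕ.* P) ≡ suc n ℕ.* (b ℕ.* P)
  rearrange = ℕ-solve-∀
  1≤b^ : 1 ≤ b ^ suc n
  1≤b^ = ℕ.>-nonZero⁻¹ (b ^ suc n) {{ℕ.m^n≢0 b (suc n) {{ℕ.>-nonZero 1≤b}}}}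

-- Multiples of R are far enough apart for each division to gain a factor R, yet are themselves
-- O(R), which matters because their sum enters the bound.
nodes : ℕ → ℕ → ∀ n → Vec ℤ n
nodes R j zero    = []
nodes R j (suc n) = + (j ℕ.* R) ∷ nodes R (suc j) n

NodeIn : ℕ → ℕ → ℕ → ℤ → Set
NodeIn R j m w = ∃ λ i → j ≤ i × i < j ℕ.+ m × w ≡ + (i ℕ.* R)

nodes-are-nodes : ∀ R j m → All (NodeIn R j m) (Vec.toList (nodes R j m))
nodes-are-nodes R j zero    = []
nodes-are-nodes R j (suc m) = (j , ℕ.≤-refl , ℕ.m<m+n j (s≤s z≤n) , refl) ∷
  All.map (λ { (i , j<i , i< , eq) → i , ℕ.<⇒≤ j<i , subst (i <_) (sym (ℕ.+-suc j m)) i< , eq })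
    (nodes-are-nodes R (suc j) m)

nodes-spaced : ∀ R j m → AllPairs (λ z w → R ≤ ∣ w - z ∣) (Vec.toList (nodes R j m))
nodes-spaced R j zero    = []
nodes-spaced R j (suc m) = All.map spaced (nodes-are-nodes R (suc j) m) ∷ nodes-spaced R (suc j) m
  where
  spaced : ∀ {w} → NodeIn R (suc j) m w → R ≤ ∣ w - + (j ℕ.* R) ∣
  spaced (i , j<i , _ , refl) = begin
    R                               ≡⟨ sym (ℕ.*-identityˡ R) ⟩
    1 ℕ.* R                         ≤⟨ ℕ.*-monoˡ-≤ R (ℕ.m<n⇒0<n∸m j<i) ⟩
    (i ℕ.∸ j) ℕ.* R                 ≡⟨ ℕ.*-distribʳ-∸ R i j ⟩
    i ℕ.* R ℕ.∸ j ℕ.* R             ≡⟨ cong ∣_∣ (sym (trans (ℤ.m-n≡m⊖n (i ℕ.* R) (j ℕ.* R)) (ℤ.⊖-≥ (ℕ.*-monoˡ-≤ R (ℕ.<⇒≤ j<i))))) ⟩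
    ∣ + (i ℕ.* R) - + (j ℕ.* R) ∣   ∎
    where open ℕ.≤-Reasoning

sum-≤ : ∀ {b} xs → All (λ x → ∣ x ∣ ≤ b) xs → ∣ sum xs ∣ ≤ length xs ℕ.* b
sum-≤ []       []       = z≤n
sum-≤ (x ∷ xs) (p ∷ ps) = ℕ.≤-trans (ℤ.∣i+j∣≤∣i∣+∣j∣ x (sum xs)) (ℕ.+-mono-≤ p (sum-≤ xs ps))

module _ (s B R : ℕ) where
  -- This is ∣ x ∣ < (2 / R)^n B / s without denominators: each division by a difference of nodes
  -- gains R, each subtraction costs 2.
  Spread : ℕ → ℤ → Set
  Spread n x = s ℕ.* R ^ n ℕ.* ∣ x ∣ < 2 ^ n ℕ.* B

  spread-divide : ∀ {n x y z w} v → R ≤ ∣ w - z ∣ → Spread n x → Spread n y → x - y ≡ (w - z) * v → Spread (suc n) v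
  spread-divide {n} {x} {y} {z} {w} v R≤ x< y< eq = begin-strict
    s ℕ.* (R ℕ.* R ^ n) ℕ.* ∣ v ∣             ≡⟨ rearrange s R (R ^ n) ∣ v ∣ ⟩
    s ℕ.* R ^ n ℕ.* (R ℕ.* ∣ v ∣)             ≤⟨ ℕ.*-monoʳ-≤ (s ℕ.* R ^ n) (ℕ.*-monoˡ-≤ ∣ v ∣ R≤) ⟩
    s ℕ.* R ^ n ℕ.* (∣ w - z ∣ ℕ.* ∣ v ∣)     ≡⟨ cong (s ℕ.* R ^ n ℕ.*_) (trans (sym (ℤ.abs-* (w - z) v)) (cong ∣_∣ (sym eq))) ⟩
    s ℕ.* R ^ n ℕ.* ∣ x - y ∣                 ≤⟨ ℕ.*-monoʳ-≤ (s ℕ.* R ^ n) (ℤ.∣i-j∣≤∣i∣+∣j∣ x y) ⟩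
    s ℕ.* R ^ n ℕ.* (∣ x ∣ ℕ.+ ∣ y ∣)         ≡⟨ ℕ.*-distribˡ-+ (s ℕ.* R ^ n) ∣ x ∣ ∣ y ∣ ⟩
    s ℕ.* R ^ n ℕ.* ∣ x ∣ ℕ.+ s ℕ.* R ^ n ℕ.* ∣ y ∣ <⟨ ℕ.+-mono-< x< y< ⟩
    2 ^ n ℕ.* B ℕ.+ 2 ^ n ℕ.* B               ≡⟨ double (2 ^ n) B ⟩
    2 ^ suc n ℕ.* B                           ∎
    where
    open ℕ.≤-Reasoning
    rearrange : ∀ s R P v → s ℕ.* (R ℕ.* P) ℕ.* v ≡ s ℕ.* P ℕ.* (R ℕ.* v)
    rearrange = ℕ-solve-∀
    double : ∀ P B → P ℕ.* B ℕ.+ P ℕ.* B ≡ (2 ℕ.* P) ℕ.* B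
    double = ℕ-solve-∀

  module SpreadInterpolation = Interpolation Spread (λ z w → R ≤ ∣ w - z ∣)
    (λ {n} {x} {y} {z} {w} → spread-divide {n} {x} {y} {z} {w})

^-distribʳ-* : ∀ n a b → (a ℕ.* b) ^ n ≡ a ^ n ℕ.* b ^ n
^-distribʳ-* zero    a b = refl
^-distribʳ-* (suc n) a b = trans (cong (a ℕ.* b ℕ.*_) (^-distribʳ-* n a b)) (rearrange a b (a ^ n) (b ^ n))
  where
  rearrange : ∀ a b P Q → a ℕ.* b ℕ.* (P ℕ.* Q) ≡ a ℕ.* P ℕ.* (b ℕ.* Q)
  rearrange = ℕ-solve-∀

-- The factor 2 is for Φ_ℓ(z) and N, each of which is at most ℓ (ℓ R)^n in absolute value at the
-- nodes.
growth : ℕ → ℕ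
growth n = 2 ℕ.* (suc n ℕ.* suc n ^ n)

1≤growth : ∀ n → 1 ≤ growth n
1≤growth n = ℕ.*-mono-≤ {1} {2} (s≤s z≤n)
  (ℕ.*-mono-≤ {1} {suc n} (s≤s z≤n) (ℕ.>-nonZero⁻¹ (suc n ^ n) {{ℕ.m^n≢0 (suc n) n}}))

-- The first summand bounds the divided difference, the second the sum of at most n nodes, each at
-- most n R.
subleading-factor : ℕ → ℕ
subleading-factor n = 2 ^ n ℕ.* growth n ℕ.+ n ℕ.* n

-- Among any m + 1 nodes of spacing R a monic polynomial g of degree m has
-- a value of size at least (R/2)^m; where g is large its cofactor f is small,
-- and interpolation at k such nodes bounds the subleading coefficient of f.
module FactorSize {n R : ℕ} (1≤R : 1 ≤ R) where
  private
    ℓ = suc n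
    instance
      R≢0 : NonZero R
      R≢0 = ℕ.>-nonZero 1≤R

  value-≤ : ∀ N z → ∣ N ∣ ≤ ℓ ℕ.* R ^ n → ∣ z ∣ ≤ n ℕ.* R → ∣ eval (ones ℓ) z - N ∣ ≤ growth n ℕ.* R ^ n
  value-≤ N z N≤ z≤ = begin
    ∣ eval (ones ℓ) z - N ∣               ≤⟨ ℤ.∣i-j∣≤∣i∣+∣j∣ (eval (ones ℓ) z) N ⟩
    ∣ eval (ones ℓ) z ∣ ℕ.+ ∣ N ∣
      ≤⟨ ℕ.+-mono-≤ (eval-ones-≤ n z 1≤ℓR (ℕ.≤-trans z≤ (ℕ.*-monoˡ-≤ R (ℕ.n≤1+n n))))
                    (ℕ.≤-trans N≤ (ℕ.*-monoʳ-≤ ℓ (ℕ.^-monoˡ-≤ n (ℕ.m≤n*m R ℓ)))) ⟩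
    ℓ ℕ.* (ℓ ℕ.* R) ^ n ℕ.+ ℓ ℕ.* (ℓ ℕ.* R) ^ n  ≡⟨ cong (λ u → ℓ ℕ.* u ℕ.+ ℓ ℕ.* u) (^-distribʳ-* n ℓ R) ⟩
    ℓ ℕ.* (ℓ ^ n ℕ.* R ^ n) ℕ.+ ℓ ℕ.* (ℓ ^ n ℕ.* R ^ n) ≡⟨ rearrange ℓ (ℓ ^ n) (R ^ n) ⟩
    growth n ℕ.* R ^ n                      ∎
    where
    open ℕ.≤-Reasoning
    1≤ℓR : 1 ≤ ℓ ℕ.* R
    1≤ℓR = ℕ.*-mono-≤ {1} {ℓ} (s≤s z≤n) 1≤R
    rearrange : ∀ l L P → l ℕ.* (L ℕ.* P) ℕ.+ l ℕ.* (L ℕ.* P) ≡ 2 ℕ.* (l ℕ.* L) ℕ.* P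
    rearrange = ℕ-solve-∀

  subleading-≤ : ∀ {k m} (f : Vec ℤ (suc k)) (g : Vec ℤ m) N → suc k ℕ.+ m ≡ n → ∣ N ∣ ≤ ℓ ℕ.* R ^ n →
    (∀ z → monic f z * monic g z ≡ eval (ones ℓ) z - N) → ∣ subleading f ∣ ≤ subleading-factor n ℕ.* R
  subleading-≤ {k} {m} f g N k+m≡n N≤ fg≗ = conclude (choose grid (All.map classify (nodes-are-nodes R 0 n)))
    where
    grid = nodes R 0 n

    B = growth n ℕ.* R ^ n
    1≤B : 1 ≤ B
    1≤B = ℕ.*-mono-≤ (1≤growth n) (ℕ.>-nonZero⁻¹ (R ^ n) {{ℕ.m^n≢0 R n}})

    -- A bad node has ∣ g(x) ∣ < (R / 2)^m; at every other one ∣ f(x) g(x) ∣ ≤ B gives ∣ f(x) ∣ ≤ (2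
    -- / R)^m B.
    Good Bad : ℤ → Set
    Good x = ∣ x ∣ ≤ n ℕ.* R × R ^ m ℕ.* ∣ monic f x ∣ ≤ 2 ^ m ℕ.* B
    Bad  x = 2 ^ m ℕ.* ∣ monic g x ∣ < R ^ m

    classify : ∀ {x} → NodeIn R 0 n x → Good x ⊎ Bad x
    classify {x} (i , _ , i<n , refl) with 2 ^ m ℕ.* ∣ monic g x ∣ ℕ.<? R ^ m
    ... | yes bad = inj₂ bad
    ... | no ¬bad = inj₁ (x≤ , (begin
      R ^ m ℕ.* ∣ monic f x ∣                           ≤⟨ ℕ.*-monoˡ-≤ ∣ monic f x ∣ (ℕ.≮⇒≥ ¬bad) ⟩
      2 ^ m ℕ.* ∣ monic g x ∣ ℕ.* ∣ monic f x ∣         ≡⟨ ℕ.*-assoc (2 ^ m) ∣ monic g x ∣ ∣ monic f x ∣ ⟩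
      2 ^ m ℕ.* (∣ monic g x ∣ ℕ.* ∣ monic f x ∣)       ≡⟨ cong (2 ^ m ℕ.*_) (trans (ℕ.*-comm ∣ monic g x ∣ ∣ monic f x ∣)
                                                            (trans (sym (ℤ.abs-* (monic f x) (monic g x))) (cong ∣_∣ (fg≗ x)))) ⟩
      2 ^ m ℕ.* ∣ eval (ones ℓ) x - N ∣                 ≤⟨ ℕ.*-monoʳ-≤ (2 ^ m) (value-≤ N x N≤ x≤) ⟩
      2 ^ m ℕ.* B                                       ∎))
      where
      open ℕ.≤-Reasoning
      x≤ : ∣ x ∣ ≤ n ℕ.* R
      x≤ = ℕ.*-monoˡ-≤ R (ℕ.<⇒≤ i<n)

    conclude : (∃ λ bs → All Good (select bs grid) × All Bad (unselect bs grid)) → ∣ subleading f ∣ ≤ subleading-factor n ℕ.* R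
    conclude (bs , good , bad) = begin
      ∣ subleading f ∣                          ≡⟨ cong ∣_∣ (rearrange (subleading f) Σz) ⟩
      ∣ (subleading f + Σz) - Σz ∣              ≤⟨ ℤ.∣i-j∣≤∣i∣+∣j∣ (subleading f + Σz) Σz ⟩
      ∣ subleading f + Σz ∣ ℕ.+ ∣ Σz ∣          ≤⟨ ℕ.+-mono-≤ (ℕ.<⇒≤ shifted<) Σz≤ ⟩
      2 ^ n ℕ.* growth n ℕ.* R ℕ.+ n ℕ.* (n ℕ.* R) ≡⟨ collect (2 ^ n ℕ.* growth n) n R ⟩
      subleading-factor n ℕ.* R                   ∎
      where
      open ℕ.≤-Reasoning
      rearrange : ∀ a s → a ≡ (a + s) - s
      rearrange = solve-∀
      collect : ∀ G n R → G ℕ.* R ℕ.+ n ℕ.* (n ℕ.* R) ≡ (G ℕ.+ n ℕ.* n) ℕ.* R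
      collect = ℕ-solve-∀

      -- For m + 1 bad nodes the smallness of the leading coefficient 1 of g would read 2^m R^m <
      -- 2^m R^m.
      #bad≤ : length (unselect bs grid) ≤ m
      #bad≤ = ℕ.≮⇒≥ λ m<# → ℕ.<-irrefl refl
        (subst₂ _<_ (trans (ℕ.*-identityʳ _) (cong (λ e → 2 ^ m ℕ.* R ^ e) (ℕ.+-identityʳ m)))
                    (cong (λ e → 2 ^ e ℕ.* R ^ m) (ℕ.+-identityʳ m))
          (SpreadInterpolation.small-lead (2 ^ m) (R ^ m) R {n = 0} g (unselect bs grid) m<#
            (AllPairs-select (Vec.map not bs) grid (nodes-spaced R 0 n))
            (All.map (λ {x} → subst₂ _<_ (cong (ℕ._* ∣ monic g x ∣) (sym (ℕ.*-identityʳ (2 ^ m)))) (sym (ℕ.*-identityˡ (R ^ m)))) bad)))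

      k<#good : suc k ≤ length (select bs grid)
      k<#good = ℕ.+-cancelʳ-≤ m (suc k) _ (ℕ.≤-trans
        (ℕ.≤-reflexive (trans k+m≡n (sym (length-select bs grid)))) (ℕ.+-monoʳ-≤ (length (select bs grid)) #bad≤))

      zs = List.take (suc k) (select bs grid)
      Σz = sum zs

      zs-good : All Good zs
      zs-good = All.take⁺ (suc k) good

      length-zs : length zs ≡ suc k
      length-zs = trans (List.length-take (suc k) (select bs grid)) (ℕ.m≤n⇒m⊓n≡m k<#good)

      Σz≤ : ∣ Σz ∣ ≤ n ℕ.* (n ℕ.* R)
      Σz≤ = ℕ.≤-trans (sum-≤ zs (All.map proj₁ zs-good)) (ℕ.*-monoˡ-≤ (n ℕ.* R)
        (ℕ.≤-trans (ℕ.≤-reflexive length-zs) (ℕ.≤-trans (ℕ.m≤m+n (suc k) m) (ℕ.≤-reflexive k+m≡n))))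

      -- The bound (2 / R)^m B at the good nodes enters through s = R^m; `suc` makes it strict.
      small : R ^ m ℕ.* R ^ (k ℕ.+ 0) ℕ.* ∣ subleading f + Σz ∣ < 2 ^ (k ℕ.+ 0) ℕ.* suc (2 ^ m ℕ.* B)
      small = SpreadInterpolation.small-subleading (R ^ m) (suc (2 ^ m ℕ.* B)) R {n = 0} f zs length-zs
        (AllPairs.take⁺ (suc k) (AllPairs-select bs grid (nodes-spaced R 0 n)))
        (All.map (λ {x} (_ , f≤) → subst₂ _<_ (cong (ℕ._* ∣ monic f x ∣) (sym (ℕ.*-identityʳ (R ^ m)))) (sym (ℕ.*-identityˡ _)) (s≤s f≤)) zs-good)

      -- B contains R^n with n = k + 1 + m, so cancelling R^m R^k leaves a single factor R.
      shifted< : ∣ subleading f + Σz ∣ < 2 ^ n ℕ.* growth n ℕ.* R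
      shifted< = ℕ.*-cancelˡ-< (R ^ m ℕ.* R ^ k) _ _ (begin-strict
        R ^ m ℕ.* R ^ k ℕ.* ∣ subleading f + Σz ∣
          <⟨ subst (λ e → R ^ m ℕ.* R ^ e ℕ.* ∣ subleading f + Σz ∣ < 2 ^ e ℕ.* suc (2 ^ m ℕ.* B)) (ℕ.+-identityʳ k) small ⟩
        2 ^ k ℕ.* suc (2 ^ m ℕ.* B)
          ≤⟨ ℕ.*-monoʳ-≤ (2 ^ k) (ℕ.+-monoˡ-≤ (2 ^ m ℕ.* B) (ℕ.*-mono-≤ (ℕ.>-nonZero⁻¹ (2 ^ m) {{ℕ.m^n≢0 2 m}}) 1≤B)) ⟩
        2 ^ k ℕ.* (2 ^ m ℕ.* B ℕ.+ 2 ^ m ℕ.* B)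
          ≡⟨ cong (λ e → 2 ^ k ℕ.* (2 ^ m ℕ.* (growth n ℕ.* R ^ e) ℕ.+ 2 ^ m ℕ.* (growth n ℕ.* R ^ e))) (sym k+m≡n) ⟩
        2 ^ k ℕ.* (2 ^ m ℕ.* (growth n ℕ.* R ^ (suc k ℕ.+ m)) ℕ.+ 2 ^ m ℕ.* (growth n ℕ.* R ^ (suc k ℕ.+ m)))
          ≡⟨ cong (λ u → 2 ^ k ℕ.* (2 ^ m ℕ.* (growth n ℕ.* (R ℕ.* u)) ℕ.+ 2 ^ m ℕ.* (growth n ℕ.* (R ℕ.* u)))) (ℕ.^-distribˡ-+-* R k m) ⟩
        2 ^ k ℕ.* (2 ^ m ℕ.* (growth n ℕ.* (R ℕ.* (R ^ k ℕ.* R ^ m))) ℕ.+ 2 ^ m ℕ.* (growth n ℕ.* (R ℕ.* (R ^ k ℕ.* R ^ m))))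
          ≡⟨ gather (2 ^ k) (2 ^ m) (growth n) R (R ^ k) (R ^ m) ⟩
        R ^ m ℕ.* R ^ k ℕ.* (2 ℕ.* (2 ^ k ℕ.* 2 ^ m) ℕ.* growth n ℕ.* R)
          ≡⟨ cong (λ u → R ^ m ℕ.* R ^ k ℕ.* (u ℕ.* growth n ℕ.* R))
               (trans (cong (2 ℕ.*_) (sym (ℕ.^-distribˡ-+-* 2 k m))) (cong (2 ^_) k+m≡n)) ⟩
        R ^ m ℕ.* R ^ k ℕ.* (2 ^ n ℕ.* growth n ℕ.* R) ∎)
        where
        gather : ∀ a b G R P Q → a ℕ.* (b ℕ.* (G ℕ.* (R ℕ.* (P ℕ.* Q))) ℕ.+ b ℕ.* (G ℕ.* (R ℕ.* (P ℕ.* Q))))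
          ≡ Q ℕ.* P ℕ.* (2 ℕ.* (a ℕ.* b) ℕ.* G ℕ.* R)
        gather = ℕ-solve-∀

-- Irreducibility over ℚ

module ℚ-eval = Evaluation ℚ.+-*-commutativeRing

fromℤ≡mkℚ : ∀ z → fromℤ z ≡ mkℚ z 0 (Coprime.sym (Coprime.1-coprimeTo ∣ z ∣))
fromℤ≡mkℚ z = ℚ.↥p/↧p≡p (mkℚ z 0 (Coprime.sym (Coprime.1-coprimeTo ∣ z ∣)))

fromℤ-+ : ∀ a b → fromℤ (a + b) ≡ fromℤ a ℚ.+ fromℤ b
fromℤ-+ a b = trans (cong₂ (λ x y → (x + y) ℚ./ 1) (sym (ℤ.*-identityʳ a)) (sym (ℤ.*-identityʳ b)))
  (sym (cong₂ ℚ._+_ (fromℤ≡mkℚ a) (fromℤ≡mkℚ b)))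

fromℤ-* : ∀ a b → fromℤ (a * b) ≡ fromℤ a ℚ.* fromℤ b
fromℤ-* a b = sym (cong₂ ℚ._*_ (fromℤ≡mkℚ a) (fromℤ≡mkℚ b))

fromℤ-neg : ∀ a → fromℤ (- a) ≡ ℚ.- fromℤ a
fromℤ-neg a = begin
  fromℤ (- a)                                        ≡⟨ sym (ℚ.+-identityʳ _) ⟩
  fromℤ (- a) ℚ.+ 0ℚ                                 ≡⟨ cong (fromℤ (- a) ℚ.+_) (sym (ℚ.+-inverseʳ (fromℤ a))) ⟩
  fromℤ (- a) ℚ.+ (fromℤ a ℚ.- fromℤ a)              ≡⟨ sym (ℚ.+-assoc (fromℤ (- a)) (fromℤ a) (ℚ.- fromℤ a)) ⟩
  fromℤ (- a) ℚ.+ fromℤ a ℚ.- fromℤ a                ≡⟨ cong (ℚ._- fromℤ a) (sym (fromℤ-+ (- a) a)) ⟩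
  fromℤ (- a + a) ℚ.- fromℤ a                        ≡⟨ cong (λ x → fromℤ x ℚ.- fromℤ a) (ℤ.+-inverseˡ a) ⟩
  0ℚ ℚ.- fromℤ a                                     ≡⟨ ℚ.+-identityˡ _ ⟩
  ℚ.- fromℤ a                                        ∎
  where open ≡-Reasoning

fromℤ-injective : ∀ {a b} → fromℤ a ≡ fromℤ b → a ≡ b
fromℤ-injective {a} {b} eq = cong ℚ.↥_ (trans (sym (fromℤ≡mkℚ a)) (trans eq (fromℤ≡mkℚ b)))

fromℤ-mono-≤ : ∀ {a b} → a ℤ.≤ b → fromℤ a ℚ.≤ fromℤ b
fromℤ-mono-≤ {a} {b} a≤b = subst₂ ℚ._≤_ (sym (fromℤ≡mkℚ a)) (sym (fromℤ≡mkℚ b))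
  (ℚ.*≤* (ℤ.*-monoʳ-≤-nonNeg 1ℤ a≤b))

fromℤ-cancel-≤ : ∀ {a b} → fromℤ a ℚ.≤ fromℤ b → a ℤ.≤ b
fromℤ-cancel-≤ {a} {b} le with subst₂ ℚ._≤_ (fromℤ≡mkℚ a) (fromℤ≡mkℚ b) le
... | ℚ.*≤* a≤b = subst₂ ℤ._≤_ (ℤ.*-identityʳ a) (ℤ.*-identityʳ b) a≤b

fromℕ-mono-≤ : ∀ {m n} → m ≤ n → fromℕ m ℚ.≤ fromℕ n
fromℕ-mono-≤ m≤n = fromℤ-mono-≤ (ℤ.+≤+ m≤n)

fromℕ-* : ∀ m n → fromℕ (m ℕ.* n) ≡ fromℕ m ℚ.* fromℕ n
fromℕ-* m n = trans (cong fromℤ (ℤ.pos-* m n)) (fromℤ-* (+ m) (+ n))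

fromℕ-^ : ∀ m n → fromℕ (m ^ n) ≡ fromℕ m ^ℚ n
fromℕ-^ m zero    = refl
fromℕ-^ m (suc n) = trans (fromℕ-* m (m ^ n)) (cong (fromℕ m ℚ.*_) (fromℕ-^ m n))

eval-toℚ : ∀ f z → evalℚ (toℚ[X] f) (fromℤ z) ≡ fromℤ (eval f z)
eval-toℚ []      z = refl
eval-toℚ (a ∷ f) z = trans (cong (λ u → fromℤ a ℚ.+ fromℤ z ℚ.* u) (eval-toℚ f z))
  (sym (trans (fromℤ-+ a (z * eval f z)) (cong (fromℤ a ℚ.+_) (fromℤ-* z (eval f z)))))

coeff-toℚ : ∀ f n → coeffℚ (toℚ[X] f) n ≡ fromℤ (coeff f n)
coeff-toℚ []      n       = refl
coeff-toℚ (a ∷ f) zero    = refl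
coeff-toℚ (a ∷ f) (suc n) = coeff-toℚ f n

onesℚ : ℕ → ℚPoly
onesℚ n = toℚ[X] (ones n)

onesℚ-nonNeg : ∀ n {q} → 0ℚ ℚ.≤ q → 0ℚ ℚ.≤ evalℚ (onesℚ n) q
onesℚ-nonNeg zero    0≤q = ℚ.≤-refl
onesℚ-nonNeg (suc n) {q} 0≤q = subst (ℚ._≤ evalℚ (onesℚ (suc n)) q) (ℚ.+-identityˡ 0ℚ)
  (ℚ.+-mono-≤ (fromℕ-mono-≤ {0} {1} z≤n)
    (subst (ℚ._≤ q ℚ.* evalℚ (onesℚ n) q) (ℚ.*-zeroʳ q)
      (ℚ.*-monoˡ-≤-nonNeg q {{ℚ.nonNegative 0≤q}} (onesℚ-nonNeg n 0≤q))))

onesℚ-mono : ∀ n {q r} → 0ℚ ℚ.≤ q → q ℚ.≤ r → evalℚ (onesℚ n) q ℚ.≤ evalℚ (onesℚ n) r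
onesℚ-mono zero    0≤q q≤r = ℚ.≤-refl
onesℚ-mono (suc n) {q} {r} 0≤q q≤r = ℚ.+-monoʳ-≤ (fromℤ 1ℤ) (ℚ.≤-trans
  (ℚ.*-monoˡ-≤-nonNeg q {{ℚ.nonNegative 0≤q}} (onesℚ-mono n 0≤q q≤r))
  (ℚ.*-monoʳ-≤-nonNeg (evalℚ (onesℚ n) r) {{ℚ.nonNegative (onesℚ-nonNeg n (ℚ.≤-trans 0≤q q≤r))}} q≤r))

^ℚ-cancel-≤ : ∀ {q r} k .{{_ : NonZero k}} → 0ℚ ℚ.≤ r → q ^ℚ k ℚ.≤ r ^ℚ k → q ℚ.≤ r
^ℚ-cancel-≤ k 0≤r q^k≤r^k = ℚ.≮⇒≥ λ r<q → ℚ.<-irrefl refl (ℚ.<-≤-trans (^-mono-< 0≤r r<q k) q^k≤r^k)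

-- The root may be irrational, so the polynomial is inspected at the rational point min(r , R), with
-- r from the upper cut. Its k-th power is at least M, so it lies above a; it is at most r < b; and
-- as it is at most R, monotonicity gives the bound.
<eval-root⇒≤ : ∀ n k .{{_ : NonZero k}} N M R → M ≤ R ^ k →
  fromℕ N <eval onesℚ n at root k M → + N ℤ.≤ eval (ones n) (+ R)
<eval-root⇒≤ n k N M R M≤R^k (a , b , (r′ , a<r′ , _ , r′^k≤M) , (r , r<b , 0≤r , M≤r^k) , c , N<c , c≤) =
  [ (λ r≤R → bound r 0≤r r≤R (c≤ r (a< r 0≤r M≤r^k) r<b))
  , (λ R≤r → bound (fromℕ R) (0≤fromℕ R) ℚ.≤-refl
      (c≤ (fromℕ R) (a< (fromℕ R) (0≤fromℕ R) M≤R^kℚ) (ℚ.≤-<-trans R≤r r<b)))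
  ]′ (ℚ.≤-total r (fromℕ R))
  where
  M≤R^kℚ : fromℕ M ℚ.≤ fromℕ R ^ℚ k
  M≤R^kℚ = subst (fromℕ M ℚ.≤_) (fromℕ-^ R k) (fromℕ-mono-≤ M≤R^k)

  a< : ∀ s → 0ℚ ℚ.≤ s → fromℕ M ℚ.≤ s ^ℚ k → a ℚ.< s
  a< s 0≤s M≤s^k = ℚ.<-≤-trans a<r′ (^ℚ-cancel-≤ k 0≤s (ℚ.≤-trans r′^k≤M M≤s^k))

  bound : ∀ q → 0ℚ ℚ.≤ q → q ℚ.≤ fromℕ R → c ℚ.≤ evalℚ (onesℚ n) q → + N ℤ.≤ eval (ones n) (+ R)
  bound q 0≤q q≤R c≤q = fromℤ-cancel-≤ (ℚ.≤-trans (ℚ.<⇒≤ N<c) (ℚ.≤-trans c≤q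
    (subst (evalℚ (onesℚ n) q ℚ.≤_) (eval-toℚ (ones n) (+ R)) (onesℚ-mono n 0≤q q≤R))))

fromℤ-↧*p≡↥p : ∀ p → fromℤ (ℚ.↧ p) ℚ.* p ≡ fromℤ (ℚ.↥ p)
fromℤ-↧*p≡↥p p@(mkℚ n d-1 _) = begin
  fromℤ (+ suc d-1) ℚ.* p       ≡⟨ cong (ℚ._* p) (fromℤ≡mkℚ (+ suc d-1)) ⟩
  (+ suc d-1 * n) ℚ./ (1 ℕ.* suc d-1)
    ≡⟨ ℚ.fromℚᵘ-cong {ℚᵘ.mkℚᵘ (+ suc d-1 * n) (d-1 ℕ.+ 0)} {ℚᵘ.mkℚᵘ n 0} (ℚᵘ.*≡* cross-multiplied) ⟩
  fromℤ n                       ∎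
  where
  open ≡-Reasoning
  cross-multiplied : (+ suc d-1 * n) * 1ℤ ≡ n * + suc (d-1 ℕ.+ 0)
  cross-multiplied = trans (ℤ.*-identityʳ (+ suc d-1 * n)) (trans (ℤ.*-comm (+ suc d-1) n)
    (cong (λ e → n * + suc e) (sym (ℕ.+-identityʳ d-1))))

record Cleared (x : ℚPoly) : Set where
  field
    D   : ℤ
    D≢0 : D ≢ 0ℤ
    F   : Poly
    F≡  : toℚ[X] F ≡ scaleℚ (fromℤ D) x

  eval-F : ∀ z → fromℤ (eval F z) ≡ fromℤ D ℚ.* evalℚ x (fromℤ z)
  eval-F z = trans (sym (eval-toℚ F z)) (trans (cong (λ f → evalℚ f (fromℤ z)) F≡)
    (ℚ-eval.eval-scale (fromℤ D) x (fromℤ z)))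

  coeff-F : ∀ n → fromℤ (coeff F n) ≡ fromℤ D ℚ.* coeffℚ x n
  coeff-F n = trans (sym (coeff-toℚ F n)) (trans (cong (λ f → coeffℚ f n) F≡)
    (ℚ-eval.coeff-scale (fromℤ D) x n))

clear-denominators : ∀ x → Cleared x
clear-denominators []      = record { D = 1ℤ ; D≢0 = λ () ; F = [] ; F≡ = refl }
clear-denominators (a ∷ x) = record
  { D   = ℚ.↧ a * D
  ; D≢0 = λ d*D≡0 → D≢0 (z*i≡0 {ℚ.↧ a} (λ ()) d*D≡0)
  ; F   = ℚ.↥ a * D ∷ scale (ℚ.↧ a) F
  ; F≡  = cong₂ _∷_ head≡ (tail≡ F x F≡)
  }
  where
  open Cleared (clear-denominators x)
  open ≡-Reasoning
  head≡ : fromℤ (ℚ.↥ a * D) ≡ fromℤ (ℚ.↧ a * D) ℚ.* a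
  head≡ = begin
    fromℤ (ℚ.↥ a * D)                       ≡⟨ fromℤ-* (ℚ.↥ a) D ⟩
    fromℤ (ℚ.↥ a) ℚ.* fromℤ D               ≡⟨ cong (ℚ._* fromℤ D) (sym (fromℤ-↧*p≡↥p a)) ⟩
    (fromℤ (ℚ.↧ a) ℚ.* a) ℚ.* fromℤ D       ≡⟨ ℚ.*-assoc (fromℤ (ℚ.↧ a)) a (fromℤ D) ⟩
    fromℤ (ℚ.↧ a) ℚ.* (a ℚ.* fromℤ D)       ≡⟨ cong (fromℤ (ℚ.↧ a) ℚ.*_) (ℚ.*-comm a (fromℤ D)) ⟩
    fromℤ (ℚ.↧ a) ℚ.* (fromℤ D ℚ.* a)       ≡⟨ sym (ℚ.*-assoc (fromℤ (ℚ.↧ a)) (fromℤ D) a) ⟩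
    (fromℤ (ℚ.↧ a) ℚ.* fromℤ D) ℚ.* a       ≡⟨ cong (ℚ._* a) (sym (fromℤ-* (ℚ.↧ a) D)) ⟩
    fromℤ (ℚ.↧ a * D) ℚ.* a                 ∎

  tail≡ : ∀ F x → toℚ[X] F ≡ scaleℚ (fromℤ D) x → toℚ[X] (scale (ℚ.↧ a) F) ≡ scaleℚ (fromℤ (ℚ.↧ a * D)) x
  tail≡ []      []      eq = refl
  tail≡ (b ∷ F) (y ∷ x) eq = cong₂ _∷_ (begin
    fromℤ (ℚ.↧ a * b)                       ≡⟨ fromℤ-* (ℚ.↧ a) b ⟩
    fromℤ (ℚ.↧ a) ℚ.* fromℤ b               ≡⟨ cong (fromℤ (ℚ.↧ a) ℚ.*_) (List.∷-injectiveˡ eq) ⟩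
    fromℤ (ℚ.↧ a) ℚ.* (fromℤ D ℚ.* y)       ≡⟨ sym (ℚ.*-assoc (fromℤ (ℚ.↧ a)) (fromℤ D) y) ⟩
    (fromℤ (ℚ.↧ a) ℚ.* fromℤ D) ℚ.* y       ≡⟨ cong (ℚ._* y) (sym (fromℤ-* (ℚ.↧ a) D)) ⟩
    fromℤ (ℚ.↧ a * D) ℚ.* y                 ∎)
    (tail≡ F x (List.∷-injectiveʳ eq))

fromℤ≢0 : ∀ {a} → a ≢ 0ℤ → fromℤ a ≢ 0ℚ
fromℤ≢0 a≢0 a≡0 = a≢0 (fromℤ-injective a≡0)

ℚ-i*j≡0 : ∀ {a b} → a ≢ 0ℚ → a ℚ.* b ≡ 0ℚ → b ≡ 0ℚ
ℚ-i*j≡0 {a} {b} a≢0 ab≡0 = begin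
  b                       ≡⟨ sym (ℚ.*-identityˡ b) ⟩
  1ℚ ℚ.* b                ≡⟨ cong (ℚ._* b) (sym (ℚ.*-inverseˡ a)) ⟩
  ℚ.1/ a ℚ.* a ℚ.* b      ≡⟨ ℚ.*-assoc (ℚ.1/ a) a b ⟩
  ℚ.1/ a ℚ.* (a ℚ.* b)    ≡⟨ cong (ℚ.1/ a ℚ.*_) ab≡0 ⟩
  ℚ.1/ a ℚ.* 0ℚ           ≡⟨ ℚ.*-zeroʳ (ℚ.1/ a) ⟩
  0ℚ                      ∎
  where
  open ≡-Reasoning
  instance
    a-nonZero : ℚ.NonZero a
    a-nonZero = ℚ.≢-nonZero a≢0

nonzero-constant∣1 : ∀ x → coeffℚ x 0 ≢ 0ℚ → (∀ i → coeffℚ x (suc i) ≡ 0ℚ) → x ∣ℚ constℚ 1ℚ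
nonzero-constant∣1 x x₀≢0 x₊≡0 = constℚ u ,∣ λ
  { zero    → trans (coeff-ux 0) (trans (cong (ℚ._+ 0ℚ) (ℚ.*-inverseˡ (coeffℚ x 0))) (ℚ.+-identityʳ 1ℚ))
  ; (suc i) → trans (coeff-ux (suc i)) (trans (cong (λ y → u ℚ.* y ℚ.+ 0ℚ) (x₊≡0 i))
      (trans (ℚ.+-identityʳ _) (ℚ.*-zeroʳ u)))
  }
  where
  instance
    x₀-nonZero : ℚ.NonZero (coeffℚ x 0)
    x₀-nonZero = ℚ.≢-nonZero x₀≢0
  u = ℚ.1/ coeffℚ x 0
  coeff-zeroℚ : ∀ i → coeffℚ (0ℚ ∷ []) i ≡ 0ℚ
  coeff-zeroℚ zero    = refl
  coeff-zeroℚ (suc i) = refl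
  coeff-ux : ∀ i → coeffℚ (constℚ u *ℚ x) i ≡ u ℚ.* coeffℚ x i ℚ.+ 0ℚ
  coeff-ux i = trans (ℚ-eval.coeff-+ₚ (scaleℚ u x) (0ℚ ∷ []) i)
    (cong₂ ℚ._+_ (ℚ-eval.coeff-scale u x i) (coeff-zeroℚ i))

module _ {n} (hs : Vec ℤ (suc n)) (H : ℚPoly) (H≗ : ∀ z → evalℚ H (fromℤ z) ≡ fromℤ (monic hs z)) where

  -- Clearing denominators in x H = 1 writes a non-zero constant as an integer polynomial times a
  -- monic one of degree n + 1, but degrees add.
  ¬unit : ¬ (H ∣ℚ constℚ 1ℚ)
  ¬unit (x ,∣ xH≈1) = case strip F of λ
    { (inj₁ F≈0)   → D≢0 (trans (sym (FH≗D 0ℤ)) (cong (_* monic hs 0ℤ) (eval-zero F 0ℤ F≈0)))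
    ; (inj₂ form) → absurd form
    }
    where
    open Cleared (clear-denominators x)
    FH≗D : ∀ z → eval F z * monic hs z ≡ D
    FH≗D z = fromℤ-injective (begin
      fromℤ (eval F z * monic hs z)                        ≡⟨ fromℤ-* (eval F z) (monic hs z) ⟩
      fromℤ (eval F z) ℚ.* fromℤ (monic hs z)              ≡⟨ cong₂ ℚ._*_ (eval-F z) (sym (H≗ z)) ⟩
      (fromℤ D ℚ.* evalℚ x (fromℤ z)) ℚ.* evalℚ H (fromℤ z) ≡⟨ ℚ.*-assoc (fromℤ D) (evalℚ x (fromℤ z)) (evalℚ H (fromℤ z)) ⟩
      fromℤ D ℚ.* (evalℚ x (fromℤ z) ℚ.* evalℚ H (fromℤ z)) ≡⟨ cong (fromℤ D ℚ.*_) (sym (ℚ-eval.eval-*ₚ x H (fromℤ z))) ⟩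
      fromℤ D ℚ.* evalℚ (x *ℚ H) (fromℤ z)                  ≡⟨ cong (fromℤ D ℚ.*_) (ℚ-eval.eval-cong (x *ℚ H) (constℚ 1ℚ) (fromℤ z) xH≈1) ⟩
      fromℤ D ℚ.* evalℚ (constℚ 1ℚ) (fromℤ z)               ≡⟨ cong (fromℤ D ℚ.*_) (ℚ-eval.eval-const 1ℚ (fromℤ z)) ⟩
      fromℤ D ℚ.* 1ℚ                                        ≡⟨ ℚ.*-identityʳ (fromℤ D) ⟩
      fromℤ D                                               ∎)
      where open ≡-Reasoning
    absurd : LeadForm F → ⊥
    absurd form = ℕ.1+n≢0 (trans (sym (ℕ.+-suc degree n)) (proj₁ (lead-product lower lead hs 1ℤ [] D lead≢0 (λ ()) D≢0
      (eval-injective (snoc lower lead *ₚ snoc hs 1ℤ) (D ∷ []) λ z → trans (eval-*ₚ (snoc lower lead) (snoc hs 1ℤ) z)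
        (trans (cong (_* monic hs z) (sym (f≗snoc z))) (trans (FH≗D z) (sym (eval-const D z))))))))
      where open LeadForm form

  -- A factor of degree 0 is a unit of ℚ[X]; two factors of positive degree would yield monic
  -- integer ones by Gauss's lemma.
  irreducible : (∀ {k m} → 1 ≤ k → 1 ≤ m → k ℕ.+ m ≡ suc n → ¬ MonicFactors k m (snoc hs 1ℤ)) → Irreducible H
  irreducible no-factors = mkIrred ¬unit split
    where
    split : ∀ {x y} → H ≈ℚ x *ℚ y → (x ∣ℚ constℚ 1ℚ) ⊎ (y ∣ℚ constℚ 1ℚ)
    split {x} {y} H≈xy = cases (strip X.F) (strip Y.F)
      where
      module X = Cleared (clear-denominators x)
      module Y = Cleared (clear-denominators y)
      DE = X.D * Y.D
      DE≢0 : DE ≢ 0ℤ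
      DE≢0 = Y.D≢0 ∘ z*i≡0 X.D≢0

      FG≗ : ∀ z → eval X.F z * eval Y.F z ≡ DE * monic hs z
      FG≗ z = fromℤ-injective (begin
        fromℤ (eval X.F z * eval Y.F z)                ≡⟨ fromℤ-* (eval X.F z) (eval Y.F z) ⟩
        fromℤ (eval X.F z) ℚ.* fromℤ (eval Y.F z)      ≡⟨ cong₂ ℚ._*_ (X.eval-F z) (Y.eval-F z) ⟩
        (d ℚ.* u) ℚ.* (e ℚ.* v)                        ≡⟨ interchange d u e v ⟩
        (d ℚ.* e) ℚ.* (u ℚ.* v)                        ≡⟨ cong₂ ℚ._*_ (sym (fromℤ-* X.D Y.D)) (sym (ℚ-eval.eval-*ₚ x y (fromℤ z))) ⟩
        fromℤ DE ℚ.* evalℚ (x *ℚ y) (fromℤ z)          ≡⟨ cong (fromℤ DE ℚ.*_) (sym (ℚ-eval.eval-cong H (x *ℚ y) (fromℤ z) H≈xy)) ⟩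
        fromℤ DE ℚ.* evalℚ H (fromℤ z)                 ≡⟨ cong (fromℤ DE ℚ.*_) (H≗ z) ⟩
        fromℤ DE ℚ.* fromℤ (monic hs z)                ≡⟨ sym (fromℤ-* DE (monic hs z)) ⟩
        fromℤ (DE * monic hs z)                        ∎)
        where
        open ≡-Reasoning
        d = fromℤ X.D
        e = fromℤ Y.D
        u = evalℚ x (fromℤ z)
        v = evalℚ y (fromℤ z)
        interchange : ∀ a b c d → (a ℚ.* b) ℚ.* (c ℚ.* d) ≡ (a ℚ.* c) ℚ.* (b ℚ.* d)
        interchange = CommutativeSemigroup.interchange (CommutativeMonoid.commutativeSemigroup ℚ.*-1-commutativeMonoid)

      ¬all-zero : ¬ (∀ z → 0ℤ ≡ DE * monic hs z)
      ¬all-zero 0≗ = DE≢0 (trans (trans (sym (ℤ.*-identityʳ DE))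
        (trans (cong (DE *_) (sym (coeff-snoc-top hs 1ℤ))) (sym (coeff-scale DE (snoc hs 1ℤ) (suc n)))))
        (sym (eval-injective [] (scale DE (snoc hs 1ℤ)) (λ z → trans (0≗ z) (sym (eval-scale DE (snoc hs 1ℤ) z))) (suc n))))

      constant : ∀ {w} (W : Cleared w) (form : LeadForm (Cleared.F W)) → LeadForm.degree form ≡ 0 → w ∣ℚ constℚ 1ℚ
      constant {w} W (leadForm {zero} [] lead lead≢0 f≈) refl = nonzero-constant∣1 w
        (λ w₀≡0 → fromℤ≢0 lead≢0 (trans (sym (cong fromℤ (f≈ 0))) (trans (coeff-F 0) (trans (cong (fromℤ D ℚ.*_) w₀≡0) (ℚ.*-zeroʳ (fromℤ D))))))
        (λ i → ℚ-i*j≡0 (fromℤ≢0 D≢0) (trans (sym (coeff-F (suc i))) (cong fromℤ (f≈ (suc i)))))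
        where open Cleared W

      cases : X.F ≈ₚ [] ⊎ LeadForm X.F → Y.F ≈ₚ [] ⊎ LeadForm Y.F → (x ∣ℚ constℚ 1ℚ) ⊎ (y ∣ℚ constℚ 1ℚ)
      cases (inj₁ F≈0) _ = ⊥-elim (¬all-zero λ z →
        trans (cong (_* eval Y.F z) (sym (eval-zero X.F z F≈0))) (FG≗ z))
      cases (inj₂ _) (inj₁ G≈0) = ⊥-elim (¬all-zero λ z →
        trans (trans (sym (ℤ.*-zeroʳ (eval X.F z))) (cong (eval X.F z *_) (sym (eval-zero Y.F z G≈0)))) (FG≗ z))
      cases (inj₂ f) (inj₂ g) = by-degree (LeadForm.degree f ℕ.≟ 0) (LeadForm.degree g ℕ.≟ 0)
        where
        module f = LeadForm f
        module g = LeadForm g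
        factorisation : f.degree ℕ.+ g.degree ≡ suc n × MonicFactors f.degree g.degree (snoc hs 1ℤ)
        factorisation = monic-factorisation f.lower f.lead g.lower g.lead hs DE f.lead≢0 g.lead≢0 DE≢0
          λ z → trans (cong₂ _*_ (sym (f.f≗snoc z)) (sym (g.f≗snoc z))) (FG≗ z)
        by-degree : Dec (f.degree ≡ 0) → Dec (g.degree ≡ 0) → (x ∣ℚ constℚ 1ℚ) ⊎ (y ∣ℚ constℚ 1ℚ)
        by-degree (yes k≡0) _         = inj₁ (constant (clear-denominators x) f k≡0)
        by-degree _         (yes m≡0) = inj₂ (constant (clear-denominators y) g m≡0)
        by-degree (no k≢0)  (no m≢0)  = ⊥-elim (no-factors (ℕ.n≢0⇒n>0 k≢0) (ℕ.n≢0⇒n>0 m≢0)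
          (proj₁ factorisation) (proj₂ factorisation))

-- Large primes outside the bad product are essential

module Essentiality {m} (ℓ-prime : Prime (suc (suc m))) where
  private
    n = suc m
    ℓ = suc n

  modulus-bound : ℕ → ℕ
  modulus-bound R = subleading-factor n ℕ.* R

  -- It puts the primes above 4 (A + 1) beyond ℓ, as the study of the roots modulo p requires.
  ℓ≤subleading-factor : ℓ ≤ subleading-factor n
  ℓ≤subleading-factor = begin
    ℓ                       ≤⟨ ℕ.m≤m*n ℓ (ℓ ^ n) {{ℕ.m^n≢0 ℓ n}} ⟩
    ℓ ℕ.* ℓ ^ n             ≤⟨ ℕ.m≤n*m (ℓ ℕ.* ℓ ^ n) 2 ⟩
    growth n                ≤⟨ ℕ.m≤n*m (growth n) (2 ^ n) {{ℕ.m^n≢0 2 n}} ⟩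
    2 ^ n ℕ.* growth n      ≤⟨ ℕ.m≤m+n _ (n ℕ.* n) ⟩
    subleading-factor n     ∎
    where open ℕ.≤-Reasoning

  shifted : ℤ → Vec ℤ n
  shifted N = (1ℤ - N) ∷ Vec.replicate m 1ℤ

  monic-shifted : ∀ N z → monic (shifted N) z ≡ eval (ones ℓ) z - N
  monic-shifted N z = trans (cong (λ f → (1ℤ - N) + z * eval f z) (sym (ones≡snoc m)))
    (rearrange N (z * eval (ones n) z))
    where
    rearrange : ∀ N u → (1ℤ - N) + u ≡ (1ℤ + u) - N
    rearrange = solve-∀

  -- The subleading coefficient a of f satisfies ∣ a ∣ ≤ A, and p divides the integer belonging to a
  -- and the roots of f modulo p. That integer is a factor of the bad product, which p does not
  -- divide.
  no-factors : ∀ {R p d N} c → 1 ≤ R → Prime p → 4 ℕ.* suc (modulus-bound R) < p →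
    p ∤ bad-product ℓ-prime (modulus-bound R) → + p ∣ eval (ones ℓ) d →
    N ≡ c * + p → ∣ N ∣ ≤ ℓ ℕ.* R ^ n →
    ∀ {k j} → 1 ≤ k → 1 ≤ j → k ℕ.+ j ≡ n → ¬ MonicFactors k j (snoc (shifted N) 1ℤ)
  no-factors {R} {p} {d} {N} c 1≤R p-prime A<p p∤bad p∣Φ N≡cp N≤ {suc k} {j} _ 1≤j k+j≡n (f , g , fg≗) =
    contradiction-from (factor-roots f g c 1≤j k+j≡n (λ z → trans (fg≗′ z) (cong (λ u → eval (ones ℓ) z - u) N≡cp)))
    where
    A = modulus-bound R
    ℓ<p : ℓ < p
    ℓ<p = begin-strict
      ℓ                           ≤⟨ ℓ≤subleading-factor ⟩
      subleading-factor n         ≤⟨ ℕ.m≤m*n (subleading-factor n) R {{ℕ.>-nonZero 1≤R}} ⟩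
      A                           ≤⟨ ℕ.n≤1+n A ⟩
      suc A                       ≤⟨ ℕ.m≤n*m (suc A) 4 ⟩
      4 ℕ.* suc A                 <⟨ A<p ⟩
      p                           ∎
      where open ℕ.≤-Reasoning
    open RootsModPrime {d = d} ℓ-prime p-prime ℓ<p p∣Φ
    fg≗′ : ∀ z → monic f z * monic g z ≡ eval (ones ℓ) z - N
    fg≗′ z = trans (fg≗ z) (monic-shifted N z)
    a = subleading f
    contradiction-from : (∃ λ bs → + p ∣ eval (a ∷ bits→poly bs) d ×
      ¬ (∀ i → i < n → coeff (a ∷ bits→poly bs) i ≡ coeff (a ∷ bits→poly bs) n)) → ⊥
    contradiction-from (bs , p∣h , nonconstant) = p∤bad (ℕ.∣-trans
      (∣-subset-integer ℓ-prime a bs p d nonconstant p∣Φ p∣h)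
      (∣-bad-product ℓ-prime a bs (FactorSize.subleading-≤ 1≤R f g N k+j≡n N≤ fg≗′)))

  -- p² ≤ R^ℓ says that p^(2/ℓ) ≤ R, so every N = c p to be considered satisfies ∣ N ∣ ≤ Φ_ℓ(R) ≤ ℓ
  -- R^n, a bound that does not depend on p.
  essential : ∀ {R p d} → 1 ≤ R → Prime p → 4 ℕ.* suc (modulus-bound R) < p →
    p ∤ bad-product ℓ-prime (modulus-bound R) → + p ∣ eval (ones ℓ) d → p ^ 2 ≤ R ^ ℓ → Essential ℓ p
  essential {R} {p} {d} 1≤R p-prime A<p p∤bad p∣Φ p²≤ = p-prime , λ c →
    subst (λ f → fromℕ ∣ c * + p ∣ <eval toℚ[X] f at root ℓ (p ^ 2) → Irreducible (toℚ[X] f ℚ[X].-ₚ constℚ (fromℤ (c * + p))))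
      (sym (Φ-prime m ℓ-prime)) (irreducible-at c)
    where
    irreducible-at : ∀ c → fromℕ ∣ c * + p ∣ <eval onesℚ ℓ at root ℓ (p ^ 2) →
      Irreducible (onesℚ ℓ ℚ[X].-ₚ constℚ (fromℤ (c * + p)))
    irreducible-at c N<Φ = irreducible (shifted N) (onesℚ ℓ ℚ[X].-ₚ constℚ (fromℤ N)) H≗
      (no-factors {d = d} c 1≤R p-prime A<p p∤bad p∣Φ refl N≤)
      where
      N = c * + p
      N≤ : ∣ N ∣ ≤ ℓ ℕ.* R ^ n
      N≤ = ℕ.≤-trans (ℤ.drop‿+≤+ (ℤ.≤-trans (<eval-root⇒≤ ℓ ℓ ∣ N ∣ (p ^ 2) R p²≤ N<Φ) (i≤∣i∣ (eval (ones ℓ) (+ R)))))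
        (eval-ones-≤ n (+ R) 1≤R ℕ.≤-refl)
        where
        i≤∣i∣ : ∀ i → i ℤ.≤ + ∣ i ∣
        i≤∣i∣ (+ i)    = ℤ.≤-refl
        i≤∣i∣ -[1+ i ] = ℤ.-≤+
      H≗ : ∀ z → evalℚ (onesℚ ℓ ℚ[X].-ₚ constℚ (fromℤ N)) (fromℤ z) ≡ fromℤ (monic (shifted N) z)
      H≗ z = begin
        evalℚ (onesℚ ℓ ℚ[X].-ₚ constℚ (fromℤ N)) (fromℤ z)
          ≡⟨ ℚ-eval.eval-+ₚ (onesℚ ℓ) (ℚ.- fromℤ N ∷ []) (fromℤ z) ⟩
        evalℚ (onesℚ ℓ) (fromℤ z) ℚ.+ evalℚ (ℚ.- fromℤ N ∷ []) (fromℤ z)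
          ≡⟨ cong₂ ℚ._+_ (eval-toℚ (ones ℓ) z) (ℚ-eval.eval-const (ℚ.- fromℤ N) (fromℤ z)) ⟩
        fromℤ (eval (ones ℓ) z) ℚ.- fromℤ N
          ≡⟨ cong (fromℤ (eval (ones ℓ) z) ℚ.+_) (sym (fromℤ-neg N)) ⟩
        fromℤ (eval (ones ℓ) z) ℚ.+ fromℤ (- N)    ≡⟨ sym (fromℤ-+ (eval (ones ℓ) z) (- N)) ⟩
        fromℤ (eval (ones ℓ) z - N)                ≡⟨ cong fromℤ (sym (monic-shifted N z)) ⟩
        fromℤ (monic (shifted N) z)                ∎
        where open ≡-Reasoning

-- Counting

length-partition : ∀ {P : ℕ → Set} (P? : ∀ x → Dec (P x)) xs →
  length xs ≡ length (List.filter P? xs) ℕ.+ length (List.filter (¬? ∘ P?) xs)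
length-partition P? [] = refl
length-partition P? (x ∷ xs) with P? x
... | yes _ = cong suc (length-partition P? xs)
... | no  _ = trans (cong suc (length-partition P? xs)) (sym (ℕ.+-suc _ _))

length-unique-< : ∀ N xs → Unique xs → All (_< N) xs → length xs ≤ N
length-unique-< zero    []       _    _        = z≤n
length-unique-< zero    (x ∷ xs) _    (() ∷ _)
length-unique-< (suc N) xs       uniq xs<1+N = begin
  length xs                              ≡⟨ length-partition (ℕ._≟ N) xs ⟩
  length equal ℕ.+ length different      ≤⟨ ℕ.+-mono-≤ (at-most-one equal (Unique.filter⁺ (ℕ._≟ N) uniq) (All.all-filter (ℕ._≟ N) xs))
    (length-unique-< N different (Unique.filter⁺ (¬? ∘ (ℕ._≟ N)) uniq)
      (All.zipWith (λ (x<1+N , x≢N) → ℕ.≤∧≢⇒< (ℕ.≤-pred x<1+N) x≢N)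
        (All.filter⁺ (¬? ∘ (ℕ._≟ N)) xs<1+N , All.all-filter (¬? ∘ (ℕ._≟ N)) xs))) ⟩
  suc N                                  ∎
  where
  open ℕ.≤-Reasoning
  equal     = List.filter (ℕ._≟ N) xs
  different = List.filter (¬? ∘ (ℕ._≟ N)) xs
  at-most-one : ∀ ys → Unique ys → All (_≡ N) ys → length ys ≤ 1
  at-most-one []           _                _                = z≤n
  at-most-one (y ∷ [])     _                _                = ℕ.≤-refl
  at-most-one (y ∷ z ∷ ys) ((y≢z ∷ _) ∷ _)  (refl ∷ refl ∷ _) = contradiction refl y≢z

module Counting {m} (ℓ-prime : Prime (suc (suc m))) where
  open Essentiality ℓ-prime
  private
    n = suc m
    ℓ = suc n

  Candidate : ℕ → ℕ → Set
  Candidate R p = Prime p × (∃ λ d → + p ∣ eval (ones ℓ) d) × p ^ 2 ≤ R ^ ℓ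

  -- Per unit of R, the first summand counts the primes up to 4 (A + 1), the second the prime
  -- divisors of the bad product.
  inessential-factor : ℕ
  inessential-factor = (4 ℕ.* subleading-factor n ℕ.+ 5) ℕ.+ bad-exponent ℓ-prime ℕ.* suc (subleading-factor n)

  1≤inessential-factor : 1 ≤ inessential-factor
  1≤inessential-factor = ℕ.≤-trans (ℕ.≤-trans (s≤s z≤n) (ℕ.m≤n+m 5 (4 ℕ.* subleading-factor n)))
    (ℕ.m≤m+n (4 ℕ.* subleading-factor n ℕ.+ 5) (bad-exponent ℓ-prime ℕ.* suc (subleading-factor n)))

  -- Essentiality is never decided: the list is sorted by size and by divisibility of the bad
  -- product, and what remains is essential. Q is carried along and later becomes membership in S^1.
  count-inessential : ∀ {Q : ℕ → Set} R → 1 ≤ R → ∀ xs → Unique xs → All (λ p → Q p × Candidate R p) xs →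
    ∃ λ ys → Unique ys × All (λ p → Q p × Essential ℓ p) ys × length xs ≤ inessential-factor ℕ.* R ℕ.+ length ys
  count-inessential {Q} R 1≤R xs uniq cands = ys , ys-unique , ys-essential , (begin
    length xs                                                   ≡⟨ length-partition small? xs ⟩
    length smalls ℕ.+ length larges                             ≡⟨ cong (length smalls ℕ.+_) (length-partition bad? larges) ⟩
    length smalls ℕ.+ (length bads ℕ.+ length ys)               ≡⟨ sym (ℕ.+-assoc (length smalls) (length bads) (length ys)) ⟩
    length smalls ℕ.+ length bads ℕ.+ length ys                 ≤⟨ ℕ.+-monoˡ-≤ (length ys) (ℕ.+-mono-≤ #smalls #bads) ⟩
    (4 ℕ.* s ℕ.+ 5) ℕ.* R ℕ.+ e ℕ.* suc s ℕ.* R ℕ.+ length ys   ≡⟨ cong (ℕ._+ length ys) (sym (ℕ.*-distribʳ-+ R (4 ℕ.* s ℕ.+ 5) (e ℕ.* suc s))) ⟩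
    inessential-factor ℕ.* R ℕ.+ length ys                      ∎)
    where
    open ℕ.≤-Reasoning
    s = subleading-factor n
    e = bad-exponent ℓ-prime
    A = modulus-bound R
    B = 4 ℕ.* suc A
    bad = bad-product ℓ-prime A
    small? = λ p → p ℕ.≤? B
    bad?   = λ p → p ℕ.∣? bad
    smalls = List.filter small? xs
    larges = List.filter (¬? ∘ small?) xs
    bads   = List.filter bad? larges
    ys     = List.filter (¬? ∘ bad?) larges

    larges-unique = Unique.filter⁺ (¬? ∘ small?) uniq
    ys-unique = Unique.filter⁺ (¬? ∘ bad?) larges-unique

    larges-> : All (B <_) larges
    larges-> = All.map ℕ.≰⇒> (All.all-filter (¬? ∘ small?) xs)

    larges-candidates : All (λ p → Q p × Candidate R p) larges
    larges-candidates = All.filter⁺ (¬? ∘ small?) cands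

    1+A≤ : suc A ≤ suc s ℕ.* R
    1+A≤ = ℕ.+-monoˡ-≤ A 1≤R

    #smalls : length smalls ≤ (4 ℕ.* s ℕ.+ 5) ℕ.* R
    #smalls = begin
      -- The numbers up to B are `suc B` many, which turns 4 s + 4 into 4 s + 5.
      length smalls                  ≤⟨ length-unique-< (suc B) smalls (Unique.filter⁺ small? uniq) (All.map s≤s (All.all-filter small? xs)) ⟩
      suc B                          ≤⟨ ℕ.+-mono-≤ 1≤R (ℕ.*-monoʳ-≤ 4 1+A≤) ⟩
      R ℕ.+ 4 ℕ.* (suc s ℕ.* R)      ≡⟨ rearrange s R ⟩
      (4 ℕ.* s ℕ.+ 5) ℕ.* R          ∎
      where
      rearrange : ∀ s R → R ℕ.+ 4 ℕ.* (suc s ℕ.* R) ≡ (4 ℕ.* s ℕ.+ 5) ℕ.* R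
      rearrange = ℕ-solve-∀

    #bads : length bads ≤ e ℕ.* suc s ℕ.* R
    #bads = begin
      length bads            ≤⟨ count-bad-primes ℓ-prime A bads (Unique.filter⁺ bad? larges-unique)
        (All.filter⁺ bad? (All.map (proj₁ ∘ proj₂) larges-candidates)) (All.filter⁺ bad? larges->) (All.all-filter bad? larges) ⟩
      e ℕ.* suc A            ≤⟨ ℕ.*-monoʳ-≤ e 1+A≤ ⟩
      e ℕ.* (suc s ℕ.* R)    ≡⟨ sym (ℕ.*-assoc e (suc s) R) ⟩
      e ℕ.* suc s ℕ.* R      ∎

    ys-essential : All (λ p → Q p × Essential ℓ p) ys
    ys-essential = All.zipWith
      (λ { ((B<p , q , p-prime , (d , p∣Φ) , p²≤) , p∤bad) → q , essential {d = d} 1≤R p-prime B<p p∤bad p∣Φ p²≤ })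
      (All.filter⁺ (¬? ∘ bad?) (All.zip (larges-> , larges-candidates)) , All.all-filter (¬? ∘ bad?) larges)

  -- With R = ⌊ M / X ⌋ the bound R is a small fraction of M, yet R^ℓ still
  -- exceeds Φ_ℓ(M) since ℓ > deg Φ_ℓ.
  power-bound : ∀ X M .{{_ : NonZero X}} → ℓ ℕ.* (2 ℕ.* X) ^ ℓ ≤ M → ℓ ℕ.* M ^ n ≤ (M ℕ./ X) ^ ℓ
  power-bound X M M₀≤M = ℕ.*-cancelˡ-≤ ((2 ℕ.* X) ^ ℓ) {{ℕ.m^n≢0 (2 ℕ.* X) ℓ {{ℕ.m*n≢0 2 X}}}} (begin
    (2 ℕ.* X) ^ ℓ ℕ.* (ℓ ℕ.* M ^ n)    ≡⟨ rearrange ((2 ℕ.* X) ^ ℓ) ℓ (M ^ n) ⟩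
    ℓ ℕ.* (2 ℕ.* X) ^ ℓ ℕ.* M ^ n      ≤⟨ ℕ.*-monoˡ-≤ (M ^ n) M₀≤M ⟩
    M ^ ℓ                              ≤⟨ ℕ.^-monoˡ-≤ ℓ M≤2XR ⟩
    (2 ℕ.* X ℕ.* (M ℕ./ X)) ^ ℓ        ≡⟨ ^-distribʳ-* ℓ (2 ℕ.* X) (M ℕ./ X) ⟩
    (2 ℕ.* X) ^ ℓ ℕ.* (M ℕ./ X) ^ ℓ    ∎)
    where
    open ℕ.≤-Reasoning
    rearrange : ∀ a b c → a ℕ.* (b ℕ.* c) ≡ b ℕ.* a ℕ.* c
    rearrange = ℕ-solve-∀
    R = M ℕ./ X
    X≤M : X ≤ M
    X≤M = begin
      X                            ≤⟨ ℕ.m≤n*m X 2 ⟩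
      2 ℕ.* X                      ≤⟨ ℕ.m≤m*n (2 ℕ.* X) ((2 ℕ.* X) ^ n) {{ℕ.m^n≢0 (2 ℕ.* X) n {{ℕ.m*n≢0 2 X}}}} ⟩
      (2 ℕ.* X) ^ ℓ                ≤⟨ ℕ.m≤n*m ((2 ℕ.* X) ^ ℓ) ℓ ⟩
      ℓ ℕ.* (2 ℕ.* X) ^ ℓ          ≤⟨ M₀≤M ⟩
      M                            ∎
    M≤2XR : M ≤ 2 ℕ.* X ℕ.* R
    M≤2XR = begin
      M                            ≡⟨ ℕ.m≡m%n+[m/n]*n M X ⟩
      M ℕ.% X ℕ.+ R ℕ.* X          ≤⟨ ℕ.+-monoˡ-≤ (R ℕ.* X) (ℕ.<⇒≤ (ℕ.m%n<n M X)) ⟩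
      X ℕ.+ R ℕ.* X                ≤⟨ ℕ.+-monoˡ-≤ (R ℕ.* X) (ℕ.m≤n*m X R {{ℕ.>-nonZero (ℕ.m≥n⇒m/n>0 X≤M)}}) ⟩
      R ℕ.* X ℕ.+ R ℕ.* X          ≡⟨ double R X ⟩
      2 ℕ.* X ℕ.* R                ∎
      where
      double : ∀ R X → R ℕ.* X ℕ.+ R ℕ.* X ≡ 2 ℕ.* X ℕ.* R
      double = ℕ-solve-∀

-- From the count to o(T)

least : ∀ {P : ℕ → Set} → (∀ n → Dec (P n)) → ∀ n → P n →
  ∃ λ k → k ≤ n × P k × (∀ d → P d → k ≤ d)
least P? zero    P0 = 0 , z≤n , P0 , λ _ _ → z≤n
least {P} P? (suc n) Pn with P? 0
... | yes P0 = 0 , z≤n , P0 , λ _ _ → z≤n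
... | no ¬P0 = let k , k≤n , Pk , k-least = least {P ∘ suc} (P? ∘ suc) n Pn in
  suc k , s≤s k≤n , Pk , λ { zero P0 → contradiction P0 ¬P0 ; (suc d) Pd → s≤s (k-least d Pd) }

floor : ∀ q → 0ℚ ℚ.≤ q → ∃ λ M → fromℕ M ℚ.≤ q × (∀ r → fromℕ r ℚ.≤ q → r ≤ M)
floor q@(mkℚ (+ a) d-1 _) _ = a ℕ./ suc d-1
  , subst (ℚ._≤ q) (sym (fromℤ≡mkℚ (+ (a ℕ./ suc d-1))))
      (ℚ.*≤* (subst₂ ℤ._≤_ (ℤ.pos-* (a ℕ./ suc d-1) (suc d-1)) (sym (ℤ.*-identityʳ (+ a)))
        (ℤ.+≤+ (ℕ.m/n*n≤m a (suc d-1)))))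
  , λ r r≤q → case subst (ℚ._≤ q) (fromℤ≡mkℚ (+ r)) r≤q of λ
      { (ℚ.*≤* r*d≤a) → ℕ.≤-trans (ℕ.≤-reflexive (sym (ℕ.m*n/n≡m r (suc d-1))))
          (ℕ./-monoˡ-≤ (suc d-1) (ℤ.drop‿+≤+ (subst₂ ℤ._≤_ (sym (ℤ.pos-* r (suc d-1))) (ℤ.*-identityʳ (+ a)) r*d≤a))) }
floor (mkℚ -[1+ a ] d-1 _) (ℚ.*≤* ())

-- Divisibility of Φ_ℓ(r) by p² bounds p² only because the value is not zero.
eval-ones-positive : ∀ n r → ∃ λ k → eval (ones (suc n)) (+ r) ≡ + suc k
eval-ones-positive zero    r = 0 , eval-const 1ℤ (+ r)
eval-ones-positive (suc n) r with eval-ones-positive n r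
... | k , eq = r ℕ.* suc k , trans (cong (λ u → 1ℤ + + r * u) eq) (cong (_+_ 1ℤ) (sym (ℤ.pos-* r (suc k))))

-- The product is the numerator of ε, a positive integer; so the denominator serves as an explicit
-- bound for 1 / ε.
1≤ε*↧ε : ∀ {ε} → 0ℚ ℚ.< ε → 1ℚ ℚ.≤ ε ℚ.* fromℤ (ℚ.↧ ε)
1≤ε*↧ε {ε@(mkℚ (+ suc a) d-1 _)} 0<ε = subst (1ℚ ℚ.≤_)
  (trans (sym (fromℤ-↧*p≡↥p ε)) (ℚ.*-comm (fromℤ (ℚ.↧ ε)) ε)) (fromℕ-mono-≤ {1} {suc a} (s≤s z≤n))
1≤ε*↧ε {mkℚ (+ 0) d-1 _}    (ℚ.*<* (ℤ.+<+ ()))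
1≤ε*↧ε {mkℚ -[1+ a ] d-1 _} (ℚ.*<* ())

module _ {m} (ℓ-prime : Prime (suc (suc m))) where
  open Counting ℓ-prime
  private
    n = suc m
    ℓ = suc n

  -- p divides Φ_ℓ(r) as well, but the least argument for p may be smaller than r and has to be
  -- searched for.
  S²⇒S¹ : ∀ {T p} → S 2 ℓ T p → S 1 ℓ T p
  S²⇒S¹ {T} {p} (p∈ℙ , [ r ] , (p²∣Φ , _) , r≤T) =
    let k , k≤r , p∣Φ , k-least = least (λ d → p ^ 1 ℕ.∣? ∣ eval (Φ ℓ) (+ d) ∣) r
          (ℕ.∣-trans (ℕ.∣n⇒∣m*n p ℕ.∣-refl) p²∣Φ)
    in  p∈ℙ , [ k ] , (p∣Φ , k-least) , λ q T<q → ℚ.≤-trans (fromℕ-mono-≤ k≤r) (r≤T q T<q)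

  S²⇒Candidate : ∀ {T q M R p} → T <ʳ q → 1 ≤ M → (∀ r → fromℕ r ℚ.≤ q → r ≤ M) → ℓ ℕ.* M ^ n ≤ R ^ ℓ →
    S 2 ℓ T p → Candidate R p
  S²⇒Candidate {T} {q} {M} {R} {p} T<q 1≤M ≤M Φ[M]≤ ((p-prime , d , p∣Φ) , [ r ] , (p²∣Φ , _) , r≤T) =
    p-prime , (+ d , subst (λ f → + p ∣ eval f (+ d)) Φ≡ (ℤ.∣ᵤ⇒∣ p∣Φ)) , (begin
      p ^ 2                          ≤⟨ ℕ.∣⇒≤ {{Φ≢0}} (subst (λ f → p ^ 2 ℕ.∣ ∣ eval f (+ r) ∣) Φ≡ p²∣Φ) ⟩
      ∣ eval (ones ℓ) (+ r) ∣        ≤⟨ eval-ones-≤ n (+ r) 1≤M (≤M r (r≤T q T<q)) ⟩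
      ℓ ℕ.* M ^ n                    ≤⟨ Φ[M]≤ ⟩
      R ^ ℓ                          ∎)
    where
    open ℕ.≤-Reasoning
    Φ≡ = Φ-prime m ℓ-prime
    Φ≢0 : NonZero ∣ eval (ones ℓ) (+ r) ∣
    Φ≢0 with eval-ones-positive n r
    ... | k , eq = subst (λ i → NonZero ∣ i ∣) (sym eq) _

  few-squares : ∣ (λ T p → S 1 ℓ T p × Essential ℓ p) ∣=o[T] → ∣ S 2 ℓ ∣=o[T]
  few-squares few-essential ε 0<ε = T₀ , bound
    where
    ε/2 = ℚ.½ ℚ.* ε
    0<ε/2 : 0ℚ ℚ.< ε/2
    0<ε/2 = ℚ.positive⁻¹ ε/2 {{ℚ.pos*pos⇒pos ℚ.½ ε {{ℚ.positive 0<ε}}}}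

    e = ℚ.↧ₙ ε/2
    -- With R = ⌊ M / X ⌋ the O(R) term is at most M / e, and 1 / e ≤ ε/2; the other half of ε is
    -- left to the essential primes.
    X = e ℕ.* inessential-factor
    instance
      X≢0 : NonZero X
      X≢0 = ℕ.m*n≢0 e inessential-factor {{_}} {{ℕ.>-nonZero 1≤inessential-factor}}

    M₀ = ℓ ℕ.* (2 ℕ.* X) ^ ℓ
    T₁ = proj₁ (few-essential ε/2 0<ε/2)
    T₀ = T₁ ℚ.⊔ fromℕ M₀

    bound : ∀ T → T₀ ≤ˡ T → ∣ S 2 ℓ T ∣≤ ε · T
    -- The real T is accessible only through rationals q above it, so M = ⌊ q ⌋ and R depend on q,
    -- and the count is made anew for each q.
    bound T T₀≤T xs xs-unique xs∈S² q T<q = begin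
      fromℕ (length xs)                                       ≤⟨ fromℕ-mono-≤ #xs≤ ⟩
      fromℕ (inessential-factor ℕ.* R ℕ.+ length ys)          ≡⟨ fromℤ-+ (+ (inessential-factor ℕ.* R)) (+ length ys) ⟩
      fromℕ (inessential-factor ℕ.* R) ℚ.+ fromℕ (length ys)  ≤⟨ ℚ.+-mono-≤ inessential≤ essential≤ ⟩
      ε/2 ℚ.* q ℚ.+ ε/2 ℚ.* q                                 ≡⟨ sym (ℚ.*-distribʳ-+ q ε/2 ε/2) ⟩
      (ε/2 ℚ.+ ε/2) ℚ.* q                                     ≡⟨ cong (ℚ._* q) (trans (sym (ℚ.*-distribʳ-+ ε ℚ.½ ℚ.½)) (ℚ.*-identityˡ ε)) ⟩
      ε ℚ.* q                                                 ∎
      where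
      open ℚ.≤-Reasoning
      M₀≤q : fromℕ M₀ ℚ.≤ q
      M₀≤q = ℚ.≤-trans (ℚ.p≤q⊔p T₁ (fromℕ M₀)) (T₀≤T q T<q)

      floor-q = floor q (ℚ.≤-trans (0≤fromℕ M₀) M₀≤q)
      M = proj₁ floor-q
      M≤q : fromℕ M ℚ.≤ q
      M≤q = proj₁ (proj₂ floor-q)
      ≤M : ∀ r → fromℕ r ℚ.≤ q → r ≤ M
      ≤M = proj₂ (proj₂ floor-q)
      M₀≤M : M₀ ≤ M
      M₀≤M = ≤M M₀ M₀≤q
      X≤M₀ : X ≤ M₀
      X≤M₀ = ℕ.≤-trans (ℕ.m≤n*m X 2) (ℕ.≤-trans
        (ℕ.m≤m*n (2 ℕ.* X) ((2 ℕ.* X) ^ n) {{ℕ.m^n≢0 (2 ℕ.* X) n {{ℕ.m*n≢0 2 X}}}}) (ℕ.m≤n*m ((2 ℕ.* X) ^ ℓ) ℓ))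
      X≤M : X ≤ M
      X≤M = ℕ.≤-trans X≤M₀ M₀≤M
      R = M ℕ./ X
      1≤R : 1 ≤ R
      1≤R = ℕ.m≥n⇒m/n>0 X≤M
      1≤M : 1 ≤ M
      1≤M = ℕ.≤-trans (ℕ.>-nonZero⁻¹ X) X≤M

      counted = count-inessential {Q = S 1 ℓ T} R 1≤R xs xs-unique
        (All.map (λ p∈S² → S²⇒S¹ {T} p∈S² , S²⇒Candidate {T} {R = R} T<q 1≤M ≤M (power-bound X M M₀≤M) p∈S²) xs∈S²)
      ys = proj₁ counted
      #xs≤ : length xs ≤ inessential-factor ℕ.* R ℕ.+ length ys
      #xs≤ = proj₂ (proj₂ (proj₂ counted))

      essential≤ : fromℕ (length ys) ℚ.≤ ε/2 ℚ.* q
      essential≤ = proj₂ (few-essential ε/2 0<ε/2) T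
        (λ q′ T<q′ → ℚ.≤-trans (ℚ.p≤p⊔q T₁ (fromℕ M₀)) (T₀≤T q′ T<q′))
        ys (proj₁ (proj₂ counted)) (proj₁ (proj₂ (proj₂ counted))) q T<q

      inessential≤ : fromℕ (inessential-factor ℕ.* R) ℚ.≤ ε/2 ℚ.* q
      inessential≤ = begin
        fromℕ (inessential-factor ℕ.* R)                        ≡⟨ sym (ℚ.*-identityˡ _) ⟩
        1ℚ ℚ.* fromℕ (inessential-factor ℕ.* R)
          ≤⟨ ℚ.*-monoʳ-≤-nonNeg (fromℕ (inessential-factor ℕ.* R)) {{ℚ.nonNegative (0≤fromℕ (inessential-factor ℕ.* R))}} (1≤ε*↧ε 0<ε/2) ⟩
        (ε/2 ℚ.* fromℕ e) ℚ.* fromℕ (inessential-factor ℕ.* R)  ≡⟨ ℚ.*-assoc ε/2 (fromℕ e) _ ⟩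
        ε/2 ℚ.* (fromℕ e ℚ.* fromℕ (inessential-factor ℕ.* R))
          ≡⟨ cong (ε/2 ℚ.*_) (trans (sym (fromℕ-* e (inessential-factor ℕ.* R)))
               (cong fromℕ (trans (sym (ℕ.*-assoc e inessential-factor R)) (ℕ.*-comm X R)))) ⟩
        ε/2 ℚ.* fromℕ (R ℕ.* X)
          ≤⟨ ℚ.*-monoˡ-≤-nonNeg ε/2 {{ℚ.nonNegative (ℚ.<⇒≤ 0<ε/2)}} (ℚ.≤-trans (fromℕ-mono-≤ (ℕ.m/n*n≤m M X)) M≤q) ⟩
        ε/2 ℚ.* q                                               ∎

theorem4 : (ℓ : ℕ) .{{_ : NonZero ℓ}} → Prime ℓ → 2 ∤ ℓ →
    ∣ (λ T p → S 1 ℓ T p × Essential ℓ p) ∣=o[T] →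
    ∣ S 2 ℓ ∣=o[T]
theorem4 zero          ℓ-prime _ = contradiction ℓ-prime ¬prime[0]
theorem4 (suc zero)    ℓ-prime _ = contradiction ℓ-prime ¬prime[1]
theorem4 (suc (suc m)) ℓ-prime _ = few-squares ℓ-prime
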